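{- Let $K$ be a global function field of characteristic $p$, let $v$ be a normalized nontrivial valuation on $K$, let $K_v$ be the completion of $K$ at $v$ and $A_v$ its valuation ring. Let $\pi\in K_v$ with $v(\pi)$ a positive integer, and let $\Gamma\subset A_v$ be a complete set of representatives of $A_v/\pi A_v$. Suppose $\Gamma$ is additively closed, i.e. $\mu+\nu\in\Gamma$ for all $\mu,\nu\in\Gamma$. Then $(\Gamma,\pi)$ has property B if and only if $\pi$ and all elements of $\Gamma$ are algebraic over $K$.
   Context: A global function field of characteristic $p$ is a field $K\supset\mathbb{F}_p$ containing an element $x$ transcendental over $\mathbb{F}_p$ with $[K:\mathbb{F}_p(x)]<\infty$. A valuation on $K$ is a map $v:K^*\to\mathbb{Z}$ with $v(ab)=v(a)+v(b)$ and $v(a+b)\ge\min\{v(a),v(b)\}$, with $v(0)=+\infty$; it is normalized if $v(K^*)=\mathbb{Z}$. The valuation extends to the completion $K_v$, with valuation ring $A_v$. A complete set of representatives of $A_v/\pi A_v$ is a subset $\Gamma\subset A_v$ containing exactly one element of each residue class modulo $\pi A_v$ (it is finite). An expansion of $x\in K_v$ with respect to $(\Gamma,\pi)$ is a representation $x=\sum_{n\ge m}a_n\pi^n$ with $m\in\mathbb{Z}$ and $a_n\in\Gamma$ for all $n\ge m$; for each $m$ with $x\in\pi^mA_v$ there is exactly one such expansion starting at $m$. Its sequence of coefficients is $\{a_n\}_{n\ge m}$. A sequence $\{a_n\}_{n\ge m}$ is $p$-automatic if its $p$-kernel, i.e. the set of sequences $\{a_{np^i+j+m}\}_{n\ge0}$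 with $i\ge0$ and $0\le j<p^i$, is finite. $(\Gamma,\pi)$ has property B if for every $x\in K_v$ and every expansion $x=\sum_{n\ge m}a_n\pi^n$ with respect to $(\Gamma,\pi)$: $x$ is algebraic over $K$ if and only if $\{a_n\}_{n\ge m}$ is $p$-automatic. -}

module Defs where

open import Level using (Level; suc; _⊔_)
open import Algebra.Bundles using (CommutativeRing; Semiring)
open import Algebra.Construct.Add.Identity using (liftOp)
import Algebra.Definitions.RawSemiring as RawSemiringDefs
open import Algebra.Morphism.Structures using (module RingMorphisms)
open import Data.Fin.Base using (Fin; toℕ)
open import Data.Integer.Base as ℤ using (ℤ; +_; -[1+_]; 0ℤ)
open import Data.List.Base using (List)
open import Data.List.Relation.Unary.Any using (Any)
open import Data.Nat.Base as ℕ using (ℕ)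
open import Data.Nat.Primality using (Prime)
open import Data.Product.Base using (∃; _×_)
open import Function.Bundles using (_⇔_)
open import Relation.Binary.Core using (Rel)
open import Relation.Binary.Definitions using (_Respects_)
import Relation.Binary.Construct.Add.Supremum.NonStrict as AddSupremum
open import Relation.Binary.PropositionalEquality.Core using (_≡_; _≢_)
open import Relation.Nullary.Construct.Add.Supremum using (_⁺; ⊤⁺; [_])
open import Relation.Nullary.Negation.Core using (¬_)
open import Relation.Unary using (Pred; _∈_; _⊆_; ∅)

-- The value of 0# ⁻¹ is left unspecified.
record Field (c ℓ : Level) : Set (suc (c ⊔ ℓ)) where
  infix 9 _⁻¹
  field
    commutativeRing : CommutativeRing c ℓ
  open CommutativeRing commutativeRing public
  field
    0≉1         : 0# ≉ 1#
    _⁻¹         : Carrier → Carrier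
    ⁻¹-cong     : ∀ {a b} → a ≈ b → a ⁻¹ ≈ b ⁻¹
    ⁻¹-inverseʳ : ∀ {a} → a ≉ 0# → a * a ⁻¹ ≈ 1#

module FieldTheory {c ℓ : Level} (K : Field c ℓ) where
  open Field K
  open RawSemiringDefs (Semiring.rawSemiring semiring) public
    using (_^_; sum) renaming (_×_ to _·_)

  infixr 8 _^ℤ_

  -- Meaningful for a ≉ 0# or a nonnegative exponent.
  _^ℤ_ : Carrier → ℤ → Carrier
  a ^ℤ (+ n)    = a ^ n
  a ^ℤ -[1+ n ] = (a ⁻¹) ^ ℕ.suc n

  -- The smallest subfield of K containing S.
  data Generated {s : Level} (S : Pred Carrier s) : Pred Carrier (c ⊔ ℓ ⊔ s) where
    gen  : ∀ {a} → a ∈ S → a ∈ Generated S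
    one  : 1# ∈ Generated S
    add  : ∀ {a b} → a ∈ Generated S → b ∈ Generated S → a + b ∈ Generated S
    neg  : ∀ {a} → a ∈ Generated S → - a ∈ Generated S
    mul  : ∀ {a b} → a ∈ Generated S → b ∈ Generated S → a * b ∈ Generated S
    inv  : ∀ {a} → a ≉ 0# → a ∈ Generated S → a ⁻¹ ∈ Generated S
    resp : ∀ {a b} → a ≈ b → a ∈ Generated S → b ∈ Generated S

  PrimeField : Pred Carrier (c ⊔ ℓ)
  PrimeField = Generated ∅

  -- a is a root of a nonzero polynomial Σ_{i<d} fᵢ Xⁱ with coefficients in F.
  AlgebraicOver : {s : Level} → Pred Carrier s → Pred Carrier (c ⊔ ℓ ⊔ s)
  AlgebraicOver F a = ∃ λ (d : ℕ) → ∃ λ (f : Fin d → Carrier) →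
    (∀ i → f i ∈ F) ×
    (∃ λ i → f i ≉ 0#) ×
    sum (λ i → f i * a ^ toℕ i) ≈ 0#

  -- K is spanned by finitely many elements as a vector space over F.
  FiniteOver : {s : Level} → Pred Carrier s → Set (c ⊔ ℓ ⊔ s)
  FiniteOver F = ∃ λ (d : ℕ) → ∃ λ (e : Fin d → Carrier) →
    ∀ a → ∃ λ (f : Fin d → Carrier) →
      (∀ i → f i ∈ F) × (a ≈ sum (λ i → f i * e i))

-- K ⊃ 𝔽_p is rendered as: p is prime and p · 1 = 0 in K. The prime field
-- is then 𝔽_p, and the subfield generated by x is 𝔽_p(x).
record IsGlobalFunctionField {c ℓ : Level} (p : ℕ) (K : Field c ℓ) : Set (c ⊔ ℓ) where
  open Field K
  open FieldTheory K
  field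
    prime          : Prime p
    characteristic : p · 1# ≈ 0#
    x              : Carrier
    transcendental : ¬ (x ∈ AlgebraicOver PrimeField)
    finite         : FiniteOver (Generated (x ≈_))

ℤ∞ : Set
ℤ∞ = ℤ ⁺

open AddSupremum ℤ._≤_ public using () renaming (_≤⁺_ to _≤∞_)

infixl 6 _+∞_
_+∞_ : ℤ∞ → ℤ∞ → ℤ∞
[ m ] +∞ [ n ] = [ m ℤ.+ n ]
[ _ ] +∞ ⊤⁺    = ⊤⁺
⊤⁺    +∞ _     = ⊤⁺

-- ∞ is the identity element for the minimum.
infixl 7 _⊓∞_
_⊓∞_ : ℤ∞ → ℤ∞ → ℤ∞
_⊓∞_ = liftOp ℤ._⊓_

-- A map K^* → ℤ, extended by the value ∞ at 0 (and only there).
record Valuation {c ℓ : Level} (K : Field c ℓ) : Set (c ⊔ ℓ) where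
  open Field K
  field
    val      : Carrier → ℤ∞
    val-cong : ∀ {a b} → a ≈ b → val a ≡ val b
    val-∞    : ∀ a → val a ≡ ⊤⁺ ⇔ a ≈ 0#
    val-*    : ∀ a b → val (a * b) ≡ val a +∞ val b
    val-+    : ∀ a b → val a ⊓∞ val b ≤∞ val (a + b)

module ValuedField {c ℓ : Level} {K : Field c ℓ} (v : Valuation K) where
  open Field K
  open Valuation v
  open FieldTheory K

  Nontrivial : Set (c ⊔ ℓ)
  Nontrivial = ∃ λ a → a ≉ 0# × val a ≢ [ 0ℤ ]

  Normalized : Set c
  Normalized = ∀ (n : ℤ) → ∃ λ a → val a ≡ [ n ]

  ConvergesTo : (ℕ → Carrier) → Carrier → Set
  ConvergesTo s a = ∀ (n : ℤ) → ∃ λ (N : ℕ) →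
    ∀ i → N ℕ.≤ i → [ n ] ≤∞ val (s i - a)

  Cauchy : (ℕ → Carrier) → Set
  Cauchy s = ∀ (n : ℤ) → ∃ λ (N : ℕ) →
    ∀ i j → N ℕ.≤ i → N ℕ.≤ j → [ n ] ≤∞ val (s i - s j)

  Complete : Set c
  Complete = ∀ s → Cauchy s → ∃ λ a → ConvergesTo s a

  ValuationRing : Pred Carrier _
  ValuationRing a = [ 0ℤ ] ≤∞ val a

  PositiveValuation : Pred Carrier _
  PositiveValuation a = ∃ λ (n : ℤ) → 0ℤ ℤ.< n × val a ≡ [ n ]

  -- Congruence modulo π A_v.
  infix 4 _≅_[mod_]
  _≅_[mod_] : Carrier → Carrier → Carrier → Set (c ⊔ ℓ)
  a ≅ b [mod π ] = ∃ λ r → r ∈ ValuationRing × (a - b ≈ π * r)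

  record IsCompleteRepresentatives {g : Level} (Γ : Pred Carrier g) (π : Carrier)
      : Set (c ⊔ ℓ ⊔ g) where
    field
      respects : Γ Respects _≈_
      integral : Γ ⊆ ValuationRing
      exists   : ∀ a → a ∈ ValuationRing → ∃ λ γ → γ ∈ Γ × (a ≅ γ [mod π ])
      unique   : ∀ {γ δ} → γ ∈ Γ → δ ∈ Γ → γ ≅ δ [mod π ] → γ ≈ δ

  AdditivelyClosed : {g : Level} → Pred Carrier g → Set (c ⊔ g)
  AdditivelyClosed Γ = ∀ {μ ν} → μ ∈ Γ → ν ∈ Γ → μ + ν ∈ Γ

  -- The expansion x = Σ_{n≥m} aₙ πⁿ. Throughout, a sequence {aₙ}_{n≥m} is
  -- stored as a function on ℕ with value a_{m+k} at k.
  IsExpansion : {g : Level} → Pred Carrier g → Carrier →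
                Carrier → ℤ → (ℕ → Carrier) → Set g
  IsExpansion Γ π x m a =
    (∀ k → a k ∈ Γ) ×
    ConvergesTo (λ N → sum {N} (λ i → a (toℕ i) * π ^ℤ (m ℤ.+ + toℕ i))) x

-- P has, up to _∼_, exactly the entries of some list as its elements.
IsFinite : {a r s : Level} {A : Set a} → Rel A r → Pred A s → Set (a ⊔ r ⊔ s)
IsFinite {A = A} _∼_ P = ∃ λ (xs : List A) → ∀ x → x ∈ P ⇔ Any (x ∼_) xs

module Automata {c ℓ : Level} (K : Field c ℓ) where
  open Field K

  infix 4 _≗_
  _≗_ : Rel (ℕ → Carrier) ℓ
  s ≗ t = ∀ n → s n ≈ t n

  -- The index np^i + j + m becomes np^i + j after the shift by m.
  Kernel : ℕ → (ℕ → Carrier) → Pred (ℕ → Carrier) ℓ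
  Kernel p a s = ∃ λ (i : ℕ) → ∃ λ (j : ℕ) →
    j ℕ.< p ℕ.^ i × s ≗ (λ n → a (n ℕ.* p ℕ.^ i ℕ.+ j))

  Automatic : ℕ → (ℕ → Carrier) → Set (c ⊔ ℓ)
  Automatic p a = IsFinite _≗_ (Kernel p a)

-- A completion is taken to be any complete valued field containing K as a
-- dense subfield with the given valuation; it is unique up to isomorphism.
record Completion {c ℓ : Level} {K : Field c ℓ} (v : Valuation K) (c′ ℓ′ : Level)
    : Set (c ⊔ ℓ ⊔ suc (c′ ⊔ ℓ′)) where
  field
    K̂  : Field c′ ℓ′
    v̂  : Valuation K̂
  private
    module K = Field K
    module K̂ = Field K̂
  open Valuation
  field
    ι       : K.Carrier → K̂.Carrier
    ι-homo  : RingMorphisms.IsRingHomomorphism K.rawRing K̂.rawRing ι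
    extends : ∀ a → val v̂ (ι a) ≡ val v a
    dense   : ∀ x (n : ℤ) → ∃ λ a → [ n ] ≤∞ val v̂ (x K̂.- ι a)
    complete : ValuedField.Complete v̂

  open ValuedField v̂
  open FieldTheory K̂
  open Automata K̂

  AlgebraicOverK : Pred K̂.Carrier (c ⊔ c′ ⊔ ℓ′)
  AlgebraicOverK = AlgebraicOver (λ y → ∃ λ a → y K̂.≈ ι a)

  PropertyB : {g : Level} → ℕ → Pred K̂.Carrier g → K̂.Carrier → Set (c ⊔ c′ ⊔ ℓ′ ⊔ g)
  PropertyB p Γ π = ∀ x m a → IsExpansion Γ π x m a →
    x ∈ AlgebraicOverK ⇔ Automatic p a

{-# OPTIONS --safe #-}
module Submission where

-- Property B forces π and Γ to be algebraic because the finite expansions γ and γ π have automatic digits. Conversely, Γ is a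
-- finite 𝔽_p-space with a basis γ₁, …, γᵣ, so a digit sequence splits into sequences with values in 𝔽_p. If such a sequence has
-- a finite kernel, the power series yₖ of its kernel satisfy yₖ ∈ Σ 𝔽_p[π] y_l^p, and iterating this relation makes the powers
-- yₖ, yₖ^p, yₖ^(p²), … linearly dependent over 𝔽_p(π): the series is algebraic.
--
-- For algebraic x, let t be a uniformizer in K, so that the completion is κ((t)) with κ finite, and let C be the Cartier operator
-- reading off the last component of y = Σ_{j<p} tʲ yⱼ^p. The residue at t satisfies res(y z^p) = res(C(y) z)^p, so for an additive map
-- ρ : κ → 𝔽_p and h algebraic the kernel of n ↦ ρ(res(h π⁻ⁿ⁻¹)) is governed by the iterates of h under y ↦ C(πᵏ y), which stay in a
-- finite set: over a basis of a finite extension of 𝔽_p(t), C divides degrees by p. It remains to see that the coordinate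
-- sequences of the digits of x have this form. The functional f(z) = Σₙ ρ(res(z π⁻ⁿ⁻¹)) πⁿ is 𝔽_p((π))-linear and, by the two facts
-- above, maps algebraic elements to algebraic ones; hence the basis dual to γ with respect to f consists of algebraic elements hⱼ,
-- and the j-th coordinate of x is f(hⱼ x).

open import Defs
open import Level using (Level; _⊔_; Lift; lift; lower)
open import Axiom.ExcludedMiddle using (ExcludedMiddle)
open import Algebra.Bundles using (CommutativeRing)
open import Algebra.Morphism.Structures using (module RingMorphisms)
import Algebra.Solver.Ring as RingSolver
open import Algebra.Solver.Ring.AlmostCommutativeRing using (fromCommutativeRing; _-Raw-AlmostCommutative⟶_)
import Algebra.Properties.Semiring.Mult as SemiringMult
import Algebra.Properties.Semiring.Mult.TCOptimised as SemiringMultTC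
import Algebra.Properties.Semiring.Exp as SemiringExp
import Algebra.Properties.CommutativeSemiring.Exp as CommSemiringExp
import Algebra.Properties.CommutativeSemiring.Binomial as Binomial
import Algebra.Properties.Semiring.Sum as SemiringSum
import Algebra.Properties.Ring as RingProps
import Algebra.Properties.AbelianGroup as AbelianGroupProps
open import Data.Nat.Base as ℕ using (ℕ; zero; suc; NonZero; z≤n; s≤s; _!)
import Data.Nat.Properties as ℕₚ
open import Data.Nat.Divisibility using (m≤n⇒m!∣n!; _∣_; divides; ∣⇒≤; ∣-trans; m∣m*n)
open import Data.Nat.DivMod using (_/_; _%_; m≡m%n+[m/n]*n; m%n<n; m/n*n≡m; m<n*o⇒m/o<n)
open import Data.Nat.Primality using (Prime; euclidsLemma)
import Data.Nat.Primality as Primality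
open import Data.Nat.Combinatorics using (_C_; nCn≡1; k![n∸k]!∣n!)
open import Data.Nat.Combinatorics.Specification using (nCk≡n!/k![n-k]!)
open import Data.Integer.Base as ℤ using (ℤ; +_; -[1+_]; 0ℤ; 1ℤ; _⊖_)
import Data.Integer.Properties as ℤₚ
open import Data.Fin.Base as Fin using (Fin; zero; suc; toℕ; fromℕ; fromℕ<; inject₁; punchIn; combine; remQuot)
import Data.Fin.Properties as Finₚ
open import Data.Fin.Relation.Unary.Top as Top using (view; ‵fromℕ; ‵inject₁)
open import Data.Vec.Functional using (tail; init; last; removeAt; insertAt)
import Data.Vec.Functional.Properties as Vecₚ
open import Data.List.Base as List using (List; []; _∷_; length)
open import Data.List.Relation.Unary.Any as Any using (Any; here; there)
import Data.List.Relation.Unary.Any.Properties as Anyₚ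
open import Data.Maybe.Base using (Maybe; just; nothing)
open import Data.Product.Base using (∃; ∃₂; _×_; _,_; proj₁; proj₂)
open import Data.Sum.Base using (_⊎_; inj₁; inj₂)
open import Data.Empty using (⊥-elim)
open import Function.Base using (_∘_; id)
open import Function.Bundles using (_⇔_; mk⇔; Equivalence)
open import Relation.Binary.PropositionalEquality as ≡ using (_≡_; _≢_)
open import Relation.Binary.Core using (Rel)
import Relation.Binary.Definitions as Tri
open import Relation.Nullary using (¬_; Dec; yes; no)
open import Relation.Nullary.Negation using (contradiction)
import Relation.Nullary.Decidable as Dec
open import Relation.Unary using (Pred; _∈_; _⊆_)
import Relation.Binary.Reasoning.Setoid as SetoidReasoning
open import Relation.Nullary.Construct.Add.Supremum using (⊤⁺; [_])
import Relation.Binary.Construct.Add.Supremum.NonStrict as Supremum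

lowerEM : ∀ {a} b → ExcludedMiddle (a ⊔ b) → ExcludedMiddle a
lowerEM b em {P} = Dec.map′ lower lift (em {Lift b P})

module IntegerSolver {c ℓ : Level} (R : CommutativeRing c ℓ) where
  open CommutativeRing R hiding (zero)
  open SemiringMult semiring using (×-homo-+; ×1-homo-*) renaming (_×_ to _·_)
  open SemiringMultTC semiring using (×ᵤ≈×) renaming (_×_ to _·′_)
  open RingProps ring using (-‿distribˡ-*; -‿distribʳ-*; -0#≈0#; -‿involutive; -‿+-comm)
  open SetoidReasoning setoid

  private
    ⟦_⟧ : ℤ → Carrier
    ⟦ + n ⟧      = n · 1#
    ⟦ -[1+ n ] ⟧ = - (suc n · 1#)

    cancel : ∀ a b d → a + b + - (a + d) ≈ b + - d
    cancel a b d = begin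
      a + b + - (a + d)       ≈⟨ +-congˡ (-‿+-comm a d) ⟨
      a + b + (- a + - d)     ≈⟨ +-congʳ (+-comm a b) ⟩
      b + a + (- a + - d)     ≈⟨ +-assoc b a _ ⟩
      b + (a + (- a + - d))   ≈⟨ +-congˡ (+-assoc a (- a) _) ⟨
      b + ((a + - a) + - d)   ≈⟨ +-congˡ (+-congʳ (-‿inverseʳ a)) ⟩
      b + (0# + - d)          ≈⟨ +-congˡ (+-identityˡ _) ⟩
      b + - d                 ∎

    ⊖-homo : ∀ m n → ⟦ m ⊖ n ⟧ ≈ m · 1# + - (n · 1#)
    ⊖-homo m       zero    = sym (trans (+-congˡ -0#≈0#) (+-identityʳ _))
    ⊖-homo zero    (suc n) = sym (+-identityˡ _)
    ⊖-homo (suc m) (suc n) = begin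
      ⟦ suc m ⊖ suc n ⟧               ≡⟨ ≡.cong ⟦_⟧ (ℤₚ.[1+m]⊖[1+n]≡m⊖n m n) ⟩
      ⟦ m ⊖ n ⟧                       ≈⟨ ⊖-homo m n ⟩
      m · 1# + - (n · 1#)             ≈⟨ cancel 1# _ _ ⟨
      suc m · 1# + - (suc n · 1#)     ∎

    +-homo : ∀ i j → ⟦ i ℤ.+ j ⟧ ≈ ⟦ i ⟧ + ⟦ j ⟧
    +-homo (+ m)    (+ n)    = ×-homo-+ 1# m n
    +-homo (+ m)    -[1+ n ] = ⊖-homo m (suc n)
    +-homo -[1+ m ] (+ n)    = trans (⊖-homo n (suc m)) (+-comm _ _)
    +-homo -[1+ m ] -[1+ n ] = begin
      - (suc (suc (m ℕ.+ n)) · 1#)        ≡⟨ ≡.cong (λ k → - (suc k · 1#)) (≡.sym (ℕₚ.+-suc m n)) ⟩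
      - ((suc m ℕ.+ suc n) · 1#)          ≈⟨ -‿cong (×-homo-+ 1# (suc m) (suc n)) ⟩
      - (suc m · 1# + suc n · 1#)         ≈⟨ -‿+-comm _ _ ⟨
      - (suc m · 1#) + - (suc n · 1#)     ∎

    neg-homo : ∀ i → ⟦ ℤ.- i ⟧ ≈ - ⟦ i ⟧
    neg-homo (+ zero)  = sym -0#≈0#
    neg-homo (+ suc n) = refl
    neg-homo -[1+ n ]  = sym (-‿involutive _)

    *⁺-homo : ∀ m j → ⟦ + m ℤ.* j ⟧ ≈ ⟦ + m ⟧ * ⟦ j ⟧
    *⁺-homo m (+ n) = trans (reflexive (≡.cong ⟦_⟧ (≡.sym (ℤₚ.pos-* m n)))) (×1-homo-* m n)
    *⁺-homo m -[1+ n ] = begin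
      ⟦ + m ℤ.* -[1+ n ] ⟧          ≡⟨ ≡.cong ⟦_⟧ (ℤₚ.neg-distribʳ-* (+ m) (+ suc n)) ⟨
      ⟦ ℤ.- (+ m ℤ.* + suc n) ⟧     ≈⟨ neg-homo (+ m ℤ.* + suc n) ⟩
      - ⟦ + m ℤ.* + suc n ⟧         ≈⟨ -‿cong (*⁺-homo m (+ suc n)) ⟩
      - (m · 1# * (suc n · 1#))     ≈⟨ -‿distribʳ-* _ _ ⟩
      m · 1# * - (suc n · 1#)       ∎

    *-homo : ∀ i j → ⟦ i ℤ.* j ⟧ ≈ ⟦ i ⟧ * ⟦ j ⟧
    *-homo (+ m)    j = *⁺-homo m j
    *-homo -[1+ m ] j = begin
      ⟦ -[1+ m ] ℤ.* j ⟧          ≡⟨ ≡.cong ⟦_⟧ (ℤₚ.neg-distribˡ-* (+ suc m) j) ⟨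
      ⟦ ℤ.- (+ suc m ℤ.* j) ⟧     ≈⟨ neg-homo (+ suc m ℤ.* j) ⟩
      - ⟦ + suc m ℤ.* j ⟧         ≈⟨ -‿cong (*⁺-homo (suc m) j) ⟩
      - (suc m · 1# * ⟦ j ⟧)      ≈⟨ -‿distribˡ-* _ _ ⟩
      - (suc m · 1#) * ⟦ j ⟧      ∎

    -- The value used by the solver: it sends 1 to 1# and not to 1# + 0#.
    ⟦_⟧′ : ℤ → Carrier
    ⟦ + n ⟧′      = n ·′ 1#
    ⟦ -[1+ n ] ⟧′ = - (suc n ·′ 1#)

    agree : ∀ i → ⟦ i ⟧′ ≈ ⟦ i ⟧
    agree (+ n)    = sym (×ᵤ≈× n 1#)
    agree -[1+ n ] = -‿cong (sym (×ᵤ≈× (suc n) 1#))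

    morphism : ℤ.+-*-rawRing -Raw-AlmostCommutative⟶ fromCommutativeRing R
    morphism = record
      { ⟦_⟧    = ⟦_⟧′
      ; +-homo = λ i j → trans (agree (i ℤ.+ j)) (trans (+-homo i j) (sym (+-cong (agree i) (agree j))))
      ; *-homo = λ i j → trans (agree (i ℤ.* j)) (trans (*-homo i j) (sym (*-cong (agree i) (agree j))))
      ; -‿homo = λ i → trans (agree (ℤ.- i)) (trans (neg-homo i) (sym (-‿cong (agree i))))
      ; 0-homo = refl
      ; 1-homo = refl
      }

    coeff≟ : ∀ i j → Maybe (⟦ i ⟧′ ≈ ⟦ j ⟧′)
    coeff≟ i j with i ℤₚ.≟ j
    ... | yes i≡j = just (reflexive (≡.cong ⟦_⟧′ i≡j))
    ... | no  _   = nothing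

  open RingSolver ℤ.+-*-rawRing (fromCommutativeRing R) morphism coeff≟ public
    using (solve; con; _:+_; _:*_; _:-_; :-_; _:=_; Polynomial)

  :0 :1 : ∀ {n} → Polynomial n
  :0 = con 0ℤ
  :1 = con 1ℤ

module FieldLemmas {c ℓ : Level} (𝔽 : Field c ℓ) where
  open Field 𝔽 hiding (zero)
  open FieldTheory 𝔽
  open IntegerSolver commutativeRing
  open AbelianGroupProps +-abelianGroup using (x∙y⁻¹≈ε⇒x≈y)
  open SetoidReasoning setoid

  *-cancelˡ : ∀ {a x y} → a ≉ 0# → a * x ≈ a * y → x ≈ y
  *-cancelˡ {a} {x} {y} a≉0 ax≈ay = begin
    x               ≈⟨ *-identityˡ x ⟨
    1# * x          ≈⟨ *-congʳ (⁻¹-inverseʳ a≉0) ⟨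
    a * a ⁻¹ * x    ≈⟨ assoc a (a ⁻¹) x ⟩
    a ⁻¹ * (a * x)  ≈⟨ *-congˡ ax≈ay ⟩
    a ⁻¹ * (a * y)  ≈⟨ assoc a (a ⁻¹) y ⟨
    a * a ⁻¹ * y    ≈⟨ *-congʳ (⁻¹-inverseʳ a≉0) ⟩
    1# * y          ≈⟨ *-identityˡ y ⟩
    y               ∎
    where
    assoc : ∀ a b x → a * b * x ≈ b * (a * x)
    assoc = solve 3 (λ a b x → a :* b :* x := b :* (a :* x)) refl

  *-zero-divisor : ∀ {a x} → a ≉ 0# → a * x ≈ 0# → x ≈ 0#
  *-zero-divisor a≉0 ax≈0 = *-cancelˡ a≉0 (trans ax≈0 (sym (zeroʳ _)))

  *-nonzero : ∀ {a b} → a ≉ 0# → b ≉ 0# → a * b ≉ 0#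
  *-nonzero a≉0 b≉0 ab≈0 = b≉0 (*-zero-divisor a≉0 ab≈0)

  1≉0 : 1# ≉ 0#
  1≉0 = 0≉1 ∘ sym

  ^-nonzero : ∀ {a} n → a ≉ 0# → a ^ n ≉ 0#
  ^-nonzero zero    a≉0 = 1≉0
  ^-nonzero (suc n) a≉0 = *-nonzero a≉0 (^-nonzero n a≉0)

  ⁻¹-nonzero : ∀ {a} → a ≉ 0# → a ⁻¹ ≉ 0#
  ⁻¹-nonzero a≉0 a⁻¹≈0 = 1≉0 (trans (sym (⁻¹-inverseʳ a≉0)) (trans (*-congˡ a⁻¹≈0) (zeroʳ _)))

  ⁻¹-inverseˡ : ∀ {a} → a ≉ 0# → a ⁻¹ * a ≈ 1#
  ⁻¹-inverseˡ a≉0 = trans (*-comm _ _) (⁻¹-inverseʳ a≉0)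

  cancel-⁻¹ : ∀ {a} b → a ≉ 0# → a * (a ⁻¹ * b) ≈ b
  cancel-⁻¹ b a≉0 = trans (sym (*-assoc _ _ _)) (trans (*-congʳ (⁻¹-inverseʳ a≉0)) (*-identityˡ b))

  ^-inverse : ∀ {a} n → a ≉ 0# → a ^ n * (a ⁻¹) ^ n ≈ 1#
  ^-inverse zero    a≉0 = *-identityˡ 1#
  ^-inverse {a} (suc n) a≉0 = begin
    a * a ^ n * (a ⁻¹ * (a ⁻¹) ^ n)    ≈⟨ solve 4 (λ a b c d → a :* b :* (c :* d) := a :* c :* (b :* d)) refl _ _ _ _ ⟩
    a * a ⁻¹ * (a ^ n * (a ⁻¹) ^ n)    ≈⟨ *-cong (⁻¹-inverseʳ a≉0) (^-inverse n a≉0) ⟩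
    1# * 1#                            ≈⟨ *-identityˡ 1# ⟩
    1#                                 ∎

  1^n≈1 : ∀ n → 1# ^ n ≈ 1#
  1^n≈1 zero    = refl
  1^n≈1 (suc n) = trans (*-identityˡ _) (1^n≈1 n)

  0^n≈0 : ∀ n → .{{NonZero n}} → 0# ^ n ≈ 0#
  0^n≈0 (suc n) = zeroˡ _

  x-y≈0⇒x≈y : ∀ {x y} → x - y ≈ 0# → x ≈ y
  x-y≈0⇒x≈y = x∙y⁻¹≈ε⇒x≈y _ _

prime∤! : ∀ {p} → Prime p → ∀ k → k ℕ.< p → ¬ p ∣ k !
prime∤! pr zero    _   p∣1 = ℕₚ.<⇒≱ (ℕ.nonTrivial⇒n>1 _ {{Primality.prime⇒nonTrivial pr}}) (∣⇒≤ p∣1)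
prime∤! pr (suc k) k<p p∣  with euclidsLemma (suc k) (k !) pr p∣
... | inj₁ p∣1+k = ℕₚ.<⇒≱ k<p (∣⇒≤ p∣1+k)
... | inj₂ p∣k!  = prime∤! pr k (ℕₚ.<-trans (ℕₚ.n<1+n k) k<p) p∣k!

prime∣C : ∀ {p} → Prime p → ∀ k → 0 ℕ.< k → k ℕ.< p → p ∣ p C k
prime∣C {p@(suc q)} pr k 0<k k<p with euclidsLemma (p C k) (k ! ℕ.* (p ℕ.∸ k) !) pr p∣product
  where
  instance
    k!-nonZero : NonZero (k ! ℕ.* (p ℕ.∸ k) !)
    k!-nonZero = k ℕₚ.!* (p ℕ.∸ k) !≢0
  product : (p C k) ℕ.* (k ! ℕ.* (p ℕ.∸ k) !) ≡ p !
  product = ≡.trans (≡.cong (ℕ._* (k ! ℕ.* (p ℕ.∸ k) !)) (nCk≡n!/k![n-k]! (ℕₚ.<⇒≤ k<p)))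
                    (m/n*n≡m (k![n∸k]!∣n! (ℕₚ.<⇒≤ k<p)))
  p∣product : p ∣ (p C k) ℕ.* (k ! ℕ.* (p ℕ.∸ k) !)
  p∣product = ≡.subst (p ∣_) (≡.sym product) (m∣m*n (q !))
... | inj₁ p∣C = p∣C
... | inj₂ p∣k![p-k]! with euclidsLemma (k !) ((p ℕ.∸ k) !) pr p∣k![p-k]!
...   | inj₁ p∣k!     = contradiction p∣k! (prime∤! pr k k<p)
...   | inj₂ p∣[p-k]! = contradiction p∣[p-k]! (prime∤! pr (p ℕ.∸ k) (ℕₚ.∸-monoʳ-< 0<k (ℕₚ.<⇒≤ k<p)))
prime∣C {zero} pr k 0<k ()

module Characteristic {c ℓ : Level} (𝔽 : Field c ℓ) {p : ℕ} (pr : Prime p)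
                      (char : Field._≈_ 𝔽 (FieldTheory._·_ 𝔽 p (Field.1# 𝔽)) (Field.0# 𝔽)) where
  open Field 𝔽 hiding (zero)
  open FieldTheory 𝔽
  open FieldLemmas 𝔽
  open IntegerSolver commutativeRing
  open SemiringMult semiring using (×-assoc-*; ×-congʳ; ×-assocˡ)
  open SemiringExp semiring using (^-congˡ)
  open CommSemiringExp commutativeSemiring using (^-distrib-*)
  open SemiringSum semiring using (sum-cong-≋; sum-init-last; sum-replicate-zero)
  open SetoidReasoning setoid

  instance
    p-nonZero : NonZero p
    p-nonZero = Primality.prime⇒nonZero pr

  1<p : 1 ℕ.< p
  1<p = ℕ.nonTrivial⇒n>1 _ {{Primality.prime⇒nonTrivial pr}}

  p·a≈0 : ∀ a → p · a ≈ 0#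
  p·a≈0 a = begin
    p · a          ≈⟨ ×-congʳ p (*-identityˡ a) ⟨
    p · (1# * a)   ≈⟨ ×-assoc-* p 1# a ⟨
    (p · 1#) * a   ≈⟨ *-congʳ char ⟩
    0# * a         ≈⟨ zeroˡ a ⟩
    0#             ∎

  p∣n⇒n·a≈0 : ∀ {n} → p ∣ n → ∀ a → n · a ≈ 0#
  p∣n⇒n·a≈0 (divides k ≡.refl) a = begin
    (k ℕ.* p) · a   ≡⟨ ≡.cong (_· a) (ℕₚ.*-comm k p) ⟩
    (p ℕ.* k) · a   ≈⟨ ×-assocˡ a p k ⟨
    p · (k · a)     ≈⟨ p·a≈0 _ ⟩
    0#              ∎

  private
    module B = Binomial commutativeSemiring

    frobenius-sum : ∀ {q} → p ≡ suc q → ∀ a b → (a + b) ^ suc q ≈ a ^ suc q + b ^ suc q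
    frobenius-sum {q} ≡.refl a b = begin
      (a + b) ^ suc q                                 ≈⟨ B.theorem (suc q) a b ⟩
      t zero + sum (tail t)                           ≈⟨ +-cong t₀ (sum-init-last (tail t)) ⟩
      b ^ suc q + (sum (init (tail t)) + last (tail t)) ≈⟨ +-congˡ (+-cong middle tₚ) ⟩
      b ^ suc q + (0# + a ^ suc q)                    ≈⟨ solve 2 (λ x y → x :+ (:0 :+ y) := y :+ x) refl _ _ ⟩
      a ^ suc q + b ^ suc q                           ∎
      where
      t : Fin (suc (suc q)) → Carrier
      t = B.binomialTerm a b (suc q)
      t₀ : t zero ≈ b ^ suc q
      t₀ = trans (+-identityʳ _) (*-identityˡ _)
      middle : sum (init (tail t)) ≈ 0#
      middle = trans (sum-cong-≋ λ i → p∣n⇒n·a≈0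
        (prime∣C pr _ (s≤s z≤n) (s≤s (≡.subst (ℕ._< q) (≡.sym (Finₚ.toℕ-inject₁ i)) (Finₚ.toℕ<n i)))) _)
        (sum-replicate-zero q)
      tₚ : last (tail t) ≈ a ^ suc q
      tₚ = begin
        (suc q C suc (toℕ (fromℕ q))) · (a ^ suc (toℕ (fromℕ q)) * b ^ (q ℕ.∸ toℕ (fromℕ q)))
          ≡⟨ ≡.cong (λ k → (suc q C suc k) · (a ^ suc k * b ^ (q ℕ.∸ k))) (Finₚ.toℕ-fromℕ q) ⟩
        (suc q C suc q) · (a ^ suc q * b ^ (q ℕ.∸ q))
          ≡⟨ ≡.cong₂ (λ m k → m · (a ^ suc q * b ^ k)) (nCn≡1 (suc q)) (ℕₚ.n∸n≡0 q) ⟩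
        1 · (a ^ suc q * 1#)
          ≈⟨ trans (+-identityʳ _) (*-identityʳ _) ⟩
        a ^ suc q ∎

  ^p-homo-+ : ∀ a b → (a + b) ^ p ≈ a ^ p + b ^ p
  ^p-homo-+ a b = ≡.subst (λ n → (a + b) ^ n ≈ a ^ n + b ^ n) (ℕₚ.suc-pred p)
                    (frobenius-sum (≡.sym (ℕₚ.suc-pred p)) a b)

  ^p-homo-* : ∀ a b → (a * b) ^ p ≈ a ^ p * b ^ p
  ^p-homo-* a b = ^-distrib-* a b p

  ^p-homo-- : ∀ a → (- a) ^ p ≈ - (a ^ p)
  ^p-homo-- a = begin
    (- a) ^ p                              ≈⟨ solve 2 (λ x y → x := (y :+ x) :- y) refl _ _ ⟩
    (a ^ p + (- a) ^ p) - a ^ p            ≈⟨ +-congʳ (^p-homo-+ a (- a)) ⟨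
    (a + - a) ^ p - a ^ p                  ≈⟨ +-congʳ (^-congˡ p (-‿inverseʳ a)) ⟩
    0# ^ p - a ^ p                         ≈⟨ +-congʳ (0^n≈0 p) ⟩
    0# - a ^ p                             ≈⟨ +-identityˡ _ ⟩
    - (a ^ p)                              ∎

  Fp : Pred Carrier ℓ
  Fp a = ∃ λ n → a ≈ n · 1#

  Fp-frobenius : ∀ {a} → a ∈ Fp → a ^ p ≈ a
  Fp-frobenius {a} (n , a≈n) = trans (^-congˡ p a≈n) (trans (go n) (sym a≈n))
    where
    go : ∀ n → (n · 1#) ^ p ≈ n · 1#
    go zero    = 0^n≈0 p
    go (suc n) = trans (^p-homo-+ _ _) (+-cong (1^n≈1 p) (go n))

module Summation {c ℓ : Level} (𝔽 : Field c ℓ) where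
  open Field 𝔽 hiding (zero)
  open FieldTheory 𝔽 using (sum)
  open IntegerSolver commutativeRing
  open SemiringSum semiring using
    ( sum-cong-≋; sum-init-last; sum-replicate-zero; sum-remove; ∑-distrib-+; *-distribˡ-sum; *-distribʳ-sum )
    renaming (∑-comm to sum-comm)

  -- Abstract, so that the summand can be inferred from a sum by unification.
  abstract
    ∑ : ∀ {n} → (Fin n → Carrier) → Carrier
    ∑ = sum

    ∑≡sum : ∀ {n} (f : Fin n → Carrier) → ∑ f ≡ sum f
    ∑≡sum f = ≡.refl

    ∑-nil : (f : Fin 0 → Carrier) → ∑ f ≈ 0#
    ∑-nil f = refl

    ∑-suc : ∀ {n} (f : Fin (suc n) → Carrier) → ∑ f ≈ f zero + ∑ (λ i → f (suc i))
    ∑-suc f = refl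

    ∑-cong : ∀ {n} {f g : Fin n → Carrier} → (∀ i → f i ≈ g i) → ∑ f ≈ ∑ g
    ∑-cong = sum-cong-≋

    ∑-zero : ∀ {n} {f : Fin n → Carrier} → (∀ i → f i ≈ 0#) → ∑ f ≈ 0#
    ∑-zero {n} f≈0 = trans (sum-cong-≋ f≈0) (sum-replicate-zero n)

    ∑-neg : ∀ {n} (f : Fin n → Carrier) → ∑ (λ i → - f i) ≈ - ∑ f
    ∑-neg {zero}  f = solve 0 (:0 := :- :0) refl
    ∑-neg {suc n} f = trans (+-congˡ (∑-neg (f ∘ suc))) (solve 2 (λ x y → :- x :+ :- y := :- (x :+ y)) refl _ _)

    ∑-+ : ∀ {n} (f g : Fin n → Carrier) → ∑ (λ i → f i + g i) ≈ ∑ f + ∑ g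
    ∑-+ = ∑-distrib-+

    ∑-comm : ∀ {m n} (f : Fin m → Fin n → Carrier) → ∑ (λ i → ∑ (λ j → f i j)) ≈ ∑ (λ j → ∑ (λ i → f i j))
    ∑-comm = sum-comm

    *-∑ : ∀ {n} x (f : Fin n → Carrier) → x * ∑ f ≈ ∑ (λ i → x * f i)
    *-∑ = *-distribˡ-sum

    ∑-* : ∀ {n} x (f : Fin n → Carrier) → ∑ f * x ≈ ∑ (λ i → f i * x)
    ∑-* = *-distribʳ-sum

    ∑-remove : ∀ {n} (i : Fin (suc n)) (f : Fin (suc n) → Carrier) → ∑ f ≈ f i + ∑ (λ k → f (punchIn i k))
    ∑-remove i = sum-remove {i = i}

    ∑-init-last : ∀ {n} (f : Fin (suc n) → Carrier) → ∑ f ≈ ∑ (λ i → f (inject₁ i)) + f (fromℕ n)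
    ∑-init-last = sum-init-last

module Subrings {c ℓ : Level} (𝔽 : Field c ℓ) where
  open Field 𝔽 hiding (zero)
  open FieldTheory 𝔽 using (_^_; _·_)
  open Summation 𝔽

  record IsSubring {s : Level} (R : Pred Carrier s) : Set (c ⊔ ℓ ⊔ s) where
    field
      resp : ∀ {a b} → a ≈ b → a ∈ R → b ∈ R
      one  : 1# ∈ R
      add  : ∀ {a b} → a ∈ R → b ∈ R → a + b ∈ R
      neg  : ∀ {a} → a ∈ R → - a ∈ R
      mul  : ∀ {a b} → a ∈ R → b ∈ R → a * b ∈ R

    zer : 0# ∈ R
    zer = resp (-‿inverseʳ 1#) (add one (neg one))

    ∑∈ : ∀ {n} {f : Fin n → Carrier} → (∀ i → f i ∈ R) → ∑ f ∈ R
    ∑∈ {zero}  f∈ = resp (sym (∑-nil _)) zer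
    ∑∈ {suc n} f∈ = resp (sym (∑-suc _)) (add (f∈ zero) (∑∈ (f∈ ∘ suc)))

    pow : ∀ {a} n → a ∈ R → a ^ n ∈ R
    pow zero    a∈ = one
    pow (suc n) a∈ = mul a∈ (pow n a∈)

    times : ∀ {a} n → a ∈ R → n · a ∈ R
    times zero    a∈ = zer
    times (suc n) a∈ = add a∈ (times n a∈)

  record IsSubfield {s : Level} (F : Pred Carrier s) : Set (c ⊔ ℓ ⊔ s) where
    field
      isSubring : IsSubring F
      inv       : ∀ {a} → a ≉ 0# → a ∈ F → a ⁻¹ ∈ F
    open IsSubring isSubring public

module PrimeSubfield {c ℓ : Level} (𝔽 : Field c ℓ) {p : ℕ} (pr : Prime p)
                     (char : Field._≈_ 𝔽 (FieldTheory._·_ 𝔽 p (Field.1# 𝔽)) (Field.0# 𝔽)) where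
  open Field 𝔽 hiding (zero)
  open FieldTheory 𝔽 using (_^_; _·_)
  open FieldLemmas 𝔽
  open Characteristic 𝔽 pr char public
  open Subrings 𝔽
  open Summation 𝔽
  open IntegerSolver commutativeRing
  open SemiringExp semiring using (^-congˡ; ^-congʳ; ^-assocʳ)
  open SemiringMult semiring using (×-homo-+; ×1-homo-*; ×-homo-1; ×-congʳ; ×-assoc-*)
  open SetoidReasoning setoid

  ^p-homo-∑ : ∀ {n} (f : Fin n → Carrier) → ∑ f ^ p ≈ ∑ (λ i → f i ^ p)
  ^p-homo-∑ {zero}  f = trans (^-congˡ p (∑-nil f)) (trans (0^n≈0 p) (sym (∑-nil _)))
  ^p-homo-∑ {suc n} f = begin
    ∑ f ^ p                                        ≈⟨ ^-congˡ p (∑-suc f) ⟩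
    (f zero + ∑ (λ i → f (suc i))) ^ p             ≈⟨ ^p-homo-+ (f zero) (∑ (λ i → f (suc i))) ⟩
    f zero ^ p + ∑ (λ i → f (suc i)) ^ p           ≈⟨ +-congˡ (^p-homo-∑ (λ i → f (suc i))) ⟩
    f zero ^ p + ∑ (λ i → f (suc i) ^ p)           ≈⟨ ∑-suc (λ i → f i ^ p) ⟨
    ∑ (λ i → f i ^ p)                              ∎

  frobenius : ℕ → Carrier → Carrier
  frobenius zero    x = x
  frobenius (suc i) x = frobenius i x ^ p

  frobenius-cong : ∀ i {x y} → x ≈ y → frobenius i x ≈ frobenius i y
  frobenius-cong zero    x≈y = x≈y
  frobenius-cong (suc i) x≈y = ^-congˡ p (frobenius-cong i x≈y)

  frobenius-^p : ∀ i x → frobenius i (x ^ p) ≡ frobenius (suc i) x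
  frobenius-^p zero    x = ≡.refl
  frobenius-^p (suc i) x = ≡.cong (_^ p) (frobenius-^p i x)

  frobenius≈^ : ∀ i x → frobenius i x ≈ x ^ (p ℕ.^ i)
  frobenius≈^ zero    x = sym (*-identityʳ x)
  frobenius≈^ (suc i) x = trans (^-congˡ p (frobenius≈^ i x))
    (trans (^-assocʳ x (p ℕ.^ i) p) (^-congʳ x (ℕₚ.*-comm (p ℕ.^ i) p)))

  Fp-isSubring : IsSubring Fp
  Fp-isSubring = record
    { resp = λ a≈b (n , a≈n) → n , trans (sym a≈b) a≈n
    ; one  = 1 , sym (×-homo-1 1#)
    ; add  = λ (m , a≈m) (n , b≈n) → m ℕ.+ n , trans (+-cong a≈m b≈n) (sym (×-homo-+ 1# m n))
    ; neg  = λ {a} (n , a≈n) → (p ℕ.∸ 1) ℕ.* n , (begin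
        - a                        ≈⟨ +-identityʳ _ ⟨
        - a + 0#                   ≈⟨ +-congˡ (p·a≈0 a) ⟨
        - a + p · a                ≡⟨ ≡.cong (λ k → - a + k · a) (≡.sym (ℕₚ.suc-pred p)) ⟩
        - a + (a + (p ℕ.∸ 1) · a)  ≈⟨ solve 2 (λ x y → :- x :+ (x :+ y) := y) refl _ _ ⟩
        (p ℕ.∸ 1) · a              ≈⟨ ×-congʳ (p ℕ.∸ 1) (trans a≈n (sym (*-identityˡ _))) ⟩
        (p ℕ.∸ 1) · (1# * n · 1#)  ≈⟨ ×-assoc-* (p ℕ.∸ 1) 1# _ ⟨
        (p ℕ.∸ 1) · 1# * n · 1#    ≈⟨ ×1-homo-* (p ℕ.∸ 1) n ⟨
        ((p ℕ.∸ 1) ℕ.* n) · 1#     ∎)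
    ; mul  = λ (m , a≈m) (n , b≈n) → m ℕ.* n , trans (*-cong a≈m b≈n) (sym (×1-homo-* m n))
    }

  Fp-inv : ∀ {a} → a ≉ 0# → a ∈ Fp → a ⁻¹ ∈ Fp
  Fp-inv {a} a≉0 a∈ with ℕₚ.m≤n⇒∃[o]m+o≡n 1<p
  ... | k , ≡.refl = IsSubring.resp Fp-isSubring eq (IsSubring.pow Fp-isSubring k a∈)
    where
    eq : a ^ k ≈ a ⁻¹
    eq = *-cancelˡ a≉0 (*-cancelˡ a≉0 (begin
      a * (a * a ^ k)   ≈⟨ Fp-frobenius a∈ ⟩
      a                 ≈⟨ *-identityʳ a ⟨
      a * 1#            ≈⟨ *-congˡ (⁻¹-inverseʳ a≉0) ⟨
      a * (a * a ⁻¹)    ∎))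

  Fp-isSubfield : IsSubfield Fp
  Fp-isSubfield = record { isSubring = Fp-isSubring ; inv = Fp-inv }

  Fp-times : ∀ n x → n · x ≈ (n · 1#) * x
  Fp-times n x = sym (trans (×-assoc-* n 1# x) (×-congʳ n (*-identityˡ x)))

  Fp-reduce : ∀ {a} → a ∈ Fp → ∃ λ (i : Fin p) → a ≈ toℕ i · 1#
  Fp-reduce {a} (n , a≈n) = fromℕ< n%p<p , (begin
      a                                          ≈⟨ a≈n ⟩
      n · 1#                                     ≡⟨ ≡.cong (_· 1#) (m≡m%n+[m/n]*n n p) ⟩
      (n % p ℕ.+ n / p ℕ.* p) · 1#               ≈⟨ ×-homo-+ 1# (n % p) _ ⟩
      (n % p) · 1# + (n / p ℕ.* p) · 1#          ≈⟨ +-congˡ (p∣n⇒n·a≈0 (divides (n / p) ≡.refl) 1#) ⟩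
      (n % p) · 1# + 0#                          ≈⟨ +-identityʳ _ ⟩
      (n % p) · 1#                               ≡⟨ ≡.cong (_· 1#) (≡.sym (Finₚ.toℕ-fromℕ< n%p<p)) ⟩
      toℕ (fromℕ< n%p<p) · 1#                    ∎)
    where
    n%p<p : n % p ℕ.< p
    n%p<p = m%n<n n p

module Spans {c ℓ : Level} (𝔽 : Field c ℓ) (_≟_ : ∀ a b → Dec (Field._≈_ 𝔽 a b)) where
  open Field 𝔽 hiding (zero)
  open FieldLemmas 𝔽
  open Subrings 𝔽
  open IntegerSolver commutativeRing
  open Summation 𝔽
  open RingProps ring using (-1*x≈-x)
  open SetoidReasoning setoid

  δ : ∀ {n} → Fin n → Fin n → Carrier
  δ zero    zero    = 1#
  δ zero    (suc j) = 0#
  δ (suc i) zero    = 0#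
  δ (suc i) (suc j) = δ i j

  ∑-δ : ∀ {n} (i : Fin n) (f : Fin n → Carrier) → ∑ (λ j → δ i j * f j) ≈ f i
  ∑-δ zero    f = trans (∑-suc _) (trans (+-cong (*-identityˡ _) (∑-zero λ j → zeroˡ _)) (+-identityʳ _))
  ∑-δ (suc i) f = trans (∑-suc _) (trans (+-cong (zeroˡ _) (∑-δ i (f ∘ suc))) (+-identityˡ _))

  δ-diagonal : ∀ {n} (i : Fin n) → δ i i ≈ 1#
  δ-diagonal zero    = refl
  δ-diagonal (suc i) = δ-diagonal i

  δ-off-diagonal : ∀ {n} {i j : Fin n} → i ≢ j → δ i j ≈ 0#
  δ-off-diagonal {i = zero}  {zero}  i≢j = contradiction ≡.refl i≢j
  δ-off-diagonal {i = zero}  {suc j} i≢j = refl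
  δ-off-diagonal {i = suc i} {zero}  i≢j = refl
  δ-off-diagonal {i = suc i} {suc j} i≢j = δ-off-diagonal (i≢j ∘ ≡.cong suc)

  δ∈ : ∀ {s} {R : Pred Carrier s} → IsSubring R → ∀ {n} (i j : Fin n) → δ i j ∈ R
  δ∈ isR zero    zero    = IsSubring.one isR
  δ∈ isR zero    (suc j) = IsSubring.zer isR
  δ∈ isR (suc i) zero    = IsSubring.zer isR
  δ∈ isR (suc i) (suc j) = δ∈ isR i j

  ∑-insert : ∀ {n} (i : Fin (suc n)) (c₀ : Carrier) (c : Fin n → Carrier) (f : Fin (suc n) → Carrier) →
               ∑ (λ k → insertAt c i c₀ k * f k) ≈ c₀ * f i + ∑ (λ k → c k * f (punchIn i k))
  ∑-insert i c₀ c f = trans (∑-remove i (λ k → insertAt c i c₀ k * f k))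
    (+-cong (*-congʳ (reflexive (Vecₚ.insertAt-lookup c i c₀)))
            (∑-cong λ k → *-congʳ (reflexive (Vecₚ.insertAt-punchIn c i c₀ k))))

  dependence : ∀ {s} {R : Pred Carrier s} → IsSubring R →
    ∀ n (v : Fin (suc n) → Fin n → Carrier) → (∀ i j → v i j ∈ R) →
    ∃ λ (c : Fin (suc n) → Carrier) → (∀ i → c i ∈ R) × (∃ λ i → c i ≉ 0#) ×
      (∀ j → ∑ (λ i → c i * v i j) ≈ 0#)
  dependence R zero    v v∈ = (λ _ → 1#) , (λ _ → IsSubring.one R) , (zero , 1≉0) , λ ()
  dependence {R = R} isR (suc n) v v∈ with Finₚ.any? (λ i → Dec.¬? (v i zero ≟ 0#))
  ... | no all0 with dependence isR n (λ i j → v (suc i) (suc j)) (λ i j → v∈ (suc i) (suc j))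
  ...   | c , c∈ , (i₁ , c≉0) , rel = c′ , c′∈ , (suc i₁ , c≉0) , rel′
    where
    c′ : Fin (suc (suc n)) → Carrier
    c′ zero    = 0#
    c′ (suc i) = c i
    c′∈ : ∀ i → c′ i ∈ R
    c′∈ zero    = IsSubring.zer isR
    c′∈ (suc i) = c∈ i
    v0≈0 : ∀ i → v i zero ≈ 0#
    v0≈0 i = Dec.decidable-stable (v i zero ≟ 0#) (λ v≉0 → all0 (i , v≉0))
    rel′ : ∀ j → ∑ (λ i → c′ i * v i j) ≈ 0#
    rel′ zero    = ∑-zero λ i → trans (*-congˡ (v0≈0 i)) (zeroʳ _)
    rel′ (suc j) = trans (∑-suc _) (trans (+-cong (zeroˡ _) (rel j)) (+-identityˡ _))
  dependence {R = R} isR (suc n) v v∈ | yes (i₀ , a≉0)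
    with dependence isR n
      (λ i j → v i₀ zero * v (punchIn i₀ i) (suc j) - v (punchIn i₀ i) zero * v i₀ (suc j))
      (λ i j → IsSubring.add isR (IsSubring.mul isR (v∈ _ _) (v∈ _ _))
                 (IsSubring.neg isR (IsSubring.mul isR (v∈ _ _) (v∈ _ _))))
  ... | c , c∈ , (i₁ , c≉0) , rel =
        insertAt (λ i → a * c i) i₀ c₀
      , insert∈
      , (punchIn i₀ i₁ , λ eq → *-nonzero a≉0 c≉0
          (trans (reflexive (≡.sym (Vecₚ.insertAt-punchIn (λ i → a * c i) i₀ c₀ i₁))) eq))
      , rel′
    where
    a = v i₀ zero
    u : Fin (suc n) → Fin (suc n) → Carrier
    u i j = v (punchIn i₀ i) j
    c₀ = - ∑ (λ i → c i * u i zero)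
    insert∈ : ∀ i → insertAt (λ i → a * c i) i₀ c₀ i ∈ R
    insert∈ i with i₀ Finₚ.≟ i
    ... | yes ≡.refl = ≡.subst R (≡.sym (Vecₚ.insertAt-lookup _ i₀ c₀))
            (IsSubring.neg isR (IsSubring.∑∈ isR λ i → IsSubring.mul isR (c∈ i) (v∈ _ _)))
    ... | no  i₀≢i = ≡.subst R (≡.trans (≡.sym (Vecₚ.insertAt-punchIn _ i₀ c₀ (Fin.punchOut i₀≢i)))
            (≡.cong (insertAt (λ i → a * c i) i₀ c₀) (Finₚ.punchIn-punchOut i₀≢i)))
            (IsSubring.mul isR (v∈ _ _) (c∈ _))
    combined : ∀ j → ∑ (λ i → insertAt (λ i → a * c i) i₀ c₀ i * v i j)
                   ≈ ∑ (λ i → c i * (a * u i j - u i zero * v i₀ j))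
    combined j = begin
      ∑ (λ i → insertAt (λ i → a * c i) i₀ c₀ i * v i j)
        ≈⟨ ∑-insert i₀ c₀ (λ i → a * c i) (λ i → v i j) ⟩
      - ∑ (λ i → c i * u i zero) * v i₀ j + ∑ (λ i → a * c i * u i j)
        ≈⟨ +-congʳ (*-congʳ (∑-neg (λ i → c i * u i zero))) ⟨
      ∑ (λ i → - (c i * u i zero)) * v i₀ j + ∑ (λ i → a * c i * u i j)
        ≈⟨ +-congʳ (∑-* (v i₀ j) _) ⟩
      ∑ (λ i → - (c i * u i zero) * v i₀ j) + ∑ (λ i → a * c i * u i j)
        ≈⟨ ∑-+ (λ i → - (c i * u i zero) * v i₀ j) (λ i → a * c i * u i j) ⟨
      ∑ (λ i → - (c i * u i zero) * v i₀ j + a * c i * u i j)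
        ≈⟨ ∑-cong (λ i → solve 5 (λ c u₀ w a u → :- (c :* u₀) :* w :+ a :* c :* u
             := c :* (a :* u :- u₀ :* w)) refl (c i) (u i zero) (v i₀ j) a (u i j)) ⟩
      ∑ (λ i → c i * (a * u i j - u i zero * v i₀ j)) ∎
    rel′ : ∀ j → ∑ (λ i → insertAt (λ i → a * c i) i₀ c₀ i * v i j) ≈ 0#
    rel′ zero    = trans (combined zero) (∑-zero λ i →
      solve 3 (λ c a u → c :* (a :* u :- u :* a) := :0) refl (c i) a (u i zero))
    rel′ (suc j) = trans (combined (suc j)) (rel j)

  Span : ∀ {s n} → Pred Carrier s → (Fin n → Carrier) → Pred Carrier (c ⊔ ℓ ⊔ s)
  Span {n = n} F b x = ∃ λ (f : Fin n → Carrier) → (∀ i → f i ∈ F) × x ≈ ∑ (λ i → f i * b i)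

  Independent : ∀ {s n} → Pred Carrier s → (Fin n → Carrier) → Set (c ⊔ ℓ ⊔ s)
  Independent {n = n} F b = ∀ (f : Fin n → Carrier) → (∀ i → f i ∈ F) → ∑ (λ i → f i * b i) ≈ 0# → ∀ i → f i ≈ 0#

  Dependent : ∀ {s n} → Pred Carrier s → (Fin n → Carrier) → Set (c ⊔ ℓ ⊔ s)
  Dependent {n = n} F b = ∃ λ (f : Fin n → Carrier) → (∀ i → f i ∈ F) × (∃ λ i → f i ≉ 0#) ×
    ∑ (λ i → f i * b i) ≈ 0#

  module _ {s : Level} {F : Pred Carrier s} (isF : IsSubring F) where
    private module F = IsSubring isF

    span-resp : ∀ {n} {b : Fin n → Carrier} {x y} → x ≈ y → x ∈ Span F b → y ∈ Span F b
    span-resp x≈y (f , f∈ , eq) = f , f∈ , trans (sym x≈y) eq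

    span-zero : ∀ {n} {b : Fin n → Carrier} → 0# ∈ Span F b
    span-zero = (λ _ → 0#) , (λ _ → F.zer) , sym (∑-zero λ i → zeroˡ _)

    span-add : ∀ {n} {b : Fin n → Carrier} {x y} → x ∈ Span F b → y ∈ Span F b → x + y ∈ Span F b
    span-add (f , f∈ , x≈) (g , g∈ , y≈) = (λ i → f i + g i) , (λ i → F.add (f∈ i) (g∈ i)) ,
      trans (+-cong x≈ y≈) (trans (sym (∑-+ _ _)) (∑-cong λ i → sym (distribʳ _ _ _)))

    span-scale : ∀ {n} {b : Fin n → Carrier} {a x} → a ∈ F → x ∈ Span F b → a * x ∈ Span F b
    span-scale a∈ (f , f∈ , x≈) = (λ i → _ * f i) , (λ i → F.mul a∈ (f∈ i)) ,
      trans (*-congˡ x≈) (trans (*-∑ _ _) (∑-cong λ i → sym (*-assoc _ _ _)))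

    span-neg : ∀ {n} {b : Fin n → Carrier} {x} → x ∈ Span F b → - x ∈ Span F b
    span-neg {x = x} x∈ = span-resp (-1*x≈-x x) (span-scale (F.neg F.one) x∈)

    span-gen : ∀ {n} {b : Fin n → Carrier} i → b i ∈ Span F b
    span-gen i = δ i , δ∈ isF i , sym (∑-δ i _)

    span-sum : ∀ {n m} {b : Fin n → Carrier} {x : Fin m → Carrier} →
               (∀ i → x i ∈ Span F b) → ∑ x ∈ Span F b
    span-sum {m = zero}  x∈ = span-resp (sym (∑-nil _)) span-zero
    span-sum {m = suc m} x∈ = span-resp (sym (∑-suc _)) (span-add (x∈ zero) (span-sum (x∈ ∘ suc)))

    span-*ʳ : ∀ {n m} {b : Fin n → Carrier} {d : Fin m → Carrier} {x y} →
              (∀ i → b i * y ∈ Span F d) → x ∈ Span F b → x * y ∈ Span F d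
    span-*ʳ {y = y} by∈ (f , f∈ , x≈) =
      span-resp (sym (trans (*-congʳ x≈) (trans (∑-* y _) (∑-cong λ i → *-assoc _ _ _))))
        (span-sum λ i → span-scale (f∈ i) (by∈ i))

    span-mono : ∀ {n m} {b : Fin n → Carrier} {d : Fin m → Carrier} →
                (∀ i → b i ∈ Span F d) → Span F b ⊆ Span F d
    span-mono b∈ x∈ = span-resp (*-identityʳ _) (span-*ʳ (λ i → span-resp (sym (*-identityʳ _)) (b∈ i)) x∈)

    span-dependent : ∀ {n} {b : Fin n → Carrier} (u : Fin (suc n) → Carrier) → (∀ i → u i ∈ Span F b) →
                     Dependent F u
    span-dependent {n} {b} u u∈ with dependence isF n (λ i → proj₁ (u∈ i)) (λ i → proj₁ (proj₂ (u∈ i)))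
    ... | c , c∈ , c≉0 , rel = c , c∈ , c≉0 , (begin
      ∑ (λ i → c i * u i)
        ≈⟨ ∑-cong (λ i → trans (*-congˡ (proj₂ (proj₂ (u∈ i)))) (*-∑ (c i) _)) ⟩
      ∑ (λ i → ∑ (λ j → c i * (f i j * b j)))
        ≈⟨ ∑-comm (λ i j → c i * (f i j * b j)) ⟩
      ∑ (λ j → ∑ (λ i → c i * (f i j * b j)))
        ≈⟨ ∑-cong (λ j → trans (∑-cong λ i → sym (*-assoc (c i) (f i j) (b j)))
                                   (sym (∑-* (b j) (λ i → c i * f i j)))) ⟩
      ∑ (λ j → ∑ (λ i → c i * f i j) * b j)
        ≈⟨ ∑-zero (λ j → trans (*-congʳ (rel j)) (zeroˡ _)) ⟩
      0# ∎)
      where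
      f : Fin (suc n) → Fin n → Carrier
      f i = proj₁ (u∈ i)

  module _ {s : Level} {F : Pred Carrier s} (isF : IsSubfield F) where
    private
      module F = IsSubfield isF
      isR = F.isSubring

    solve-for : ∀ {n} {b : Fin n → Carrier} {c₀ x : Carrier} {c : Fin n → Carrier} → c₀ ∈ F → c₀ ≉ 0# →
      (∀ i → c i ∈ F) → c₀ * x + ∑ (λ i → c i * b i) ≈ 0# → x ∈ Span F b
    solve-for {b = b} {c₀} {x} {c} c₀∈ c₀≉0 c∈ eq =
      span-resp isR (begin
        - (c₀ ⁻¹) * ∑ (λ i → c i * b i)                        ≈⟨ solve 2 (λ a y → :- a :* y := a :* (:0 :- y)) refl _ _ ⟩
        c₀ ⁻¹ * (0# - ∑ (λ i → c i * b i))                     ≈⟨ *-congˡ (+-congʳ eq) ⟨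
        c₀ ⁻¹ * (c₀ * x + ∑ (λ i → c i * b i) - ∑ (λ i → c i * b i))
            ≈⟨ solve 4 (λ a c x y → a :* (c :* x :+ y :- y) := c :* (a :* x)) refl _ _ _ _ ⟩
        c₀ * (c₀ ⁻¹ * x)                                         ≈⟨ cancel-⁻¹ x c₀≉0 ⟩
        x                                                        ∎)
      (span-scale isR (F.neg (F.inv c₀≉0 c₀∈)) (c , c∈ , refl))

    independent-spans : ∀ {n} {b d : Fin n → Carrier} → Independent F d → (∀ i → d i ∈ Span F b) →
                        Span F b ⊆ Span F d
    independent-spans {n} {b} {d} ind d∈ {x} x∈ with span-dependent isR u u∈
      where
      u : Fin (suc n) → Carrier
      u zero    = x
      u (suc i) = d i
      u∈ : ∀ i → u i ∈ Span F b
      u∈ zero    = x∈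
      u∈ (suc i) = d∈ i
    ... | c , c∈ , (i₀ , c≉0) , rel with c zero ≟ 0#
    ...   | no c₀≉0  = solve-for (c∈ zero) c₀≉0 (c∈ ∘ suc) (trans (sym (∑-suc _)) rel)
    ...   | yes c₀≈0 = ⊥-elim (c≉0 (all0 i₀))
      where
      rel′ : ∑ (λ i → c (suc i) * d i) ≈ 0#
      rel′ = trans (sym (trans (+-congʳ (trans (*-congʳ c₀≈0) (zeroˡ x))) (+-identityˡ _))) (trans (sym (∑-suc _)) rel)
      all0 : ∀ i → c i ≈ 0#
      all0 zero    = c₀≈0
      all0 (suc i) = ind (c ∘ suc) (c∈ ∘ suc) rel′ i

    basis : (∀ {n} (b : Fin n → Carrier) → Dec (Dependent F b)) → ∀ n (b : Fin n → Carrier) →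
      ∃₂ λ m (d : Fin m → Carrier) → Independent F d × (∀ i → ∃ λ j → d i ≡ b j) × Span F b ⊆ Span F d
    basis dec zero b = zero , b , (λ _ _ _ ()) , (λ ()) , id
    basis dec (suc n) b with dec b
    ... | no  ¬dep = suc n , b , independent , (λ i → i , ≡.refl) , id
      where
      independent : Independent F b
      independent f f∈ rel i = Dec.decidable-stable (f i ≟ 0#) λ f≉0 → ¬dep (f , f∈ , (i , f≉0) , rel)
    ... | yes (f , f∈ , (i₀ , f≉0) , rel) with basis dec n (removeAt b i₀)
    ...   | m , d , ind , d⊆b , b⊆d = m , d , ind , (λ i → punchIn i₀ (proj₁ (d⊆b i)) , proj₂ (d⊆b i)) ,
                                      λ x∈ → b⊆d (span-mono isR b∈ x∈)
      where
      b∈ : ∀ i → b i ∈ Span F (removeAt b i₀)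
      b∈ i with i₀ Finₚ.≟ i
      ... | yes ≡.refl = solve-for (f∈ i₀) f≉0 (f∈ ∘ punchIn i₀)
                           (trans (sym (∑-remove i₀ (λ k → f k * b k))) rel)
      ... | no  i₀≢i = ≡.subst (λ k → b k ∈ Span F (removeAt b i₀)) (Finₚ.punchIn-punchOut i₀≢i)
                         (span-gen isR (Fin.punchOut i₀≢i))

module Algebraic {c ℓ : Level} (𝔽 : Field c ℓ) (_≟_ : ∀ a b → Dec (Field._≈_ 𝔽 a b)) where
  open Field 𝔽 hiding (zero)
  open FieldTheory 𝔽 using (_^_; AlgebraicOver)
  open FieldLemmas 𝔽
  open Subrings 𝔽
  open Summation 𝔽
  open Spans 𝔽 _≟_
  open IntegerSolver commutativeRing
  open SemiringExp semiring using (^-congˡ; ^-congʳ; ^-homo-*)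
  open SetoidReasoning setoid

  record IsFiniteAlgebra {s : Level} (F : Pred Carrier s) {n : ℕ} (b : Fin n → Carrier) : Set (c ⊔ ℓ ⊔ s) where
    field
      one : 1# ∈ Span F b
      mul : ∀ i j → b i * b j ∈ Span F b

  powers : ∀ {n} → Carrier → Fin n → Carrier
  powers a i = a ^ toℕ i

  infixl 7 _⊗_
  _⊗_ : ∀ {n m} → (Fin n → Carrier) → (Fin m → Carrier) → Fin (n ℕ.* m) → Carrier
  _⊗_ {n} {m} b d k = b (proj₁ (remQuot {n} m k)) * d (proj₂ (remQuot {n} m k))

  ⊗-combine : ∀ {n m} (b : Fin n → Carrier) (d : Fin m → Carrier) i j → (b ⊗ d) (combine i j) ≡ b i * d j
  ⊗-combine b d i j = ≡.cong (λ q → b (proj₁ q) * d (proj₂ q)) (Finₚ.remQuot-combine i j)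

  algebraic-cong : ∀ {s} {F : Pred Carrier s} {a b} → a ≈ b → a ∈ AlgebraicOver F → b ∈ AlgebraicOver F
  algebraic-cong {a = a} {b} a≈b (d , f , f∈ , f≉0 , rel) = d , f , f∈ , f≉0 , (begin
    _                            ≡⟨ ≡.sym (∑≡sum (λ i → f i * b ^ toℕ i)) ⟩
    ∑ (λ i → f i * b ^ toℕ i)    ≈⟨ ∑-cong (λ i → *-congˡ (^-congˡ (toℕ i) a≈b)) ⟨
    ∑ (λ i → f i * a ^ toℕ i)    ≡⟨ ∑≡sum _ ⟩
    _                            ≈⟨ rel ⟩
    0#                           ∎)

  module _ {s : Level} {F : Pred Carrier s} (isF : IsSubfield F) where
    private
      module F = IsSubfield isF
      isR = F.isSubring

    span-⊗ : ∀ {n m} {b : Fin n → Carrier} {d : Fin m → Carrier} {x y} →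
             x ∈ Span F b → y ∈ Span F d → x * y ∈ Span F (b ⊗ d)
    span-⊗ {b = b} {d} x∈ y∈ = span-*ʳ isR (λ i → span-resp isR (*-comm _ _)
      (span-*ʳ isR (λ j → span-resp isR (trans (reflexive (⊗-combine b d i j)) (*-comm _ _))
        (span-gen isR (combine i j))) y∈)) x∈

    algebra-mul : ∀ {n} {b : Fin n → Carrier} {x y} → IsFiniteAlgebra F b →
                  x ∈ Span F b → y ∈ Span F b → x * y ∈ Span F b
    algebra-mul alg x∈ y∈ = span-*ʳ isR (λ i → span-resp isR (*-comm _ _)
      (span-*ʳ isR (λ j → IsFiniteAlgebra.mul alg j i) y∈)) x∈

    algebra-pow : ∀ {n} {b : Fin n → Carrier} {x} → IsFiniteAlgebra F b → x ∈ Span F b → ∀ k → x ^ k ∈ Span F b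
    algebra-pow alg x∈ zero    = IsFiniteAlgebra.one alg
    algebra-pow alg x∈ (suc k) = algebra-mul alg x∈ (algebra-pow alg x∈ k)

    unit : Fin 1 → Carrier
    unit _ = 1#

    span-unit : F ⊆ Span F unit
    span-unit a∈ = span-resp isR (*-identityʳ _) (span-scale isR a∈ (span-gen isR zero))

    unit-isFiniteAlgebra : IsFiniteAlgebra F unit
    unit-isFiniteAlgebra = record
      { one = span-unit F.one ; mul = λ _ _ → span-unit (F.mul F.one F.one) }

    span⇒algebraic : ∀ {n} {b : Fin n → Carrier} → IsFiniteAlgebra F b → Span F b ⊆ AlgebraicOver F
    span⇒algebraic {n} alg {a} a∈ with span-dependent isR {n = n} (powers a) (λ i → algebra-pow alg a∈ (toℕ i))
    ... | c , c∈ , c≉0 , rel = suc n , c , c∈ , c≉0 , trans (reflexive (≡.sym (∑≡sum _))) rel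

    monic-relation : ∀ {a} → a ∈ AlgebraicOver F →
      ∃₂ λ m (g : Fin m → Carrier) → (∀ i → g i ∈ F) × a ^ m ≈ ∑ (λ i → g i * a ^ toℕ i)
    monic-relation {a} (d , f , f∈ , nz , rel) = go d f f∈ nz (trans (reflexive (∑≡sum _)) rel)
      where
      go : ∀ d (f : Fin d → Carrier) → (∀ i → f i ∈ F) → (∃ λ i → f i ≉ 0#) → ∑ (λ i → f i * a ^ toℕ i) ≈ 0# →
        ∃₂ λ m (g : Fin m → Carrier) → (∀ i → g i ∈ F) × a ^ m ≈ ∑ (λ i → g i * a ^ toℕ i)
      go (suc d) f f∈ (i , fᵢ≉0) rel = split (f (fromℕ d) ≟ 0#)
        where
        S = ∑ (λ i → f (inject₁ i) * a ^ toℕ i)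
        unfold : S + f (fromℕ d) * a ^ d ≈ 0#
        unfold = begin
          S + f (fromℕ d) * a ^ d
            ≈⟨ +-cong (∑-cong λ i → *-congˡ (^-congʳ a (≡.sym (Finₚ.toℕ-inject₁ i))))
                      (*-congˡ (^-congʳ a (≡.sym (Finₚ.toℕ-fromℕ d)))) ⟩
          ∑ (λ i → f (inject₁ i) * a ^ toℕ (inject₁ i)) + f (fromℕ d) * a ^ toℕ (fromℕ d)
            ≈⟨ ∑-init-last (λ i → f i * a ^ toℕ i) ⟨
          ∑ (λ i → f i * a ^ toℕ i)
            ≈⟨ rel ⟩
          0# ∎
        split : Dec (f (fromℕ d) ≈ 0#) →
          ∃₂ λ m (g : Fin m → Carrier) → (∀ i → g i ∈ F) × a ^ m ≈ ∑ (λ i → g i * a ^ toℕ i)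
        split (no f≉0)  = d , solve-for isF {x = a ^ d} {c = λ i → f (inject₁ i)} (f∈ (fromℕ d)) f≉0
                            (λ i → f∈ (inject₁ i)) (trans (+-comm _ _) unfold)
        split (yes f≈0) = go d (f ∘ inject₁) (f∈ ∘ inject₁) (nonzero (view i) fᵢ≉0)
                            (trans (sym (trans (+-congˡ (trans (*-congʳ f≈0) (zeroˡ _))) (+-identityʳ S))) unfold)
          where
          nonzero : ∀ {i} → Top.View i → f i ≉ 0# → ∃ λ j → f (inject₁ j) ≉ 0#
          nonzero ‵fromℕ       f≉0 = contradiction f≈0 f≉0
          nonzero (‵inject₁ j) f≉0 = j , f≉0

    inverse-relation : ∀ {a} → a ≉ 0# → a ∈ AlgebraicOver F →
      ∃₂ λ m (g : Fin m → Carrier) → (∀ i → g i ∈ F) × a ⁻¹ ≈ ∑ (λ i → g i * a ^ toℕ i)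
    inverse-relation {a} a≉0 (d , f , f∈ , nz , rel) = go d f f∈ nz (trans (reflexive (∑≡sum _)) rel)
      where
      factor : ∀ {d} (f : Fin (suc d) → Carrier) →
               ∑ (λ i → f i * a ^ toℕ i) ≈ f zero + a * ∑ (λ i → f (suc i) * a ^ toℕ i)
      factor f = trans (∑-suc _) (+-cong (*-identityʳ _) (trans
        (∑-cong λ i → solve 3 (λ f a b → f :* (a :* b) := a :* (f :* b)) refl (f (suc i)) a (a ^ toℕ i))
        (sym (*-∑ a _))))
      go : ∀ d (f : Fin d → Carrier) → (∀ i → f i ∈ F) → (∃ λ i → f i ≉ 0#) → ∑ (λ i → f i * a ^ toℕ i) ≈ 0# →
        ∃₂ λ m (g : Fin m → Carrier) → (∀ i → g i ∈ F) × a ⁻¹ ≈ ∑ (λ i → g i * a ^ toℕ i)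
      go (suc d) f f∈ (i , fᵢ≉0) rel = split (f zero ≟ 0#)
        where
        S = ∑ (λ i → f (suc i) * a ^ toℕ i)
        unfold : f zero + a * S ≈ 0#
        unfold = trans (sym (factor f)) rel
        split : Dec (f zero ≈ 0#) →
          ∃₂ λ m (g : Fin m → Carrier) → (∀ i → g i ∈ F) × a ⁻¹ ≈ ∑ (λ i → g i * a ^ toℕ i)
        split (no f₀≉0) = d , solve-for isF {x = a ⁻¹} {c = f ∘ suc} (f∈ zero) f₀≉0 (f∈ ∘ suc)
          (*-zero-divisor a≉0 (begin
            a * (f zero * a ⁻¹ + S)           ≈⟨ solve 4 (λ a f i s → a :* (f :* i :+ s) := f :* (a :* i) :+ a :* s)
                refl a (f zero) (a ⁻¹) S ⟩
            f zero * (a * a ⁻¹) + a * S       ≈⟨ +-congʳ (trans (*-congˡ (⁻¹-inverseʳ a≉0)) (*-identityʳ _)) ⟩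
            f zero + a * S                    ≈⟨ unfold ⟩
            0#                                ∎))
        split (yes f₀≈0) = go d (f ∘ suc) (f∈ ∘ suc) (nonzero i fᵢ≉0)
          (*-zero-divisor a≉0 (trans (sym (trans (+-congʳ f₀≈0) (+-identityˡ _))) unfold))
          where
          nonzero : ∀ i → f i ≉ 0# → ∃ λ j → f (suc j) ≉ 0#
          nonzero zero    f≉0 = contradiction f₀≈0 f≉0
          nonzero (suc j) f≉0 = j , f≉0

    span-powers : ∀ {n} {b : Fin n → Carrier} {a} m (g : Fin m → Carrier) → IsFiniteAlgebra F b →
                  (∀ i → g i ∈ F) → a ∈ Span F b → ∑ (λ i → g i * a ^ toℕ i) ∈ Span F b
    span-powers m g alg g∈ a∈ = span-sum isR λ i → span-scale isR (g∈ i) (algebra-pow alg a∈ (toℕ i))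

    span-inv : ∀ {n} {b : Fin n → Carrier} {a} → IsFiniteAlgebra F b → a ≉ 0# → a ∈ Span F b → a ⁻¹ ∈ Span F b
    span-inv alg a≉0 a∈ with inverse-relation a≉0 (span⇒algebraic alg a∈)
    ... | m , g , g∈ , eq = span-resp isR (sym eq) (span-powers m g alg g∈ a∈)

    module Adjoin {n : ℕ} {B : Fin n → Carrier} (alg : IsFiniteAlgebra F B) {a : Carrier} {m : ℕ}
                  {g : Fin m → Carrier} (g∈ : ∀ i → g i ∈ Span F B) (eq : a ^ m ≈ ∑ (λ i → g i * a ^ toℕ i)) where

      private
        T : Fin (n ℕ.* m) → Carrier
        T = B ⊗ powers a

        below : ∀ {x} k → k ℕ.< m → x ∈ Span F B → x * a ^ k ∈ Span F T
        below {x} k k<m x∈ = span-resp isR (*-congˡ (^-congʳ a (Finₚ.toℕ-fromℕ< k<m)))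
          (span-⊗ {d = powers a} x∈ (span-gen isR (fromℕ< k<m)))

        at-m : ∀ {x} → x ∈ Span F B → x * a ^ m ∈ Span F T
        at-m {x} x∈ = span-resp isR (sym (trans (*-congˡ eq) (*-∑ x _)))
          (span-sum isR λ i → span-resp isR (*-assoc _ _ _)
            (below (toℕ i) (Finₚ.toℕ<n i) (algebra-mul alg x∈ (g∈ i))))

        upto : ∀ {x} k → k ℕ.≤ m → x ∈ Span F B → x * a ^ k ∈ Span F T
        upto k k≤m x∈ with ℕₚ.m≤n⇒m<n∨m≡n k≤m
        ... | inj₁ k<m    = below k k<m x∈
        ... | inj₂ ≡.refl = at-m x∈

        shift : ∀ {y} → y ∈ Span F T → y * a ∈ Span F T
        shift = span-*ʳ isR λ i → span-resp isR
          (solve 3 (λ b a p → b :* (a :* p) := b :* p :* a) refl _ _ _)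
          (upto (suc (toℕ (proj₂ (remQuot {n} m i)))) (Finₚ.toℕ<n (proj₂ (remQuot {n} m i)))
                (span-gen isR (proj₁ (remQuot {n} m i))))

        all : ∀ {x} k → x ∈ Span F B → x * a ^ k ∈ Span F T
        all zero    x∈ = upto 0 z≤n x∈
        all {x} (suc k) x∈ = span-resp isR (solve 3 (λ x a p → x :* p :* a := x :* (a :* p)) refl _ _ _) (shift (all k x∈))

      adjoin-isFiniteAlgebra : IsFiniteAlgebra F T
      adjoin-isFiniteAlgebra = record
        { one = span-resp isR (*-identityʳ _) (all 0 (IsFiniteAlgebra.one alg))
        ; mul = λ i j → span-resp isR (trans (*-congˡ (^-homo-* a (toℕ (proj₂ (remQuot {n} m i)))
            (toℕ (proj₂ (remQuot {n} m j)))))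
                  (solve 4 (λ a b c d → (a :* b) :* (c :* d) := (a :* c) :* (b :* d)) refl _ _ _ _))
                  (all (toℕ (proj₂ (remQuot {n} m i)) ℕ.+ toℕ (proj₂ (remQuot {n} m j)))
                      (IsFiniteAlgebra.mul alg (proj₁ (remQuot {n} m i)) (proj₁ (remQuot {n} m j))))
        }

      adjoined : a ∈ Span F T
      adjoined = span-resp isR (trans (*-identityˡ _) (*-identityʳ _)) (all 1 (IsFiniteAlgebra.one alg))

      adjoin-⊇ : Span F B ⊆ Span F T
      adjoin-⊇ x∈ = span-resp isR (*-identityʳ _) (all 0 x∈)

    InFiniteAlgebra : ∀ {m} → (Fin m → Carrier) → Set (c ⊔ ℓ ⊔ s)
    InFiniteAlgebra a = ∃₂ λ n (b : Fin n → Carrier) → IsFiniteAlgebra F b × ∀ i → a i ∈ Span F b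

    algebraic⇒finite : ∀ {m} (a : Fin m → Carrier) → (∀ i → a i ∈ AlgebraicOver F) → InFiniteAlgebra a
    algebraic⇒finite {zero}  a a∈ = 1 , unit , unit-isFiniteAlgebra , λ ()
    algebraic⇒finite {suc m} a a∈ with algebraic⇒finite (a ∘ suc) (a∈ ∘ suc) | monic-relation (a∈ zero)
    ... | n , b , alg , as∈ | k , g , g∈ , eq = _ , _ , adjoin-isFiniteAlgebra , λ
      { zero → adjoined ; (suc i) → adjoin-⊇ (as∈ i) }
      where
      open Adjoin alg (λ i → span-resp isR (*-identityʳ _) (span-scale isR (g∈ i) (IsFiniteAlgebra.one alg))) eq

    pair : Carrier → Carrier → Fin 2 → Carrier
    pair a b zero    = a
    pair a b (suc _) = b

    algebraic-pair : ∀ {a b} → a ∈ AlgebraicOver F → b ∈ AlgebraicOver F → InFiniteAlgebra (pair a b)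
    algebraic-pair {a} {b} a∈ b∈ = algebraic⇒finite (pair a b) λ { zero → a∈ ; (suc _) → b∈ }

    base⊆algebraic : F ⊆ AlgebraicOver F
    base⊆algebraic a∈ = span⇒algebraic unit-isFiniteAlgebra (span-unit a∈)

    algebraic-isSubfield : IsSubfield (AlgebraicOver F)
    algebraic-isSubfield = record
      { isSubring = record
        { resp = algebraic-cong {F = F}
        ; one  = base⊆algebraic F.one
        ; add  = λ a∈ b∈ → let _ , _ , alg , ab∈ = algebraic-pair a∈ b∈ in
                   span⇒algebraic alg (span-add isR (ab∈ zero) (ab∈ (suc zero)))
        ; neg  = λ a∈ → let _ , _ , alg , ab∈ = algebraic-pair a∈ a∈ in
                   span⇒algebraic alg (span-neg isR (ab∈ zero))
        ; mul  = λ a∈ b∈ → let _ , _ , alg , ab∈ = algebraic-pair a∈ b∈ in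
                   span⇒algebraic alg (algebra-mul alg (ab∈ zero) (ab∈ (suc zero)))
        }
      ; inv = λ a≉0 a∈ → let _ , _ , alg , ab∈ = algebraic-pair a∈ a∈ in
                   span⇒algebraic alg (span-inv alg a≉0 (ab∈ zero))
      }

  module _ {s : Level} {F : Pred Carrier s} (isF : IsSubfield F) where

    algebraic-trans : AlgebraicOver (AlgebraicOver F) ⊆ AlgebraicOver F
    algebraic-trans a∈ with monic-relation (algebraic-isSubfield isF) a∈
    ... | m , g , g∈ , eq with algebraic⇒finite isF g g∈
    ...   | n , b , alg , gs∈ = span⇒algebraic isF adjoin-isFiniteAlgebra adjoined
      where open Adjoin isF alg gs∈ eq

  algebraic-mono : ∀ {s t} {F : Pred Carrier s} {G : Pred Carrier t} → F ⊆ G → AlgebraicOver F ⊆ AlgebraicOver G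
  algebraic-mono F⊆G (d , f , f∈ , nz , rel) = d , f , (λ i → F⊆G (f∈ i)) , nz , rel

module Adic {c ℓ : Level} (𝔽 : Field c ℓ) where
  open Field 𝔽 hiding (zero)
  open FieldTheory 𝔽 using (_^_; _·_)
  open FieldLemmas 𝔽
  open Subrings 𝔽
  open Summation 𝔽
  open IntegerSolver commutativeRing
  open SemiringExp semiring using (^-congˡ)
  open CommSemiringExp commutativeSemiring using (^-distrib-*)
  open SetoidReasoning setoid

  partial : Carrier → (ℕ → Carrier) → ℕ → Carrier
  partial π s zero    = 0#
  partial π s (suc N) = s 0 + π * partial π (s ∘ suc) N

  partial≈∑ : ∀ π s N → partial π s N ≈ ∑ {N} (λ i → π ^ toℕ i * s (toℕ i))
  partial≈∑ π s zero    = sym (∑-nil _)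
  partial≈∑ π s (suc N) = begin
    s 0 + π * partial π (s ∘ suc) N                          ≈⟨ +-cong (sym (*-identityˡ _))
        (*-congˡ (partial≈∑ π (s ∘ suc) N)) ⟩
    1# * s 0 + π * ∑ (λ i → π ^ toℕ i * s (suc (toℕ i)))     ≈⟨ +-congˡ
        (trans (*-∑ π _) (∑-cong λ i → sym (*-assoc _ _ _))) ⟩
    1# * s 0 + ∑ (λ i → π * π ^ toℕ i * s (suc (toℕ i)))     ≈⟨ ∑-suc _ ⟨
    ∑ (λ i → π ^ toℕ i * s (toℕ i))                          ∎

  module _ {a : Level} (A : Pred Carrier a) (π : Carrier) where

    Ideal : ℕ → Pred Carrier (c ⊔ ℓ ⊔ a)
    Ideal N y = ∃ λ r → r ∈ A × y ≈ π ^ N * r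

    -- y = Σ sₙ πⁿ
    IsSeries : (ℕ → Carrier) → Pred Carrier (c ⊔ ℓ ⊔ a)
    IsSeries s y = ∀ N → ∃ λ r → r ∈ A × y ≈ partial π s N + π ^ N * r

    record IsAdic : Set (c ⊔ ℓ ⊔ a) where
      field
        isSubring : IsSubring A
        π∈        : π ∈ A
        π≉0       : π ≉ 0#
        separated : ∀ {y} → (∀ N → y ∈ Ideal N) → y ≈ 0#
        absorb    : ∀ y → ∃ λ N → π ^ N * y ∈ A
        complete  : ∀ s → (∀ n → s n ∈ A) → ∃ (IsSeries s)

    UniqueDigits : {g : Level} → Pred Carrier g → Set (c ⊔ ℓ ⊔ a ⊔ g)
    UniqueDigits Γ = ∀ {γ δ r} → γ ∈ Γ → δ ∈ Γ → r ∈ A → γ ≈ δ + π * r → γ ≈ δ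

    record IsDigits {g : Level} (Γ : Pred Carrier g) : Set (c ⊔ ℓ ⊔ a ⊔ g) where
      field
        resp     : ∀ {γ δ} → γ ≈ δ → γ ∈ Γ → δ ∈ Γ
        integral : Γ ⊆ A
        exists   : ∀ {y} → y ∈ A → ∃₂ λ γ r → γ ∈ Γ × r ∈ A × y ≈ γ + π * r
        unique   : UniqueDigits Γ
        add      : ∀ {γ δ} → γ ∈ Γ → δ ∈ Γ → γ + δ ∈ Γ
        zer      : 0# ∈ Γ

    IsExpansionOf : {g : Level} → Pred Carrier g → (ℕ → Carrier) → Pred Carrier (c ⊔ ℓ ⊔ a ⊔ g)
    IsExpansionOf Γ s y = (∀ n → s n ∈ Γ) × IsSeries s y

  module AdicLemmas {a : Level} {A : Pred Carrier a} {π : Carrier} (adic : IsAdic A π) where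
    open IsAdic adic
    private module A = IsSubring isSubring

    ideal-suc : ∀ {N y z} → y ≈ π * z → z ∈ Ideal A π N → y ∈ Ideal A π (suc N)
    ideal-suc y≈πz (r , r∈ , z≈) = r , r∈ , trans y≈πz (trans (*-congˡ z≈) (sym (*-assoc _ _ _)))

    ideal-zero : ∀ {y} → y ∈ A → y ∈ Ideal A π 0
    ideal-zero y∈ = _ , y∈ , sym (*-identityˡ _)

    1∉π : ∀ {r} → r ∈ A → 1# ≉ π * r
    1∉π {r} r∈ 1≈πr = 1≉0 (separated λ N → r ^ N , A.pow N r∈ ,
      trans (sym (1^n≈1 N)) (trans (^-congˡ N 1≈πr) (^-distrib-* π r N)))

    partial-cong : ∀ {s t} N → (∀ n → s n ≈ t n) → partial π s N ≈ partial π t N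
    partial-cong zero    s≈t = refl
    partial-cong (suc N) s≈t = +-cong (s≈t 0) (*-congˡ (partial-cong N (s≈t ∘ suc)))

    partial-+ : ∀ s t N → partial π (λ n → s n + t n) N ≈ partial π s N + partial π t N
    partial-+ s t zero    = sym (+-identityˡ _)
    partial-+ s t (suc N) = trans (+-congˡ (*-congˡ (partial-+ (s ∘ suc) (t ∘ suc) N)))
      (solve 5 (λ a b p x y → (a :+ b) :+ p :* (x :+ y) := (a :+ p :* x) :+ (b :+ p :* y)) refl (s 0) (t 0) π _ _)

    partial-* : ∀ e s N → partial π (λ n → e * s n) N ≈ e * partial π s N
    partial-* e s zero    = sym (zeroʳ e)
    partial-* e s (suc N) = trans (+-congˡ (*-congˡ (partial-* e (s ∘ suc) N)))
      (solve 4 (λ e a p x → e :* a :+ p :* (e :* x) := e :* (a :+ p :* x)) refl e (s 0) π _)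

    series-cong : ∀ {s t y z} → (∀ n → s n ≈ t n) → y ≈ z → IsSeries A π s y → IsSeries A π t z
    series-cong s≈t y≈z ser N = let r , r∈ , eq = ser N in
      r , r∈ , trans (sym y≈z) (trans eq (+-congʳ (partial-cong N s≈t)))

    series∈ : ∀ {s y} → IsSeries A π s y → y ∈ A
    series∈ ser = let r , r∈ , eq = ser 0 in
      A.resp (sym (trans eq (trans (+-identityˡ _) (*-identityˡ _)))) r∈

    series-unique : ∀ {s y z} → IsSeries A π s y → IsSeries A π s z → y ≈ z
    series-unique {s} {y} {z} ser ser′ = x-y≈0⇒x≈y (separated λ N →
      let r , r∈ , eq = ser N ; r′ , r′∈ , eq′ = ser′ N in
      r - r′ , A.add r∈ (A.neg r′∈) , trans (+-cong eq (-‿cong eq′))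
        (solve 4 (λ P p r r′ → (P :+ p :* r) :- (P :+ p :* r′) := p :* (r :- r′)) refl (partial π s N) (π ^ N) r r′))

    series-+ : ∀ {s t y z} → IsSeries A π s y → IsSeries A π t z → IsSeries A π (λ n → s n + t n) (y + z)
    series-+ {s} {t} ser ser′ N = let r , r∈ , eq = ser N ; r′ , r′∈ , eq′ = ser′ N in
      r + r′ , A.add r∈ r′∈ , trans (+-cong eq eq′) (trans
        (solve 5 (λ P Q p r r′ → (P :+ p :* r) :+ (Q :+ p :* r′) := (P :+ Q) :+ p :* (r :+ r′)) refl
          (partial π s N) (partial π t N) (π ^ N) r r′)
        (+-congʳ (sym (partial-+ s t N))))

    series-* : ∀ {e s y} → e ∈ A → IsSeries A π s y → IsSeries A π (λ n → e * s n) (e * y)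
    series-* {e} {s} e∈ ser N = let r , r∈ , eq = ser N in
      e * r , A.mul e∈ r∈ , trans (*-congˡ eq) (trans
        (solve 4 (λ e P p r → e :* (P :+ p :* r) := e :* P :+ p :* (e :* r)) refl e (partial π s N) (π ^ N) r)
        (+-congʳ (sym (partial-* e s N))))

    series-tails : ∀ {s} (Y : ℕ → Carrier) → (∀ n → Y n ∈ A) → (∀ n → Y n ≈ s n + π * Y (suc n)) →
                   IsSeries A π s (Y 0)
    series-tails Y Y∈ eq zero    = Y 0 , Y∈ 0 , sym (trans (+-identityˡ _) (*-identityˡ _))
    series-tails {s} Y Y∈ eq (suc N) = let r , r∈ , eq′ = series-tails {s ∘ suc} (Y ∘ suc) (Y∈ ∘ suc) (eq ∘ suc) N in
      r , r∈ , trans (eq 0) (trans (+-congˡ (*-congˡ eq′))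
        (solve 5 (λ a p P q r → a :+ p :* (P :+ q :* r) := (a :+ p :* P) :+ p :* q :* r) refl (s 0) π _ (π ^ N) r))

    series-cons : ∀ {s y} → s 0 ∈ A → IsSeries A π (s ∘ suc) y → IsSeries A π s (s 0 + π * y)
    series-cons s0∈ ser zero = _ , A.add s0∈ (A.mul π∈ (series∈ ser)) , sym (trans (+-identityˡ _) (*-identityˡ _))
    series-cons {s} s0∈ ser (suc N) = let r , r∈ , eq = ser N in
      r , r∈ , trans (+-congˡ (*-congˡ eq))
        (solve 5 (λ a p P q r → a :+ p :* (P :+ q :* r) := (a :+ p :* P) :+ p :* q :* r) refl (s 0) π _ (π ^ N) r)

    series-zero : IsSeries A π (λ _ → 0#) 0#
    series-zero = series-tails (λ _ → 0#) (λ _ → A.zer) (λ _ → sym (trans (+-identityˡ _) (zeroʳ π)))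

    series-∑ : ∀ {m} {s : Fin m → ℕ → Carrier} {y : Fin m → Carrier} →
               (∀ i → IsSeries A π (s i) (y i)) → IsSeries A π (λ n → ∑ (λ i → s i n)) (∑ y)
    series-∑ {zero}  ser = series-cong (λ n → sym (∑-nil _)) (sym (∑-nil _)) series-zero
    series-∑ {suc m} ser = series-cong (λ n → sym (∑-suc _)) (sym (∑-suc _)) (series-+ (ser zero) (series-∑ (ser ∘ suc)))

    series-tail : ∀ {s y} → (∀ n → s n ∈ A) → IsSeries A π s y →
                  ∃ λ z → IsSeries A π (s ∘ suc) z × y ≈ s 0 + π * z
    series-tail {s} s∈ ser = let z , ser′ = complete (s ∘ suc) (s∈ ∘ suc) in
      z , ser′ , series-unique ser (series-cons {s} (s∈ 0) ser′)

    series-drop : ∀ {s y} → (∀ n → s n ∈ A) → IsSeries A π s y → ∀ N →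
                  ∃ λ z → IsSeries A π (λ n → s (N ℕ.+ n)) z × y ≈ partial π s N + π ^ N * z
    series-drop s∈ ser zero = _ , ser , sym (trans (+-identityˡ _) (*-identityˡ _))
    series-drop {s} s∈ ser (suc N) =
      let z , ser′ , eq = series-tail s∈ ser
          w , ser″ , eq′ = series-drop {s ∘ suc} (s∈ ∘ suc) ser′ N in
      w , ser″ , trans eq (trans (+-congˡ (*-congˡ eq′))
        (solve 5 (λ a p P q r → a :+ p :* (P :+ q :* r) := (a :+ p :* P) :+ p :* q :* r) refl (s 0) π _ (π ^ N) w))

    digits-unique : ∀ {g} {Γ : Pred Carrier g} → Γ ⊆ A → UniqueDigits A π Γ → ∀ {s t y z} → y ≈ z →
                    IsExpansionOf A π Γ s y → IsExpansionOf A π Γ t z → ∀ n → s n ≈ t n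
    digits-unique {Γ = Γ} Γ⊆A uniq {s} {t} y≈z (s∈ , ser) (t∈ , ser′) = go
      where
      y-tail = series-tail (Γ⊆A ∘ s∈) ser
      z-tail = series-tail (Γ⊆A ∘ t∈) ser′
      y′ = proj₁ y-tail
      z′ = proj₁ z-tail
      sery′ = proj₁ (proj₂ y-tail)
      serz′ = proj₁ (proj₂ z-tail)
      s0+πy≈t0+πz : s 0 + π * y′ ≈ t 0 + π * z′
      s0+πy≈t0+πz = trans (sym (proj₂ (proj₂ y-tail))) (trans y≈z (proj₂ (proj₂ z-tail)))
      s0≈t0 : s 0 ≈ t 0
      s0≈t0 = uniq (s∈ 0) (t∈ 0) (A.add (series∈ serz′) (A.neg (series∈ sery′))) (begin
        s 0                            ≈⟨ solve 3 (λ s p y → s := (s :+ p :* y) :- p :* y) refl (s 0) π y′ ⟩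
        (s 0 + π * y′) - π * y′        ≈⟨ +-congʳ s0+πy≈t0+πz ⟩
        (t 0 + π * z′) - π * y′        ≈⟨ solve 4 (λ t p z y → (t :+ p :* z) :- p :* y := t :+ p :* (z :- y)) refl
            (t 0) π z′ y′ ⟩
        t 0 + π * (z′ - y′)            ∎)
      y′≈z′ : y′ ≈ z′
      y′≈z′ = *-cancelˡ π≉0 (begin
        π * y′                         ≈⟨ solve 2 (λ s y → y := (s :+ y) :- s) refl (s 0) (π * y′) ⟩
        (s 0 + π * y′) - s 0           ≈⟨ +-cong s0+πy≈t0+πz (-‿cong s0≈t0) ⟩
        (t 0 + π * z′) - t 0           ≈⟨ solve 2 (λ s y → y := (s :+ y) :- s) refl (t 0) (π * z′) ⟨
        π * z′                         ∎)
      go : ∀ n → s n ≈ t n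
      go zero    = s0≈t0
      go (suc n) = digits-unique Γ⊆A uniq y′≈z′ (s∈ ∘ suc , sery′) (t∈ ∘ suc , serz′) n

    module Digits {g : Level} {Γ : Pred Carrier g} (digits : IsDigits A π Γ) where
      private module Γ = IsDigits digits

      expand : ∀ {y} → y ∈ A → ∃ λ s → IsExpansionOf A π Γ s y
      expand {y} y∈ = (λ n → digit (tails n)) , (λ n → digit∈ (tails n)) ,
        series-tails (λ n → proj₁ (tails n)) (λ n → proj₂ (tails n)) (λ n → proj₂ (proj₂ (proj₂ (proj₂ (split (tails n))))))
        where
        split : (z : ∃ A) → ∃₂ λ γ r → γ ∈ Γ × r ∈ A × proj₁ z ≈ γ + π * r
        split (z , z∈) = Γ.exists z∈
        digit : ∃ A → Carrier
        digit z = proj₁ (split z)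
        digit∈ : ∀ z → digit z ∈ Γ
        digit∈ z = proj₁ (proj₂ (proj₂ (split z)))
        tails : ℕ → ∃ A
        tails zero    = y , y∈
        tails (suc n) = let _ , r , _ , r∈ , _ = split (tails n) in r , r∈

      expansion-unique : ∀ {s t y z} → y ≈ z → IsExpansionOf A π Γ s y → IsExpansionOf A π Γ t z → ∀ n → s n ≈ t n
      expansion-unique = digits-unique Γ.integral Γ.unique

      expansion-+ : ∀ {s t y z} → IsExpansionOf A π Γ s y → IsExpansionOf A π Γ t z →
                    IsExpansionOf A π Γ (λ n → s n + t n) (y + z)
      expansion-+ (s∈ , ser) (t∈ , ser′) = (λ n → Γ.add (s∈ n) (t∈ n)) , series-+ ser ser′

      prepend-zero : (ℕ → Carrier) → ℕ → Carrier
      prepend-zero s zero    = 0#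
      prepend-zero s (suc n) = s n

      expansion-π* : ∀ {s y} → IsExpansionOf A π Γ s y → IsExpansionOf A π Γ (prepend-zero s) (π * y)
      expansion-π* {s} {y} (s∈ , ser) = (λ { zero → Γ.zer ; (suc n) → s∈ n }) ,
        series-cong (λ _ → refl) (+-identityˡ _) (series-cons {prepend-zero s} A.zer ser)

      expansion-shift : ∀ {s t y} k → IsExpansionOf A π Γ s y → IsExpansionOf A π Γ t (π ^ k * y) → ∀ n → s n ≈ t (k ℕ.+ n)
      expansion-shift zero    es et = expansion-unique (sym (*-identityˡ _)) es et
      expansion-shift {s} {t} {y} (suc k) es@(_ , ser) et n = trans (expansion-shift k es eu n)
          (expansion-unique (sym (*-assoc _ _ _)) (expansion-π* eu) et (suc (k ℕ.+ n)))
        where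
        u : ∃ λ u → IsExpansionOf A π Γ u (π ^ k * y)
        u = expand (A.mul (A.pow k π∈) (series∈ ser))
        eu = proj₂ u

  module FrobeniusSeries {p : ℕ} (pr : Prime p) (char : p · 1# ≈ 0#)
                         {a : Level} {A : Pred Carrier a} {π : Carrier} (adic : IsAdic A π) where
    open IsAdic adic
    open AdicLemmas adic
    open Characteristic 𝔽 pr char
    private module A = IsSubring isSubring

    -- The difference of the two sides is π^p times the difference for the shifted sequences, hence 0.
    series-split : ∀ {s : ℕ → Carrier} {w : Fin p → ℕ → Carrier} {y : Carrier} {d : Fin p → Carrier} →
      (∀ n → s n ∈ A) → (∀ j n → w j n ∈ A) → (∀ j n → s (n ℕ.* p ℕ.+ toℕ j) ≈ w j n ^ p) →
      IsSeries A π s y → (∀ j → IsSeries A π (w j) (d j)) → y ≈ ∑ (λ j → π ^ toℕ j * d j ^ p)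
    series-split s∈ w∈ s≈w ser ser′ = x-y≈0⇒x≈y (separated λ N → difference N s∈ w∈ s≈w ser ser′)
      where
      difference : ∀ N {s : ℕ → Carrier} {w : Fin p → ℕ → Carrier} {y : Carrier} {d : Fin p → Carrier} →
        (∀ n → s n ∈ A) → (∀ j n → w j n ∈ A) → (∀ j n → s (n ℕ.* p ℕ.+ toℕ j) ≈ w j n ^ p) →
        IsSeries A π s y → (∀ j → IsSeries A π (w j) (d j)) → y - ∑ (λ j → π ^ toℕ j * d j ^ p) ∈ Ideal A π N
      difference zero {d = d} s∈ w∈ s≈w ser ser′ = ideal-zero (A.add (series∈ ser)
        (A.neg (A.∑∈ λ j → A.mul (A.pow (toℕ j) π∈) (A.pow p (series∈ (ser′ j))))))
      difference (suc N) {s} {w} {y} {d} s∈ w∈ s≈w ser ser′ =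
          ideal-suc {N} e≈ (π ^ (p ℕ.∸ 1) * r , A.mul (A.pow (p ℕ.∸ 1) π∈) (proj₁ (proj₂ ih)) ,
            trans (*-congˡ (proj₂ (proj₂ ih))) (solve 3 (λ a b c → a :* (b :* c) := b :* (a :* c)) refl
                (π ^ (p ℕ.∸ 1)) (π ^ N) r))
        where
        dropped : ∃ λ z → IsSeries A π (λ n → s (p ℕ.+ n)) z × y ≈ partial π s p + π ^ p * z
        dropped = series-drop s∈ ser p
        y′ = proj₁ dropped
        tails : ∀ j → ∃ λ z → IsSeries A π (w j ∘ suc) z × d j ≈ w j 0 + π * z
        tails j = series-tail (w∈ j) (ser′ j)
        d′ : Fin p → Carrier
        d′ j = proj₁ (tails j)
        ih : y′ - ∑ (λ j → π ^ toℕ j * d′ j ^ p) ∈ Ideal A π N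
        ih = difference N {w = λ j n → w j (suc n)} (λ n → s∈ (p ℕ.+ n)) (λ j n → w∈ j (suc n))
               (λ j n → trans (reflexive (≡.cong s (≡.sym (ℕₚ.+-assoc p (n ℕ.* p) (toℕ j))))) (s≈w j (suc n)))
               (proj₁ (proj₂ dropped)) (λ j → proj₁ (proj₂ (tails j)))
        r = proj₁ ih
        S S₀ : Carrier
        S  = ∑ (λ j → π ^ toℕ j * d′ j ^ p)
        S₀ = ∑ {p} (λ j → π ^ toℕ j * s (toℕ j))
        π^p : π ^ p ≈ π * π ^ (p ℕ.∸ 1)
        π^p = reflexive (≡.cong (π ^_) (≡.sym (ℕₚ.suc-pred p)))
        dᵖ : ∀ j → π ^ toℕ j * d j ^ p ≈ π ^ toℕ j * s (toℕ j) + π ^ p * (π ^ toℕ j * d′ j ^ p)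
        dᵖ j = begin
          π ^ toℕ j * d j ^ p                              ≈⟨ *-congˡ (^-congˡ p (proj₂ (proj₂ (tails j)))) ⟩
          π ^ toℕ j * (w j 0 + π * d′ j) ^ p               ≈⟨ *-congˡ
              (trans (^p-homo-+ _ _) (+-cong (sym (s≈w j 0)) (^p-homo-* _ _))) ⟩
          π ^ toℕ j * (s (toℕ j) + π ^ p * d′ j ^ p)       ≈⟨ solve 4
              (λ a b c d → a :* (b :+ c :* d) := a :* b :+ c :* (a :* d)) refl (π ^ toℕ j) (s (toℕ j)) (π ^ p) (d′ j ^ p) ⟩
          π ^ toℕ j * s (toℕ j) + π ^ p * (π ^ toℕ j * d′ j ^ p) ∎
        e≈ : y - ∑ (λ j → π ^ toℕ j * d j ^ p) ≈ π * (π ^ (p ℕ.∸ 1) * (y′ - S))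
        e≈ = begin
          y - ∑ (λ j → π ^ toℕ j * d j ^ p)
            ≈⟨ +-cong (trans (proj₂ (proj₂ dropped)) (+-congʳ (partial≈∑ π s p)))
                (-‿cong (trans (∑-cong dᵖ) (trans (∑-+ _ _) (+-congˡ (sym (*-∑ (π ^ p) _)))))) ⟩
          (S₀ + π ^ p * y′) - (S₀ + π ^ p * S)
            ≈⟨ solve 4 (λ S₀ P y S → (S₀ :+ P :* y) :- (S₀ :+ P :* S) := P :* (y :- S)) refl S₀ (π ^ p) y′ S ⟩
          π ^ p * (y′ - S)
            ≈⟨ trans (*-congʳ π^p) (*-assoc _ _ _) ⟩
          π * (π ^ (p ℕ.∸ 1) * (y′ - S)) ∎

module Cartier {c ℓ : Level} (𝔽 : Field c ℓ) (_≟_ : ∀ a b → Dec (Field._≈_ 𝔽 a b))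
               {q : ℕ} (pr : Prime (suc q))
               (char : Field._≈_ 𝔽 (FieldTheory._·_ 𝔽 (suc q) (Field.1# 𝔽)) (Field.0# 𝔽)) where
  open Field 𝔽 hiding (zero)
  open FieldTheory 𝔽 using (_^_; _·_)
  open FieldLemmas 𝔽
  open Subrings 𝔽
  open Summation 𝔽
  open Adic 𝔽
  open PrimeSubfield 𝔽 pr char
  open IntegerSolver commutativeRing
  open SemiringExp semiring using (^-congˡ; ^-congʳ; ^-homo-*; ^-assocʳ)
  open SetoidReasoning setoid

  p : ℕ
  p = suc q

  record IsUniformizer {a k : Level} (A : Pred Carrier a) (t : Carrier) (κ : Pred Carrier k) : Set (c ⊔ ℓ ⊔ a ⊔ k) where
    field
      adic    : IsAdic A t
      radical : ∀ {y} → y ∈ A → y ^ p ∈ Ideal A t 1 → y ∈ Ideal A t 1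
      digits  : IsDigits A t κ
      power   : ∀ {u} → u ∈ κ → u ^ p ∈ κ
      root    : ∀ {u} → u ∈ κ → ∃ λ w → w ∈ κ × u ≈ w ^ p

  module CartierLemmas {a k : Level} {A : Pred Carrier a} {t : Carrier} {κ : Pred Carrier k}
                       (uniformizer : IsUniformizer A t κ) where
    open IsUniformizer uniformizer
    open IsAdic adic renaming (π∈ to t∈; π≉0 to t≉0)
    open AdicLemmas adic
    open Digits digits
    open FrobeniusSeries pr char adic
    private
      module A = IsSubring isSubring
      module κ = IsDigits digits

    absorb-more : ∀ {y N M} → N ℕ.≤ M → t ^ N * y ∈ A → t ^ M * y ∈ A
    absorb-more {y} {N} N≤M ty∈ = let o , N+o≡M = ℕₚ.m≤n⇒∃[o]m+o≡n N≤M in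
      A.resp (trans (solve 3 (λ a b y → a :* (b :* y) := b :* a :* y) refl (t ^ o) (t ^ N) y)
                    (*-congʳ (trans (sym (^-homo-* t N o)) (^-congʳ t N+o≡M))))
             (A.mul (A.pow o t∈) ty∈)

    absorb-all : ∀ {n} (y : Fin n → Carrier) → ∃ λ N → ∀ i → t ^ N * y i ∈ A
    absorb-all {zero}  y = 0 , λ ()
    absorb-all {suc n} y = let N , y0∈ = absorb (y zero) ; M , ys∈ = absorb-all (y ∘ suc) in
      N ℕ.⊔ M , λ { zero → absorb-more (ℕₚ.m≤m⊔n N M) y0∈ ; (suc i) → absorb-more (ℕₚ.m≤n⊔m N M) (ys∈ i) }

    combination : ∀ {n} → (Fin n → Carrier) → Carrier
    combination d = ∑ (λ j → t ^ toℕ j * d j ^ p)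

    combination-cong : ∀ {n} {d e : Fin n → Carrier} → (∀ j → d j ≈ e j) → combination d ≈ combination e
    combination-cong d≈e = ∑-cong λ j → *-congˡ (^-congˡ p (d≈e j))

    combination-+ : ∀ {n} (d e : Fin n → Carrier) → combination (λ j → d j + e j) ≈ combination d + combination e
    combination-+ d e = trans (∑-cong λ j → trans (*-congˡ (^p-homo-+ (d j) (e j))) (distribˡ _ _ _)) (∑-+ _ _)

    combination-* : ∀ {n} z (d : Fin n → Carrier) → combination (λ j → z * d j) ≈ z ^ p * combination d
    combination-* z d = trans (∑-cong λ j → trans (*-congˡ (^p-homo-* z (d j)))
      (solve 3 (λ a b c → a :* (b :* c) := b :* (a :* c)) refl (t ^ toℕ j) (z ^ p) (d j ^ p))) (sym (*-∑ (z ^ p) _))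

    private
      decompose-integral : ∀ {y} → y ∈ A → ∃ λ (d : Fin p → Carrier) → y ≈ combination d
      decompose-integral {y} y∈ =
        (λ j → proj₁ (coefficients j)) ,
        series-split (κ.integral ∘ s∈) (λ j n → κ.integral (proj₁ (proj₂ (w j n)))) (λ j n → proj₂ (proj₂ (w j n)))
          ser (λ j → proj₂ (coefficients j))
        where
        s = proj₁ (expand y∈)
        s∈ = proj₁ (proj₂ (expand y∈))
        ser = proj₂ (proj₂ (expand y∈))
        w : ∀ (j : Fin p) n → ∃ λ w → w ∈ κ × s (n ℕ.* p ℕ.+ toℕ j) ≈ w ^ p
        w j n = root (s∈ (n ℕ.* p ℕ.+ toℕ j))
        coefficients : ∀ j → ∃ (IsSeries A t (λ n → proj₁ (w j n)))
        coefficients j = complete (λ n → proj₁ (w j n)) (λ n → κ.integral (proj₁ (proj₂ (w j n))))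

    decompose : ∀ y → ∃ λ (d : Fin p → Carrier) → y ≈ combination d
    decompose y = (λ j → (t ⁻¹) ^ N * d j) , (begin
      y                                         ≈⟨ trans (*-congʳ (1^n≈1 p)) (*-identityˡ y) ⟨
      1# ^ p * y                                ≈⟨ *-congʳ (^-congˡ p (trans (*-comm _ _) (^-inverse N t≉0))) ⟨
      ((t ⁻¹) ^ N * t ^ N) ^ p * y              ≈⟨ *-congʳ (trans (^p-homo-* _ _) (*-congˡ (^-assocʳ t N p))) ⟩
      ((t ⁻¹) ^ N) ^ p * t ^ (N ℕ.* p) * y      ≈⟨ *-assoc _ _ _ ⟩
      ((t ⁻¹) ^ N) ^ p * (t ^ (N ℕ.* p) * y)    ≈⟨ *-congˡ (proj₂ scaled) ⟩
      ((t ⁻¹) ^ N) ^ p * combination d          ≈⟨ combination-* _ d ⟨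
      combination (λ j → (t ⁻¹) ^ N * d j)      ∎)
      where
      N = proj₁ (absorb y)
      scaled : ∃ λ (d : Fin p → Carrier) → t ^ (N ℕ.* p) * y ≈ combination d
      scaled = decompose-integral (absorb-more (ℕₚ.m≤m*n N p) (proj₂ (absorb y)))
      d = proj₁ scaled

    private
      step : ∀ k (d : Fin k → Carrier) → k ℕ.≤ p → (∀ j → d j ∈ A) → combination d ∈ Ideal A t k →
             ∀ j → d j ∈ Ideal A t 1
      step (suc k) d k<p d∈ (r , r∈ , eq) = λ { zero → d0∈ ; (suc j) → step k (d ∘ suc) (ℕₚ.<⇒≤ k<p) (d∈ ∘ suc) rest∈ j }
        where
        rest = combination (d ∘ suc)
        unfold : combination d ≈ d zero ^ p + t * rest
        unfold = trans (∑-suc _) (+-cong (*-identityˡ _) (trans (∑-cong λ j → *-assoc t _ _) (sym (*-∑ t _))))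
        d0ᵖ : d zero ^ p ≈ t ^ 1 * (t ^ k * r - rest)
        d0ᵖ = begin
          d zero ^ p                          ≈⟨ solve 2 (λ x y → x := (x :+ y) :- y) refl (d zero ^ p) (t * rest) ⟩
          (d zero ^ p + t * rest) - t * rest  ≈⟨ +-congʳ (trans (sym unfold) eq) ⟩
          t * t ^ k * r - t * rest            ≈⟨ solve 4 (λ t s r e → t :* s :* r :- t :* e := t :* :1 :*
              (s :* r :- e)) refl t (t ^ k) r rest ⟩
          t ^ 1 * (t ^ k * r - rest)          ∎
        d0∈ : d zero ∈ Ideal A t 1
        d0∈ = radical (d∈ zero) (_ , A.add (A.mul (A.pow k t∈) r∈)
                (A.neg (A.∑∈ λ j → A.mul (A.pow (toℕ j) t∈) (A.pow p (d∈ (suc j))))) , d0ᵖ)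
        rest∈ : rest ∈ Ideal A t k
        rest∈ = r - t ^ o * r₀ ^ p , A.add r∈ (A.neg (A.mul (A.pow o t∈) (A.pow p (proj₁ (proj₂ d0∈))))) ,
          *-cancelˡ t≉0 (begin
            t * rest                                    ≈⟨ solve 2 (λ x y → y := (x :+ y) :- x) refl (d zero ^ p)
                (t * rest) ⟩
            (d zero ^ p + t * rest) - d zero ^ p        ≈⟨ +-cong (trans (sym unfold) eq) (-‿cong (begin
              d zero ^ p                  ≈⟨ ^-congˡ p (proj₂ (proj₂ d0∈)) ⟩
              (t ^ 1 * r₀) ^ p            ≈⟨ ^p-homo-* _ _ ⟩
              (t * 1#) ^ p * r₀ ^ p       ≈⟨ *-congʳ (^-congˡ p (*-identityʳ t)) ⟩
              t ^ p * r₀ ^ p              ≈⟨ *-congʳ (*-congˡ (trans (^-congʳ t (≡.sym k+o≡q)) (^-homo-* t k o))) ⟩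
              t * (t ^ k * t ^ o) * r₀ ^ p ∎)) ⟩
            t * t ^ k * r - t * (t ^ k * t ^ o) * r₀ ^ p
              ≈⟨ solve 5 (λ t s r o e → t :* s :* r :- t :* (s :* o) :* e := t :* (s :* (r :- o :* e))) refl t (t ^ k)
                  r (t ^ o) (r₀ ^ p) ⟩
            t * (t ^ k * (r - t ^ o * r₀ ^ p)) ∎)
          where
          r₀ = proj₁ d0∈
          o = proj₁ (ℕₚ.m≤n⇒∃[o]m+o≡n (ℕₚ.≤-pred k<p))
          k+o≡q = proj₂ (ℕₚ.m≤n⇒∃[o]m+o≡n (ℕₚ.≤-pred k<p))

      vanish-integral : ∀ N (d : Fin p → Carrier) → (∀ j → d j ∈ A) → combination d ≈ 0# → ∀ j → d j ∈ Ideal A t N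
      vanish-integral zero    d d∈ eq j = ideal-zero (d∈ j)
      vanish-integral (suc N) d d∈ eq j = ideal-suc {N} (d≈ j) (vanish-integral N e e∈ e≈0 j)
        where
        small : ∀ j → d j ∈ Ideal A t 1
        small = step p d ℕₚ.≤-refl d∈ (0# , A.zer , trans eq (sym (zeroʳ _)))
        e : Fin p → Carrier
        e j = proj₁ (small j)
        e∈ : ∀ j → e j ∈ A
        e∈ j = proj₁ (proj₂ (small j))
        d≈ : ∀ j → d j ≈ t * e j
        d≈ j = trans (proj₂ (proj₂ (small j))) (*-congʳ (*-identityʳ t))
        e≈0 : combination e ≈ 0#
        e≈0 = *-zero-divisor (^-nonzero p t≉0) (trans (sym (combination-* t e)) (trans (combination-cong (sym ∘ d≈)) eq))

    vanish : ∀ (d : Fin p → Carrier) → combination d ≈ 0# → ∀ j → d j ≈ 0#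
    vanish d eq j = let M , td∈ = absorb-all d in *-zero-divisor (^-nonzero M t≉0) (separated λ N →
      vanish-integral N (λ j → t ^ M * d j) td∈ (trans (combination-* (t ^ M) d) (trans (*-congˡ eq) (zeroʳ _))) j)

    abstract
      cartier : Carrier → Fin p → Carrier
      cartier y = proj₁ (decompose y)

      cartier-combination : ∀ y → y ≈ combination (cartier y)
      cartier-combination y = proj₂ (decompose y)

    cartier-unique : ∀ {y} (d : Fin p → Carrier) → y ≈ combination d → ∀ j → cartier y j ≈ d j
    cartier-unique {y} d eq j = x-y≈0⇒x≈y (vanish (λ j → cartier y j - d j) (begin
      combination (λ j → cartier y j - d j)                      ≈⟨ combination-+ _ _ ⟩
      combination (cartier y) + combination (λ j → - d j)        ≈⟨ +-cong (trans (sym (cartier-combination y)) eq)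
                                                                      (∑-cong λ j → trans (*-congˡ (^p-homo-- (d j)))
                                                                          (solve 2 (λ a b → a :* :- b := :- (a :* b))
                                                                          refl _ _)) ⟩
      combination d + ∑ (λ j → - (t ^ toℕ j * d j ^ p))          ≈⟨ +-congˡ (∑-neg _) ⟩
      combination d - combination d                              ≈⟨ -‿inverseʳ _ ⟩
      0#                                                         ∎) j)

    cartier-cong : ∀ {y z} → y ≈ z → ∀ j → cartier y j ≈ cartier z j
    cartier-cong {y} {z} y≈z = cartier-unique (cartier z) (trans y≈z (cartier-combination z))

    cartier-+ : ∀ y z j → cartier (y + z) j ≈ cartier y j + cartier z j
    cartier-+ y z = cartier-unique (λ j → cartier y j + cartier z j)
      (trans (+-cong (cartier-combination y) (cartier-combination z)) (sym (combination-+ (cartier y) (cartier z))))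

    cartier-*ᵖ : ∀ y z j → cartier (y * z ^ p) j ≈ cartier y j * z
    cartier-*ᵖ y z = cartier-unique (λ j → cartier y j * z) (begin
      y * z ^ p                            ≈⟨ *-comm y (z ^ p) ⟩
      z ^ p * y                            ≈⟨ *-congˡ (cartier-combination y) ⟩
      z ^ p * combination (cartier y)      ≈⟨ combination-* z (cartier y) ⟨
      combination (λ j → z * cartier y j)  ≈⟨ combination-cong (λ j → *-comm z (cartier y j)) ⟩
      combination (λ j → cartier y j * z)  ∎)

    cartier-zero : ∀ {y} → y ≈ 0# → ∀ j → cartier y j ≈ 0#
    cartier-zero y≈0 = cartier-unique (λ _ → 0#) (trans y≈0 (sym (∑-zero λ i → trans (*-congˡ (0^n≈0 p)) (zeroʳ _))))

    cartier-∑ : ∀ {n} (y : Fin n → Carrier) j → cartier (∑ y) j ≈ ∑ (λ i → cartier (y i) j)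
    cartier-∑ {zero}  y j = trans (cartier-zero (∑-nil y) j) (sym (∑-nil _))
    cartier-∑ {suc n} y j = begin
      cartier (∑ y) j                                          ≈⟨ cartier-cong (∑-suc y) j ⟩
      cartier (y zero + ∑ (λ i → y (suc i))) j                 ≈⟨ cartier-+ (y zero) (∑ (λ i → y (suc i))) j ⟩
      cartier (y zero) j + cartier (∑ (λ i → y (suc i))) j     ≈⟨ +-congˡ (cartier-∑ (λ i → y (suc i)) j) ⟩
      cartier (y zero) j + ∑ (λ i → cartier (y (suc i)) j)     ≈⟨ ∑-suc (λ i → cartier (y i) j) ⟨
      ∑ (λ i → cartier (y i) j)                                ∎

    cartier-horner : ∀ {n} b → n ∈ Fp →
      cartier (n + t * b) zero ≈ n + t * cartier b (fromℕ q) ×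
      (∀ i → cartier (n + t * b) (suc i) ≈ cartier b (inject₁ i))
    cartier-horner {n} b n∈ = eq zero , eq ∘ suc
      where
      d : Fin p → Carrier
      d zero    = n + t * cartier b (fromℕ q)
      d (suc i) = cartier b (inject₁ i)
      eq : ∀ j → cartier (n + t * b) j ≈ d j
      eq = cartier-unique d (begin
        n + t * b
          ≈⟨ +-congˡ (*-congˡ (trans (cartier-combination b) (∑-init-last _))) ⟩
        n + t * (∑ (λ i → t ^ toℕ (inject₁ i) * d (suc i) ^ p) + t ^ toℕ (fromℕ q) * cartier b (fromℕ q) ^ p)
          ≈⟨ +-congˡ (*-congˡ (+-cong (∑-cong λ i → *-congʳ (^-congʳ t (Finₚ.toℕ-inject₁ i)))
              (*-congʳ (^-congʳ t (Finₚ.toℕ-fromℕ q))))) ⟩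
        n + t * (∑ (λ i → t ^ toℕ i * d (suc i) ^ p) + t ^ q * cartier b (fromℕ q) ^ p)
          ≈⟨ solve 5 (λ n t s u e → n :+ t :* (s :+ u :* e) := (n :+ (t :* u) :* e) :+ t :* s) refl n t
              (∑ (λ i → t ^ toℕ i * d (suc i) ^ p)) (t ^ q) (cartier b (fromℕ q) ^ p) ⟩
        (n + t ^ p * cartier b (fromℕ q) ^ p) + t * ∑ (λ i → t ^ toℕ i * d (suc i) ^ p)
          ≈⟨ +-cong (+-cong (sym (Fp-frobenius n∈)) (sym (^p-homo-* _ _))) (*-∑ t _) ⟩
        (n ^ p + (t * cartier b (fromℕ q)) ^ p) + ∑ (λ i → t * (t ^ toℕ i * d (suc i) ^ p))
          ≈⟨ +-cong (sym (trans (*-identityˡ _) (^p-homo-+ _ _))) (∑-cong λ i → sym (*-assoc _ _ _)) ⟩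
        1# * d zero ^ p + ∑ (λ i → t ^ toℕ (suc i) * d (suc i) ^ p)
          ≈⟨ ∑-suc _ ⟨
        combination d ∎)

    expansion-resp : ∀ {s y z} → y ≈ z → IsExpansionOf A t κ s y → IsExpansionOf A t κ s z
    expansion-resp y≈z (s∈ , ser) = s∈ , series-cong (λ _ → refl) y≈z ser

    private
      align : ∀ {y s u} N o → IsExpansionOf A t κ s (t ^ suc N * y) → IsExpansionOf A t κ u (t ^ suc (N ℕ.+ o) * y) →
              s N ≈ u (N ℕ.+ o)
      align {y} {s} {u} N o es (u∈ , ser) = trans
        (expansion-shift o es (u∈ , series-cong (λ _ → refl) (trans (*-congʳ (*-congˡ (^-homo-* t N o)))
          (solve 4 (λ t a b y → t :* (a :* b) :* y := b :* (t :* a :* y)) refl t (t ^ N) (t ^ o) y)) ser) N)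
        (reflexive (≡.cong u (ℕₚ.+-comm o N)))

      coefficient-unique : ∀ {y s u} N M → IsExpansionOf A t κ s (t ^ suc N * y) →
                           IsExpansionOf A t κ u (t ^ suc M * y) → s N ≈ u M
      coefficient-unique N M es eu with ℕₚ.≤-total N M
      ... | inj₁ N≤M with ℕₚ.m≤n⇒∃[o]m+o≡n N≤M
      ...   | o , ≡.refl = align N o es eu
      coefficient-unique N M es eu | inj₂ M≤N with ℕₚ.m≤n⇒∃[o]m+o≡n M≤N
      ...   | o , ≡.refl = sym (align M o eu es)

      coefficient : ∀ y → ∃ λ N → ∃ λ s → IsExpansionOf A t κ s (t ^ suc N * y)
      coefficient y = let N , ty∈ = absorb y in N , expand (absorb-more (ℕₚ.n≤1+n N) ty∈)

    abstract
      -- The coefficient of t⁻¹.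
      residue : Carrier → Carrier
      residue y = let N , s , _ = coefficient y in s N

      residue∈ : ∀ y → residue y ∈ κ
      residue∈ y = proj₁ (proj₂ (proj₂ (coefficient y))) (proj₁ (coefficient y))

      residue-expansion : ∀ {y s} N → IsExpansionOf A t κ s (t ^ suc N * y) → residue y ≈ s N
      residue-expansion {y} N es = let M , _ , eu = coefficient y in coefficient-unique M N eu es

    residue-cong : ∀ {y z} → y ≈ z → residue y ≈ residue z
    residue-cong {y} {z} y≈z = let N , ty∈ = absorb z ; s , es = expand (absorb-more (ℕₚ.n≤1+n N) ty∈) in
      trans (residue-expansion N (expansion-resp (*-congˡ (sym y≈z)) es)) (sym (residue-expansion N es))

    residue-+ : ∀ y z → residue (y + z) ≈ residue y + residue z
    residue-+ y z = begin
      residue (y + z)            ≈⟨ residue-expansion L (expansion-resp (sym (distribˡ _ _ _))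
          (expansion-+ (proj₂ ey) (proj₂ ez))) ⟩
      proj₁ ey L + proj₁ ez L    ≈⟨ +-cong (residue-expansion L (proj₂ ey)) (residue-expansion L (proj₂ ez)) ⟨
      residue y + residue z      ∎
      where
      N = proj₁ (absorb y)
      M = proj₁ (absorb z)
      L = N ℕ.⊔ M
      ey : ∃ λ s → IsExpansionOf A t κ s (t ^ suc L * y)
      ey = expand (absorb-more (ℕₚ.≤-trans (ℕₚ.m≤m⊔n N M) (ℕₚ.n≤1+n _)) (proj₂ (absorb y)))
      ez : ∃ λ s → IsExpansionOf A t κ s (t ^ suc L * z)
      ez = expand (absorb-more (ℕₚ.≤-trans (ℕₚ.m≤n⊔m N M) (ℕₚ.n≤1+n _)) (proj₂ (absorb z)))

    residue-integral : ∀ {y} → y ∈ A → residue y ≈ 0#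
    residue-integral y∈ = residue-expansion 0
      (expansion-resp (*-congʳ (sym (*-identityʳ t))) (expansion-π* (proj₂ (expand y∈))))

    select : ℕ → Carrier → Carrier
    select zero    u = u
    select (suc _) u = 0#

    residue-monomial : ∀ {u} m → u ∈ κ → residue (u * (t ⁻¹) ^ suc m) ≈ select m u
    residue-monomial {u} m u∈ = residue-expansion m (expansion-resp eq constant)
      where
      constant : IsExpansionOf A t κ (λ n → select n u) u
      constant = (λ { zero → u∈ ; (suc n) → κ.zer }) , series-cong (λ _ → refl)
        (trans (+-congˡ (zeroʳ t)) (+-identityʳ u)) (series-cons {λ n → select n u} (κ.integral u∈) series-zero)
      eq : u ≈ t ^ suc m * (u * (t ⁻¹) ^ suc m)
      eq = begin
        u                                    ≈⟨ *-identityʳ u ⟨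
        u * 1#                               ≈⟨ *-congˡ (^-inverse (suc m) t≉0) ⟨
        u * (t ^ suc m * (t ⁻¹) ^ suc m)     ≈⟨ solve 3 (λ u a b → u :* (a :* b) := a :* (u :* b)) refl u (t ^ suc m)
            ((t ⁻¹) ^ suc m) ⟩
        t ^ suc m * (u * (t ⁻¹) ^ suc m)     ∎

    residue-zero : residue 0# ≈ 0#
    residue-zero = residue-integral A.zer

    residue-∑ : ∀ {n} (y : Fin n → Carrier) → residue (∑ y) ≈ ∑ (λ i → residue (y i))
    residue-∑ {zero}  y = trans (residue-cong (∑-nil y)) (trans residue-zero (sym (∑-nil _)))
    residue-∑ {suc n} y = trans (residue-cong (∑-suc y)) (trans (residue-+ (y zero) (∑ (λ i → y (suc i))))
      (trans (+-congˡ (residue-∑ (λ i → y (suc i)))) (sym (∑-suc _))))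

    private
      select-cong : ∀ o {u w} → u ≈ w → select o u ≈ select o w
      select-cong zero    u≈w = u≈w
      select-cong (suc o) u≈w = refl

      select-+ : ∀ o u w → select o (u + w) ≈ select o u + select o w
      select-+ zero    u w = refl
      select-+ (suc o) u w = sym (+-identityˡ 0#)

      select-zero : ∀ o → select o 0# ≈ 0#
      select-zero zero    = refl
      select-zero (suc o) = refl

      select-positive : ∀ {o} u → 0 ℕ.< o → select o u ≈ 0#
      select-positive {suc o} u _ = refl

      select-^ : ∀ o N u → select (o ℕ.+ N ℕ.* p) (u ^ p) ≈ select o (select N u ^ p)
      select-^ (suc o) N       u = refl
      select-^ zero    zero    u = refl
      select-^ zero    (suc N) u = sym (0^n≈0 p)

      residue-component : ∀ N {o j} → j ℕ.+ o ≡ q → ∀ {y} → t ^ N * y ∈ A →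
                          residue (t ^ j * y ^ p) ≈ select o (residue y ^ p)
      residue-component zero {o} {j} j+o≡q {y} ty∈ = trans
        (residue-integral (A.mul (A.pow j t∈) (A.pow p y∈)))
        (sym (trans (select-cong o (trans (^-congˡ p (residue-integral y∈)) (0^n≈0 p))) (select-zero o)))
        where
        y∈ : y ∈ A
        y∈ = A.resp (*-identityˡ y) ty∈
      residue-component (suc N) {o} {j} j+o≡q {y} ty∈ = begin
        residue (t ^ j * y ^ p)
          ≈⟨ residue-cong (*-congˡ (trans (^-congˡ p y≈) (^p-homo-+ (u * i ^ suc N) y′))) ⟩
        residue (t ^ j * ((u * i ^ suc N) ^ p + y′ ^ p))
          ≈⟨ trans (residue-cong (distribˡ (t ^ j) ((u * i ^ suc N) ^ p) (y′ ^ p)))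
              (residue-+ (t ^ j * (u * i ^ suc N) ^ p) (t ^ j * y′ ^ p)) ⟩
        residue (t ^ j * (u * i ^ suc N) ^ p) + residue (t ^ j * y′ ^ p)
          ≈⟨ +-cong leading (residue-component N {o} {j} j+o≡q ty′∈) ⟩
        select o (residue (u * i ^ suc N) ^ p) + select o (residue y′ ^ p)
          ≈⟨ select-+ o (residue (u * i ^ suc N) ^ p) (residue y′ ^ p) ⟨
        select o (residue (u * i ^ suc N) ^ p + residue y′ ^ p)
          ≈⟨ select-cong o (trans (sym (^p-homo-+ (residue (u * i ^ suc N)) (residue y′)))
               (^-congˡ p (trans (sym (residue-+ (u * i ^ suc N) y′)) (residue-cong (sym y≈))))) ⟩
        select o (residue y ^ p) ∎
        where
        i = t ⁻¹
        split : ∃₂ λ γ r → γ ∈ κ × r ∈ A × t ^ suc N * y ≈ γ + t * r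
        split = κ.exists ty∈
        u = proj₁ split
        r = proj₁ (proj₂ split)
        u∈ : u ∈ κ
        u∈ = proj₁ (proj₂ (proj₂ split))
        y′ = i ^ N * r
        ty′∈ : t ^ N * y′ ∈ A
        ty′∈ = A.resp (sym (trans (sym (*-assoc (t ^ N) (i ^ N) r)) (trans (*-congʳ (^-inverse N t≉0)) (*-identityˡ r))))
                 (proj₁ (proj₂ (proj₂ (proj₂ split))))
        y≈ : y ≈ u * i ^ suc N + y′
        y≈ = begin
          y                                          ≈⟨ trans (*-congʳ (^-inverse (suc N) t≉0)) (*-identityˡ y) ⟨
          t ^ suc N * i ^ suc N * y                  ≈⟨ solve 3 (λ a b y → a :* b :* y := b :* (a :* y)) refl
              (t ^ suc N) (i ^ suc N) y ⟩
          i ^ suc N * (t ^ suc N * y)                ≈⟨ *-congˡ (proj₂ (proj₂ (proj₂ (proj₂ split)))) ⟩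
          i * i ^ N * (u + t * r)                    ≈⟨ solve 5 (λ i e u t r → i :* e :* (u :+ t :* r) := u :*
              (i :* e) :+ t :* i :* (e :* r)) refl i (i ^ N) u t r ⟩
          u * (i * i ^ N) + t * i * (i ^ N * r)      ≈⟨ +-congˡ (trans (*-congʳ (⁻¹-inverseʳ t≉0)) (*-identityˡ _)) ⟩
          u * i ^ suc N + y′                         ∎
        exponent : suc N ℕ.* p ≡ j ℕ.+ suc (o ℕ.+ N ℕ.* p)
        exponent = ≡.trans (≡.cong (λ k → suc (k ℕ.+ N ℕ.* p)) (≡.sym j+o≡q))
          (≡.trans (≡.cong suc (ℕₚ.+-assoc j o (N ℕ.* p))) (≡.sym (ℕₚ.+-suc j (o ℕ.+ N ℕ.* p))))
        m = o ℕ.+ N ℕ.* p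
        leading : residue (t ^ j * (u * i ^ suc N) ^ p) ≈ select o (residue (u * i ^ suc N) ^ p)
        leading = begin
          residue (t ^ j * (u * i ^ suc N) ^ p)
            ≈⟨ residue-cong (begin
                 t ^ j * (u * i ^ suc N) ^ p              ≈⟨ *-congˡ
                     (trans (^p-homo-* u (i ^ suc N)) (*-congˡ (^-assocʳ i (suc N) p))) ⟩
                 t ^ j * (u ^ p * i ^ (suc N ℕ.* p))      ≈⟨ *-congˡ
                     (*-congˡ (trans (^-congʳ i exponent) (^-homo-* i j (suc m)))) ⟩
                 t ^ j * (u ^ p * (i ^ j * i ^ suc m))    ≈⟨ solve 4
                     (λ a b c d → a :* (b :* (c :* d)) := a :* c :* (b :* d)) refl (t ^ j) (u ^ p) (i ^ j) (i ^ suc m) ⟩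
                 t ^ j * i ^ j * (u ^ p * i ^ suc m)      ≈⟨ trans (*-congʳ (^-inverse j t≉0)) (*-identityˡ _) ⟩
                 u ^ p * i ^ suc m                        ∎) ⟩
          residue (u ^ p * i ^ suc m)       ≈⟨ residue-monomial m (power u∈) ⟩
          select m (u ^ p)                  ≈⟨ select-^ o N u ⟩
          select o (select N u ^ p)         ≈⟨ select-cong o (^-congˡ p (residue-monomial N u∈)) ⟨
          select o (residue (u * i ^ suc N) ^ p) ∎

    topCartier : Carrier → Carrier
    topCartier y = cartier y (fromℕ q)

    residue-frobenius : ∀ y → residue y ≈ residue (topCartier y) ^ p
    residue-frobenius y = begin
      residue y
        ≈⟨ residue-cong (cartier-combination y) ⟩
      residue (combination (cartier y))
        ≈⟨ trans (residue-∑ (λ j → t ^ toℕ j * cartier y j ^ p)) (∑-cong component) ⟩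
      ∑ (λ j → select (q ℕ.∸ toℕ j) (residue (cartier y j) ^ p))
        ≈⟨ ∑-init-last (λ j → select (q ℕ.∸ toℕ j) (residue (cartier y j) ^ p)) ⟩
      ∑ (λ i → select (q ℕ.∸ toℕ (inject₁ i)) (residue (cartier y (inject₁ i)) ^ p)) + select (q ℕ.∸ toℕ (fromℕ q))
          (residue (topCartier y) ^ p)
        ≈⟨ +-cong (∑-zero λ i → select-positive _ (ℕₚ.m<n⇒0<n∸m (≡.subst (ℕ._< q) (≡.sym (Finₚ.toℕ-inject₁ i))
            (Finₚ.toℕ<n i))))
             (reflexive (≡.cong (λ o → select o (residue (topCartier y) ^ p))
                 (≡.trans (≡.cong (q ℕ.∸_) (Finₚ.toℕ-fromℕ q)) (ℕₚ.n∸n≡0 q)))) ⟩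
      0# + residue (topCartier y) ^ p
        ≈⟨ +-identityˡ _ ⟩
      residue (topCartier y) ^ p ∎
      where
      component : ∀ (j : Fin p) → residue (t ^ toℕ j * cartier y j ^ p) ≈ select (q ℕ.∸ toℕ j) (residue (cartier y j) ^ p)
      component j = residue-component (proj₁ (absorb (cartier y j))) {q ℕ.∸ toℕ j} {toℕ j}
          (ℕₚ.m+[n∸m]≡n (ℕₚ.≤-pred (Finₚ.toℕ<n j))) (proj₂ (absorb (cartier y j)))

    residue-adjoint : ∀ y z → residue (y * z ^ p) ≈ residue (topCartier y * z) ^ p
    residue-adjoint y z = trans (residue-frobenius (y * z ^ p)) (^-congˡ p (residue-cong (cartier-*ᵖ y z (fromℕ q))))

Covered : ∀ {a r s} {A : Set a} → Rel A r → Pred A s → Set (a ⊔ r ⊔ s)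
Covered {A = A} _∼_ P = ∃ λ (xs : List A) → ∀ x → x ∈ P → Any (x ∼_) xs

covered-map₂ : ∀ {a b d q r s t u v} {A : Set a} {B : Set b} {E : Set d} {_∼₁_ : Rel A q} {_∼₂_ : Rel B r} {_∼₃_ : Rel E s}
  {P : Pred A t} {Q : Pred B u} {R : Pred E v} (f : A → B → E) →
  (∀ {x y x′ y′ z} → z ∼₃ f x y → x ∼₁ x′ → y ∼₂ y′ → z ∼₃ f x′ y′) →
  (∀ z → z ∈ R → ∃₂ λ x y → x ∈ P × y ∈ Q × z ∼₃ f x y) →
  Covered _∼₁_ P → Covered _∼₂_ Q → Covered _∼₃_ R
covered-map₂ f f-cong R⇒ (xs , P⇒) (ys , Q⇒) = List.cartesianProductWith f xs ys , λ z z∈ →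
  let x , y , x∈ , y∈ , z∼ = R⇒ z z∈ in
  Anyₚ.cartesianProductWith⁺ f (λ x∼ y∼ → f-cong z∼ x∼ y∼) (P⇒ x x∈) (Q⇒ y y∈)

module _ {a r s : Level} {A : Set a} {_∼_ : Rel A r} {P : Pred A s}
         (∼-sym : ∀ {x y} → x ∼ y → y ∼ x) (∼-trans : ∀ {x y z} → x ∼ y → y ∼ z → x ∼ z)
         (P-resp : ∀ {x y} → x ∼ y → x ∈ P → y ∈ P) (hit? : ∀ y → Dec (∃ λ x → x ∈ P × x ∼ y)) where

  private
    Representatives : List A → List A → Set (a ⊔ r ⊔ s)
    Representatives ys xs = (∀ x → x ∈ P → Any (x ∼_) ys → Any (x ∼_) xs) × (∀ x → Any (x ∼_) xs → x ∈ P)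

    representatives : ∀ ys → ∃ (Representatives ys)
    representatives []       = [] , (λ _ _ ()) , (λ _ ())
    representatives (y ∷ ys) with hit? y | representatives ys
    ... | no ¬hit | xs , ⇒ , ⇐ = xs , (λ { x x∈ (here x∼y) → contradiction (x , x∈ , x∼y) ¬hit ; x x∈ (there any) → ⇒
        x x∈ any }) , ⇐
    ... | yes (z , z∈ , z∼y) | xs , ⇒ , ⇐ = z ∷ xs ,
      (λ { x x∈ (here x∼y) → here (∼-trans x∼y (∼-sym z∼y)) ; x x∈ (there any) → there (⇒ x x∈ any) }) ,
      (λ { x (here x∼z) → P-resp (∼-sym x∼z) z∈ ; x (there any) → ⇐ x any })

  covered⇒finite : Covered _∼_ P → IsFinite _∼_ P
  covered⇒finite (ys , cover) = let xs , ⇒ , ⇐ = representatives ys in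
    xs , λ x → mk⇔ (λ x∈ → ⇒ x x∈ (cover x x∈)) (⇐ x)

module AutomaticSequences {c ℓ : Level} (𝔽 : Field c ℓ) (em : ExcludedMiddle (c ⊔ ℓ)) (p : ℕ) .{{_ : NonZero p}} where
  open Field 𝔽 hiding (zero)
  open Automata 𝔽

  Sequence : Set c
  Sequence = ℕ → Carrier

  ≗-sym : ∀ {s t} → s ≗ t → t ≗ s
  ≗-sym s≗t n = sym (s≗t n)

  ≗-trans : ∀ {s t u} → s ≗ t → t ≗ u → s ≗ u
  ≗-trans s≗t t≗u n = trans (s≗t n) (t≗u n)

  decimate : ℕ → Sequence → Sequence
  decimate j s n = s (n ℕ.* p ℕ.+ j)

  kernel-resp : ∀ {s t u} → t ≗ u → t ∈ Kernel p s → u ∈ Kernel p s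
  kernel-resp t≗u (i , j , j< , eq) = i , j , j< , ≗-trans (≗-sym t≗u) eq

  kernel-self : ∀ {s} → s ∈ Kernel p s
  kernel-self {s} = 0 , 0 , s≤s z≤n , λ n → reflexive (≡.cong s (≡.sym (≡.trans (ℕₚ.+-identityʳ _) (ℕₚ.*-identityʳ n))))

  kernel-decimate : ∀ {s t} j → j ℕ.< p → t ∈ Kernel p s → decimate j t ∈ Kernel p s
  kernel-decimate {s} {t} j j<p (i , k , k< , eq) = suc i , j ℕ.* p ℕ.^ i ℕ.+ k , bound , λ n →
      trans (eq (n ℕ.* p ℕ.+ j)) (reflexive (≡.cong s (arith n)))
    where
    P = p ℕ.^ i
    open ℕₚ.≤-Reasoning
    bound : j ℕ.* P ℕ.+ k ℕ.< p ℕ.* P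
    bound = begin-strict
      j ℕ.* P ℕ.+ k    <⟨ ℕₚ.+-monoʳ-< (j ℕ.* P) k< ⟩
      j ℕ.* P ℕ.+ P    ≡⟨ ℕₚ.+-comm (j ℕ.* P) P ⟩
      suc j ℕ.* P      ≤⟨ ℕₚ.*-monoˡ-≤ P j<p ⟩
      p ℕ.* P          ∎
    arith : ∀ n → (n ℕ.* p ℕ.+ j) ℕ.* P ℕ.+ k ≡ n ℕ.* (p ℕ.* P) ℕ.+ (j ℕ.* P ℕ.+ k)
    arith n = ≡.trans (≡.cong (ℕ._+ k) (≡.trans (ℕₚ.*-distribʳ-+ P (n ℕ.* p) j) (≡.cong (ℕ._+ j ℕ.* P) (ℕₚ.*-assoc n p P))))
                      (ℕₚ.+-assoc (n ℕ.* (p ℕ.* P)) (j ℕ.* P) k)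

  kernel⊆closed : ∀ {u} {S : Pred Sequence u} → (∀ {s t} → s ≗ t → s ∈ S → t ∈ S) →
    (∀ {s} j → j ℕ.< p → s ∈ S → decimate j s ∈ S) → ∀ {s} → s ∈ S → Kernel p s ⊆ S
  kernel⊆closed {S = S} resp closed s∈ (i , j , j< , eq) = go i j j< s∈ eq
    where
    go : ∀ i j → j ℕ.< p ℕ.^ i → ∀ {s t} → s ∈ S → t ≗ (λ n → s (n ℕ.* p ℕ.^ i ℕ.+ j)) → t ∈ S
    go zero zero j< {s} s∈ eq = resp (λ n → sym (trans (eq n)
      (reflexive (≡.cong s (≡.trans (ℕₚ.+-identityʳ _) (ℕₚ.*-identityʳ n)))))) s∈
    go zero (suc j) (s≤s ()) s∈ eq
    go (suc i) j j< {s} s∈ eq = go i (j / p) (m<n*o⇒m/o<n (≡.subst (j ℕ.<_) (ℕₚ.*-comm p (p ℕ.^ i)) j<))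
      (closed (j % p) (m%n<n j p) s∈) (λ n → trans (eq n) (reflexive (≡.cong s (arith n))))
      where
      P = p ℕ.^ i
      open ≡.≡-Reasoning
      arith : ∀ n → n ℕ.* (p ℕ.* P) ℕ.+ j ≡ (n ℕ.* P ℕ.+ j / p) ℕ.* p ℕ.+ j % p
      arith n = begin
        n ℕ.* (p ℕ.* P) ℕ.+ j                             ≡⟨ ≡.cong₂ ℕ._+_
            (≡.trans (≡.cong (n ℕ.*_) (ℕₚ.*-comm p P)) (≡.sym (ℕₚ.*-assoc n P p))) (m≡m%n+[m/n]*n j p) ⟩
        n ℕ.* P ℕ.* p ℕ.+ (j % p ℕ.+ j / p ℕ.* p)         ≡⟨ ≡.cong (n ℕ.* P ℕ.* p ℕ.+_) (ℕₚ.+-comm (j % p) _) ⟩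
        n ℕ.* P ℕ.* p ℕ.+ (j / p ℕ.* p ℕ.+ j % p)         ≡⟨ ℕₚ.+-assoc (n ℕ.* P ℕ.* p) _ _ ⟨
        n ℕ.* P ℕ.* p ℕ.+ j / p ℕ.* p ℕ.+ j % p           ≡⟨ ≡.cong (ℕ._+ j % p) (ℕₚ.*-distribʳ-+ p (n ℕ.* P) (j / p)) ⟨
        (n ℕ.* P ℕ.+ j / p) ℕ.* p ℕ.+ j % p               ∎

  covered-kernel⇒automatic : ∀ {s} → Covered _≗_ (Kernel p s) → Automatic p s
  covered-kernel⇒automatic {s} = covered⇒finite ≗-sym ≗-trans (kernel-resp {s}) (λ _ → em)

  automatic⇒covered : ∀ {s} → Automatic p s → Covered _≗_ (Kernel p s)
  automatic⇒covered (xs , ⇔) = xs , λ t → Equivalence.to (⇔ t)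

  closed-covered⇒automatic : ∀ {u} {S : Pred Sequence u} → (∀ {s t} → s ≗ t → s ∈ S → t ∈ S) →
    (∀ {s} j → j ℕ.< p → s ∈ S → decimate j s ∈ S) → Covered _≗_ S → ∀ {s} → s ∈ S → Automatic p s
  closed-covered⇒automatic resp closed (xs , cover) {s} s∈ =
    covered-kernel⇒automatic {s} (xs , λ t t∈ → cover t (kernel⊆closed resp closed s∈ t∈))

  automatic-resp : ∀ {s t} → s ≗ t → Automatic p s → Automatic p t
  automatic-resp {s} {t} s≗t auto = covered-kernel⇒automatic {t}
    (proj₁ cover , λ { u (i , j , j< , eq) → proj₂ cover u (i , j , j< , λ n → trans (eq n) (sym (s≗t _))) })
    where cover = automatic⇒covered {s} auto

  record KernelFamily (s : Sequence) : Set (c ⊔ ℓ) where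
    field
      size   : ℕ
      member : Fin size → Sequence
      kernel : ∀ k → member k ∈ Kernel p s
      find   : ∀ {t} → t ∈ Kernel p s → ∃ λ k → t ≗ member k

  kernelFamily : ∀ {s} → Automatic p s → KernelFamily s
  kernelFamily {s} (xs , ⇔) = record
    { size = length xs ; member = List.lookup xs ; kernel = member∈ ; find = find }
    where
    find : ∀ {t} → t ∈ Kernel p s → ∃ λ l → t ≗ List.lookup xs l
    find {t} t∈ = let any = Equivalence.to (⇔ t) t∈ in Any.index any , Anyₚ.lookup-index any
    member∈ : ∀ k → List.lookup xs k ∈ Kernel p s
    member∈ k = Equivalence.from (⇔ (List.lookup xs k)) (go xs k)
      where
      go : ∀ xs k → Any (List.lookup xs k ≗_) xs
      go (x ∷ xs) zero    = here (λ _ → refl)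
      go (x ∷ xs) (suc k) = there (go xs k)

module Polynomials {c ℓ : Level} (𝔽 : Field c ℓ) (_≟_ : ∀ a b → Dec (Field._≈_ 𝔽 a b))
                   {q : ℕ} (pr : Prime (suc q))
                   (char : Field._≈_ 𝔽 (FieldTheory._·_ 𝔽 (suc q) (Field.1# 𝔽)) (Field.0# 𝔽)) where
  open Field 𝔽 hiding (zero)
  open FieldTheory 𝔽 using (_^_; _·_)
  open FieldLemmas 𝔽
  open Subrings 𝔽
  open Summation 𝔽
  open PrimeSubfield 𝔽 pr char
  open IntegerSolver commutativeRing
  open SemiringExp semiring using (^-congˡ; ^-congʳ)
  open SetoidReasoning setoid
  private module Fp = IsSubfield Fp-isSubfield

  -- Values at T of polynomials of degree < D over 𝔽_p, in Horner form.
  data Poly (T : Carrier) : ℕ → Pred Carrier (c ⊔ ℓ) where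
    nil    : ∀ {D a} → a ≈ 0# → a ∈ Poly T D
    horner : ∀ {D n b a} → n ∈ Fp → b ∈ Poly T D → a ≈ n + T * b → a ∈ Poly T (suc D)

  Polys : Carrier → Pred Carrier (c ⊔ ℓ)
  Polys T a = ∃ λ D → a ∈ Poly T D

  -- The subfield 𝔽_p(T).
  Frac : Carrier → Pred Carrier (c ⊔ ℓ)
  Frac T a = ∃ λ d → d ∈ Polys T × d ≉ 0# × d * a ∈ Polys T

  module _ {T : Carrier} where

    poly-resp : ∀ {D a b} → a ≈ b → a ∈ Poly T D → b ∈ Poly T D
    poly-resp a≈b (nil a≈0)         = nil (trans (sym a≈b) a≈0)
    poly-resp a≈b (horner n∈ b∈ eq) = horner n∈ b∈ (trans (sym a≈b) eq)

    poly-mono : ∀ {D E a} → D ℕ.≤ E → a ∈ Poly T D → a ∈ Poly T E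
    poly-mono D≤E       (nil a≈0)         = nil a≈0
    poly-mono (s≤s D≤E) (horner n∈ b∈ eq) = horner n∈ (poly-mono D≤E b∈) eq

    poly-add : ∀ {D a b} → a ∈ Poly T D → b ∈ Poly T D → a + b ∈ Poly T D
    poly-add (nil a≈0) b∈ = poly-resp (sym (trans (+-congʳ a≈0) (+-identityˡ _))) b∈
    poly-add a∈@(horner _ _ _) (nil b≈0) = poly-resp (sym (trans (+-congˡ b≈0) (+-identityʳ _))) a∈
    poly-add (horner {n = n} {a} n∈ a∈ eq) (horner {n = m} {b} m∈ b∈ eq′) = horner (Fp.add n∈ m∈) (poly-add a∈ b∈)
      (trans (+-cong eq eq′) (solve 5 (λ n m t a b → (n :+ t :* a) :+ (m :+ t :* b) := (n :+ m) :+ t :* (a :+ b)) refl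
          n m T a b))

    poly-scale : ∀ {D n a} → n ∈ Fp → a ∈ Poly T D → n * a ∈ Poly T D
    poly-scale n∈ (nil a≈0) = nil (trans (*-congˡ a≈0) (zeroʳ _))
    poly-scale {n = n} n∈ (horner {n = m} {a} m∈ a∈ eq) = horner (Fp.mul n∈ m∈) (poly-scale n∈ a∈)
      (trans (*-congˡ eq) (solve 4 (λ n m t a → n :* (m :+ t :* a) := n :* m :+ t :* (n :* a)) refl n m T a))

    poly-shift : ∀ {D a} → a ∈ Poly T D → T * a ∈ Poly T (suc D)
    poly-shift a∈ = horner Fp.zer a∈ (sym (+-identityˡ _))

    poly-const : ∀ {D n} → n ∈ Fp → n ∈ Poly T (suc D)
    poly-const n∈ = horner n∈ (nil refl) (sym (trans (+-congˡ (zeroʳ _)) (+-identityʳ _)))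

    poly-mul : ∀ {D E a b} → a ∈ Poly T D → b ∈ Poly T E → a * b ∈ Poly T (D ℕ.+ E)
    poly-mul (nil a≈0) b∈ = nil (trans (*-congʳ a≈0) (zeroˡ _))
    poly-mul {suc D} {E} {b = b} (horner {n = n} {a} n∈ a∈ eq) b∈ =
      poly-resp (sym (trans (*-congʳ eq) (solve 4 (λ n t a b → (n :+ t :* a) :* b := n :* b :+ t :* (a :* b)) refl n T
          a b)))
        (poly-add (poly-mono (ℕₚ.m≤n+m E (suc D)) (poly-scale n∈ b∈)) (poly-shift (poly-mul a∈ b∈)))

    poly-∑ : ∀ {n D} {a : Fin n → Carrier} → (∀ i → a i ∈ Poly T D) → ∑ a ∈ Poly T D
    poly-∑ {zero}  a∈ = nil (∑-nil _)
    poly-∑ {suc n} a∈ = poly-resp (sym (∑-suc _)) (poly-add (a∈ zero) (poly-∑ (a∈ ∘ suc)))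

    fp-covered : Covered _≈_ Fp
    fp-covered = List.tabulate (λ (i : Fin (suc q)) → toℕ i · 1#) , λ a a∈ →
      let i , eq = Fp-reduce a∈ in Anyₚ.tabulate⁺ {f = λ i → toℕ i · 1#} i eq

    poly-covered : ∀ D → Covered _≈_ (Poly T D)
    poly-covered zero    = 0# ∷ [] , λ { a (nil a≈0) → here a≈0 }
    poly-covered (suc D) = covered-map₂ (λ n b → n + T * b)
      (λ z≈ n≈ b≈ → trans z≈ (+-cong n≈ (*-congˡ b≈))) split fp-covered (poly-covered D)
      where
      split : ∀ a → a ∈ Poly T (suc D) → ∃₂ λ n b → n ∈ Fp × b ∈ Poly T D × a ≈ n + T * b
      split a (nil a≈0)                           = 0# , 0# , Fp.zer , nil refl , trans a≈0
          (sym (trans (+-identityˡ _) (zeroʳ T)))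
      split a (horner {n = n} {b} n∈ b∈ eq)       = n , b , n∈ , b∈ , eq

    poly-head : ∀ {D x} → x ∈ Poly T D → ∃₂ λ n b → n ∈ Fp × b ∈ Poly T (ℕ.pred D) × x ≈ n + T * b
    poly-head (nil x≈0)                     = 0# , 0# , Fp.zer , nil refl , trans x≈0
        (sym (trans (+-identityˡ _) (zeroʳ T)))
    poly-head (horner {n = n} {b} n∈ b∈ eq) = n , b , n∈ , b∈ , eq

    poly-coefficients : ∀ {D x} → x ∈ Poly T D → ∃ λ (n : Fin D → Carrier) → (∀ i → n i ∈ Fp) × x ≈ ∑
        (λ i → n i * T ^ toℕ i)
    poly-coefficients (nil x≈0) = (λ _ → 0#) , (λ _ → Fp.zer) , trans x≈0 (sym (∑-zero λ i → zeroˡ _))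
    poly-coefficients {suc D} (horner {n = n} {b} n∈ b∈ eq) =
      let m , m∈ , b≈ = poly-coefficients b∈
          f : Fin (suc D) → Carrier
          f = λ { zero → n ; (suc i) → m i }
      in f , (λ { zero → n∈ ; (suc i) → m∈ i }) , trans eq (sym (trans (∑-suc (λ i → f i * T ^ toℕ i))
          (+-cong (*-identityʳ n)
           (trans (∑-cong λ i → solve 3 (λ n t p → n :* (t :* p) := t :* (n :* p)) refl (m i) T (T ^ toℕ i))
             (trans (sym (*-∑ T (λ i → m i * T ^ toℕ i))) (*-congˡ (sym b≈)))))))

    poly-combination : ∀ {D} (n : Fin D → Carrier) → (∀ i → n i ∈ Fp) → ∑ (λ i → n i * T ^ toℕ i) ∈ Poly T D
    poly-combination {zero}  n n∈ = nil (∑-nil _)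
    poly-combination {suc D} n n∈ = horner (n∈ zero) (poly-combination (n ∘ suc) (n∈ ∘ suc))
      (trans (∑-suc (λ i → n i * T ^ toℕ i)) (+-cong (*-identityʳ _)
        (trans (∑-cong λ i → solve 3 (λ n t p → n :* (t :* p) := t :* (n :* p)) refl (n (suc i)) T (T ^ toℕ i))
               (sym (*-∑ T (λ i → n (suc i) * T ^ toℕ i))))))

    polys-isSubring : IsSubring (Polys T)
    polys-isSubring = record
      { resp = λ a≈b (D , a∈) → D , poly-resp a≈b a∈
      ; one  = 1 , poly-const Fp.one
      ; add  = λ (D , a∈) (E , b∈) → D ℕ.⊔ E , poly-add (poly-mono (ℕₚ.m≤m⊔n D E) a∈) (poly-mono (ℕₚ.m≤n⊔m D E) b∈)
      ; neg  = λ {a} (D , a∈) → D , poly-resp (RingProps.-1*x≈-x ring a) (poly-scale (Fp.neg Fp.one) a∈)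
      ; mul  = λ (D , a∈) (E , b∈) → D ℕ.+ E , poly-mul a∈ b∈
      }

    private module P = IsSubring polys-isSubring

    T∈Polys : T ∈ Polys T
    T∈Polys = 2 , poly-resp (*-identityʳ T) (poly-shift (poly-const Fp.one))

    poly⇒frac : Polys T ⊆ Frac T
    poly⇒frac a∈ = 1# , P.one , 1≉0 , P.resp (sym (*-identityˡ _)) a∈

    frac-isSubfield : IsSubfield (Frac T)
    frac-isSubfield = record
      { isSubring = record
        { resp = λ a≈b (d , d∈ , d≉0 , da∈) → d , d∈ , d≉0 , P.resp (*-congˡ a≈b) da∈
        ; one  = poly⇒frac P.one
        ; add  = λ {a} {b} (d , d∈ , d≉0 , da∈) (e , e∈ , e≉0 , eb∈) → d * e , P.mul d∈ e∈ , *-nonzero d≉0 e≉0 ,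
            P.resp (solve 4 (λ d e a b → e :* (d :* a) :+ d :* (e :* b) := d :* e :* (a :+ b)) refl d e a b)
              (P.add (P.mul e∈ da∈) (P.mul d∈ eb∈))
        ; neg  = λ {a} (d , d∈ , d≉0 , da∈) → d , d∈ , d≉0 ,
            P.resp (solve 2 (λ d a → :- (d :* a) := d :* :- a) refl d a) (P.neg da∈)
        ; mul  = λ {a} {b} (d , d∈ , d≉0 , da∈) (e , e∈ , e≉0 , eb∈) → d * e , P.mul d∈ e∈ , *-nonzero d≉0 e≉0 ,
            P.resp (solve 4 (λ d e a b → (d :* a) :* (e :* b) := d :* e :* (a :* b)) refl d e a b) (P.mul da∈ eb∈)
        }
      ; inv = λ {a} a≉0 (d , d∈ , d≉0 , da∈) → d * a , da∈ , *-nonzero d≉0 a≉0 ,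
          P.resp (sym (trans (*-assoc d a (a ⁻¹)) (trans (*-congˡ (⁻¹-inverseʳ a≉0)) (*-identityʳ d)))) d∈
      }

    IsDenominator : Carrier → Set (c ⊔ ℓ)
    IsDenominator d = d ∈ Polys T × d ≉ 0#

    common-denominator : ∀ {s n} (P : Fin n → Pred Carrier s) → (∀ i {d e} → e ∈ Polys T → d ∈ P i → e * d ∈ P i) →
      (∀ i {d e} → d ≈ e → d ∈ P i → e ∈ P i) →
      (∀ i → ∃ λ d → IsDenominator d × d ∈ P i) → ∃ λ d → IsDenominator d × ∀ i → d ∈ P i
    common-denominator {n = zero}  P ideal resp ex = 1# , (P.one , 1≉0) , λ ()
    common-denominator {n = suc n} P ideal resp ex =
      let d , (d∈ , d≉0) , d∈P = ex zero
          e , (e∈ , e≉0) , e∈P = common-denominator (P ∘ suc) (ideal ∘ suc) (resp ∘ suc) (ex ∘ suc)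
      in d * e , (P.mul d∈ e∈ , *-nonzero d≉0 e≉0) ,
         λ { zero → resp zero (*-comm e d) (ideal zero e∈ d∈P) ; (suc i) → ideal (suc i) d∈ (e∈P i) }

    Clears : ∀ {n} → (Fin n → Carrier) → Pred Carrier (c ⊔ ℓ)
    Clears a d = ∀ i → d * a i ∈ Polys T

    clears-ideal : ∀ {n} {a : Fin n → Carrier} {d e} → e ∈ Polys T → d ∈ Clears a → e * d ∈ Clears a
    clears-ideal e∈ d∈ i = P.resp (sym (*-assoc _ _ _)) (P.mul e∈ (d∈ i))

    clears-resp : ∀ {n} {a : Fin n → Carrier} {d e} → d ≈ e → d ∈ Clears a → e ∈ Clears a
    clears-resp d≈e d∈ i = P.resp (*-congʳ d≈e) (d∈ i)

    clear-denominators : ∀ {n} (a : Fin n → Carrier) → (∀ i → a i ∈ Frac T) → ∃ λ d → IsDenominator d × d ∈ Clears a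
    clear-denominators a a∈ = common-denominator (λ i d → d * a i ∈ Polys T)
      (λ i e∈ da∈ → P.resp (sym (*-assoc _ _ _)) (P.mul e∈ da∈)) (λ i d≈e → P.resp (*-congʳ d≈e))
      (λ i → let d , d∈ , d≉0 , da∈ = a∈ i in d , (d∈ , d≉0) , da∈)

    common-degree : ∀ {n} (P : Fin n → Pred ℕ (c ⊔ ℓ)) → (∀ i {D E} → D ℕ.≤ E → D ∈ P i → E ∈ P i) →
                    (∀ i → ∃ (P i)) → ∃ λ D → ∀ i → D ∈ P i
    common-degree {zero}  P mono ex = 0 , λ ()
    common-degree {suc n} P mono ex =
      let D , D∈ = ex zero
          E , E∈ = common-degree (P ∘ suc) (mono ∘ suc) (ex ∘ suc)
      in D ℕ.⊔ E , λ { zero → mono zero (ℕₚ.m≤m⊔n D E) D∈ ; (suc i) → mono (suc i) (ℕₚ.m≤n⊔m D E) (E∈ i) }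

  combinations-covered : ∀ {s n} {P : Pred Carrier s} (e : Fin n → Carrier) → Covered _≈_ P →
    Covered _≈_ (λ x → ∃ λ (a : Fin n → Carrier) → (∀ i → a i ∈ P) × x ≈ ∑ (λ i → a i * e i))
  combinations-covered {n = zero}  e cover = 0# ∷ [] , λ { x (a , a∈ , eq) → here (trans eq (∑-nil _)) }
  combinations-covered {n = suc n} e cover = covered-map₂ (λ a x → a * e zero + x)
    (λ z≈ a≈ x≈ → trans z≈ (+-cong (*-congʳ a≈) x≈))
    (λ { x (a , a∈ , eq) → a zero , ∑ (λ i → a (suc i) * e (suc i)) , a∈ zero , (a ∘ suc , a∈ ∘ suc , refl) , trans eq
        (∑-suc _) })
    cover (combinations-covered (e ∘ suc) cover)

  module CartierPolynomials {a k : Level} {A : Pred Carrier a} {t : Carrier} {κ : Pred Carrier k}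
    (uniformizer : Cartier.IsUniformizer 𝔽 _≟_ pr char A t κ)
    (em : ExcludedMiddle (c ⊔ ℓ)) where
    open Cartier 𝔽 _≟_ pr char using (p; module CartierLemmas)
    open CartierLemmas uniformizer
    open Spans 𝔽 _≟_
    open Algebraic 𝔽 _≟_
    open FieldTheory 𝔽 using (AlgebraicOver)
    private
      module P = IsSubring (polys-isSubring {t})
      module Fr = IsSubfield (frac-isSubfield {t})
      isFr = Fr.isSubring

    cartier-poly : ∀ {D x} → x ∈ Poly t D → ∀ E (j : Fin p) → D ℕ.≤ E ℕ.* p ℕ.+ toℕ j → cartier x j ∈ Poly t E
    cartier-poly (nil x≈0) E j D≤ = nil (cartier-zero x≈0 j)
    cartier-poly {suc D} (horner {n = n} {b} n∈ b∈ eq) zero zero ()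
    cartier-poly {suc D} (horner {n = n} {b} n∈ b∈ eq) (suc E) zero (s≤s D≤) =
      horner n∈ (cartier-poly b∈ E (fromℕ q) (≡.subst (D ℕ.≤_) arith D≤))
          (trans (cartier-cong eq zero) (proj₁ (cartier-horner b n∈)))
      where
      arith : q ℕ.+ E ℕ.* p ℕ.+ 0 ≡ E ℕ.* p ℕ.+ toℕ (fromℕ q)
      arith = ≡.trans (ℕₚ.+-identityʳ _) (≡.trans (ℕₚ.+-comm q (E ℕ.* p))
          (≡.cong (E ℕ.* p ℕ.+_) (≡.sym (Finₚ.toℕ-fromℕ q))))
    cartier-poly {suc D} (horner {n = n} {b} n∈ b∈ eq) E (suc j) D≤ =
      poly-resp (sym (trans (cartier-cong eq (suc j)) (proj₂ (cartier-horner b n∈) j)))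
        (cartier-poly b∈ E (inject₁ j) (ℕₚ.≤-pred (≡.subst (suc D ℕ.≤_) arith D≤)))
      where
      arith : E ℕ.* p ℕ.+ suc (toℕ j) ≡ suc (E ℕ.* p ℕ.+ toℕ (inject₁ j))
      arith = ≡.trans (ℕₚ.+-suc (E ℕ.* p) (toℕ j)) (≡.cong (λ i → suc (E ℕ.* p ℕ.+ i)) (≡.sym (Finₚ.toℕ-inject₁ j)))

    cartier-polys : ∀ {x} → x ∈ Polys t → ∀ j → cartier x j ∈ Polys t
    cartier-polys (D , x∈) j = D , cartier-poly x∈ D j (ℕₚ.≤-trans (ℕₚ.m≤m*n D p) (ℕₚ.m≤m+n (D ℕ.* p) (toℕ j)))

    cartier≈0⇒≈0 : ∀ {x} → (∀ j → cartier x j ≈ 0#) → x ≈ 0#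
    cartier≈0⇒≈0 {x} eq = trans (cartier-combination x)
      (∑-zero λ j → trans (*-congˡ (trans (^-congˡ p (eq j)) (0^n≈0 p))) (zeroʳ _))

    independent-^p : ∀ {n} {d : Fin n → Carrier} → Independent (Frac t) d → Independent (Frac t) (λ i → d i ^ p)
    independent-^p {n} {d} ind f f∈ rel i = *-zero-divisor (proj₂ (proj₁ (proj₂ cleared))) (cartier≈0⇒≈0 λ j →
        ind (λ i → cartier (e * f i) j) (λ i → poly⇒frac (cartier-polys (proj₂ (proj₂ cleared) i) j)) (rel′ j) i)
      where
      cleared : ∃ λ e → IsDenominator {t} e × e ∈ Clears f
      cleared = clear-denominators f f∈
      e = proj₁ cleared
      rel′ : ∀ j → ∑ (λ i → cartier (e * f i) j * d i) ≈ 0#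
      rel′ j = begin
        ∑ (λ i → cartier (e * f i) j * d i)           ≈⟨ ∑-cong (λ i → cartier-*ᵖ (e * f i) (d i) j) ⟨
        ∑ (λ i → cartier (e * f i * d i ^ p) j)       ≈⟨ cartier-∑ (λ i → e * f i * d i ^ p) j ⟨
        cartier (∑ (λ i → e * f i * d i ^ p)) j       ≈⟨ cartier-zero (trans (∑-cong λ i → *-assoc e (f i) (d i ^ p))
                                                           (trans (sym (*-∑ e (λ i → f i * d i ^ p)))
                                                               (trans (*-congˡ rel) (zeroʳ e)))) j ⟩
        0#                                            ∎

    record StableSet (π h : Carrier) : Set (Level.suc (c ⊔ ℓ)) where
      field
        V       : Pred Carrier (c ⊔ ℓ)
        covered : Covered _≈_ V
        initial : h ∈ V
        stable  : ∀ {y} (k : Fin p) → y ∈ V → topCartier (π ^ toℕ k * y) ∈ V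

    -- The top Cartier operator divides the degrees of the coordinates with respect to e by p, up to a bounded error.
    module _ (π h : Carrier) {n : ℕ} (e : Fin n → Carrier) (D : ℕ)
             (N : Fin p → Fin n → Fin n → Carrier) (N∈ : ∀ k i j → N k i j ∈ Poly t D)
             (N≈ : ∀ k i → π ^ toℕ k * e i ≈ ∑ (λ j → N k i j * e j ^ p))
             (f : Fin n → Carrier) (f∈ : ∀ i → f i ∈ Poly t D) (h≈ : h ≈ ∑ (λ i → f i * e i)) where

      coordinates-stable : 1 ℕ.≤ q → StableSet π h
      coordinates-stable 1≤q = record
        { V       = λ x → ∃ λ (a : Fin n → Carrier) → (∀ i → a i ∈ Poly t D) × x ≈ ∑ (λ i → a i * e i)
        ; covered = combinations-covered e (poly-covered D)
        ; initial = f , f∈ , h≈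
        ; stable  = λ {y} k (a , a∈ , y≈) →
            (λ j → topCartier (∑ (λ i → a i * N k i j))) ,
            (λ j → cartier-poly (poly-∑ λ i → poly-mul (a∈ i) (N∈ k i j)) D (fromℕ q) bound) ,
            (begin
              topCartier (π ^ toℕ k * y)
                ≈⟨ cartier-cong (expand-product k a y≈) (fromℕ q) ⟩
              topCartier (∑ (λ j → ∑ (λ i → a i * N k i j) * e j ^ p))
                ≈⟨ cartier-∑ (λ j → ∑ (λ i → a i * N k i j) * e j ^ p) (fromℕ q) ⟩
              ∑ (λ j → topCartier (∑ (λ i → a i * N k i j) * e j ^ p))
                ≈⟨ ∑-cong (λ j → cartier-*ᵖ (∑ (λ i → a i * N k i j)) (e j) (fromℕ q)) ⟩
              ∑ (λ j → topCartier (∑ (λ i → a i * N k i j)) * e j) ∎)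
        }
        where
        bound : D ℕ.+ D ℕ.≤ D ℕ.* p ℕ.+ toℕ (fromℕ q)
        bound = ℕₚ.≤-trans (ℕₚ.≤-reflexive (≡.trans (≡.cong (D ℕ.+_) (≡.sym (ℕₚ.+-identityʳ D))) (ℕₚ.*-comm 2 D)))
          (ℕₚ.≤-trans (ℕₚ.*-monoʳ-≤ D (s≤s 1≤q)) (ℕₚ.m≤m+n (D ℕ.* p) (toℕ (fromℕ q))))
        expand-product : ∀ k (a : Fin n → Carrier) {y} → y ≈ ∑ (λ i → a i * e i) →
                         π ^ toℕ k * y ≈ ∑ (λ j → ∑ (λ i → a i * N k i j) * e j ^ p)
        expand-product k a {y} y≈ = begin
          π ^ toℕ k * y
            ≈⟨ trans (*-congˡ y≈) (*-∑ (π ^ toℕ k) (λ i → a i * e i)) ⟩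
          ∑ (λ i → π ^ toℕ k * (a i * e i))
            ≈⟨ ∑-cong (λ i → trans (solve 3 (λ P a e → P :* (a :* e) := a :* (P :* e)) refl (π ^ toℕ k) (a i) (e i))
                 (trans (*-congˡ (N≈ k i)) (*-∑ (a i) (λ j → N k i j * e j ^ p)))) ⟩
          ∑ (λ i → ∑ (λ j → a i * (N k i j * e j ^ p)))
            ≈⟨ ∑-comm (λ i j → a i * (N k i j * e j ^ p)) ⟩
          ∑ (λ j → ∑ (λ i → a i * (N k i j * e j ^ p)))
            ≈⟨ ∑-cong (λ j → trans (∑-cong λ i → sym (*-assoc (a i) (N k i j) (e j ^ p)))
                (sym (∑-* (e j ^ p) (λ i → a i * N k i j)))) ⟩
          ∑ (λ j → ∑ (λ i → a i * N k i j) * e j ^ p) ∎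

    stableSet : ∀ {π h} → π ∈ AlgebraicOver (Frac t) → h ∈ AlgebraicOver (Frac t) → StableSet π h
    stableSet {π} {h} π∈ h∈ = coordinates-stable π h e D N N∈ N≈ F F∈ h≈ (ℕₚ.≤-pred 1<p)
      where
      algebra : InFiniteAlgebra frac-isSubfield (pair (frac-isSubfield {t}) π h)
      algebra = algebraic-pair frac-isSubfield π∈ h∈
      b₀ = proj₁ (proj₂ algebra)
      alg₀ : IsFiniteAlgebra (Frac t) b₀
      alg₀ = proj₁ (proj₂ (proj₂ algebra))
      based : ∃₂ λ m (d : Fin m → Carrier) → Independent (Frac t) d × (∀ i → ∃ λ j → d i ≡ b₀ j) × Span (Frac t) b₀ ⊆
          Span (Frac t) d
      based = basis frac-isSubfield (λ _ → em) _ b₀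
      n = proj₁ based
      d : Fin n → Carrier
      d = proj₁ (proj₂ based)
      ind : Independent (Frac t) d
      ind = proj₁ (proj₂ (proj₂ based))
      to-d : Span (Frac t) b₀ ⊆ Span (Frac t) d
      to-d = proj₂ (proj₂ (proj₂ (proj₂ based)))
      d∈b₀ : ∀ i → d i ∈ Span (Frac t) b₀
      d∈b₀ i = let j , eq = proj₁ (proj₂ (proj₂ (proj₂ based))) i in
        ≡.subst (_∈ Span (Frac t) b₀) (≡.sym eq) (span-gen isFr j)
      to-dᵖ : Span (Frac t) d ⊆ Span (Frac t) (λ i → d i ^ p)
      to-dᵖ = independent-spans frac-isSubfield (independent-^p ind)
        (λ i → to-d (algebra-pow frac-isSubfield alg₀ (d∈b₀ i) p))
      product : ∀ (k : Fin p) i → π ^ toℕ k * d i ∈ Span (Frac t) (λ i → d i ^ p)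
      product k i = to-dᵖ (to-d (algebra-mul frac-isSubfield alg₀
        (algebra-pow frac-isSubfield alg₀ (proj₂ (proj₂ (proj₂ algebra)) zero) (toℕ k)) (d∈b₀ i)))
      h-span : h ∈ Span (Frac t) d
      h-span = to-d (proj₂ (proj₂ (proj₂ algebra)) (suc zero))
      M : Fin p → Fin n → Fin n → Carrier
      M k i = proj₁ (product k i)
      f : Fin n → Carrier
      f = proj₁ h-span
      denominators : ∃ λ g → IsDenominator {t} g × (∀ k i → g ∈ Clears (M k i))
      denominators = common-denominator (λ k g → ∀ i → g ∈ Clears (M k i))
        (λ k e∈ d∈ i → clears-ideal e∈ (d∈ i)) (λ k d≈e d∈ i → clears-resp d≈e (d∈ i))
        (λ k → common-denominator (λ i g → g ∈ Clears (M k i)) (λ i → clears-ideal) (λ i → clears-resp)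
          (λ i → clear-denominators (M k i) (proj₁ (proj₂ (product k i)))))
      denominator-f : ∃ λ g → IsDenominator {t} g × g ∈ Clears f
      denominator-f = clear-denominators f (proj₁ (proj₂ h-span))
      g₁ = proj₁ denominators
      g₂ = proj₁ denominator-f
      g = g₁ * g₂
      g≉0 : g ≉ 0#
      g≉0 = *-nonzero (proj₂ (proj₁ (proj₂ denominators))) (proj₂ (proj₁ (proj₂ denominator-f)))
      g∈ : g ∈ Polys t
      g∈ = P.mul (proj₁ (proj₁ (proj₂ denominators))) (proj₁ (proj₁ (proj₂ denominator-f)))
      gM∈ : ∀ k i → g ∈ Clears (M k i)
      gM∈ k i = clears-resp (*-comm g₂ g₁) (clears-ideal (proj₁ (proj₁ (proj₂ denominator-f)))
          (proj₂ (proj₂ denominators) k i))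
      gf∈ : g ∈ Clears f
      gf∈ = clears-ideal (proj₁ (proj₁ (proj₂ denominators))) (proj₂ (proj₂ denominator-f))
      e : Fin n → Carrier
      e i = g ⁻¹ * d i
      N : Fin p → Fin n → Fin n → Carrier
      N k i j = g ^ (q ℕ.∸ 1) * (g * M k i j)
      F : Fin n → Carrier
      F i = g * f i
      N-poly : ∀ k i j → N k i j ∈ Polys t
      N-poly k i j = P.mul (P.pow (q ℕ.∸ 1) g∈) (gM∈ k i j)
      degree-N : ∃ λ D → ∀ k i j → N k i j ∈ Poly t D
      degree-N = common-degree {t} (λ k D → ∀ i j → N k i j ∈ Poly t D) (λ k D≤E a∈ i j → poly-mono D≤E (a∈ i j))
        (λ k → common-degree {t} (λ i D → ∀ j → N k i j ∈ Poly t D) (λ i D≤E a∈ j → poly-mono D≤E (a∈ j))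
          (λ i → common-degree {t} (λ j D → N k i j ∈ Poly t D) (λ j → poly-mono) (N-poly k i)))
      degree-F : ∃ λ D → ∀ i → F i ∈ Poly t D
      degree-F = common-degree {t} (λ i D → F i ∈ Poly t D) (λ i → poly-mono) gf∈
      D = proj₁ degree-N ℕ.⊔ proj₁ degree-F
      N∈ : ∀ k i j → N k i j ∈ Poly t D
      N∈ k i j = poly-mono (ℕₚ.m≤m⊔n _ _) (proj₂ degree-N k i j)
      F∈ : ∀ i → F i ∈ Poly t D
      F∈ i = poly-mono (ℕₚ.m≤n⊔m (proj₁ degree-N) _) (proj₂ degree-F i)
      g⁻¹g : g ⁻¹ * g ≈ 1#
      g⁻¹g = ⁻¹-inverseˡ g≉0
      h≈ : h ≈ ∑ (λ i → F i * e i)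
      h≈ = trans (proj₂ (proj₂ h-span)) (∑-cong λ i → sym (begin
        g * f i * (g ⁻¹ * d i)       ≈⟨ solve 4 (λ g f i d → g :* f :* (i :* d) := i :* g :* (f :* d)) refl g (f i)
            (g ⁻¹) (d i) ⟩
        g ⁻¹ * g * (f i * d i)       ≈⟨ trans (*-congʳ g⁻¹g) (*-identityˡ _) ⟩
        f i * d i                    ∎))
      scale : ∀ x y → g ⁻¹ * (x * y ^ p) ≈ g ^ (q ℕ.∸ 1) * (g * x) * (g ⁻¹ * y) ^ p
      scale x y = sym (begin
        g ^ (q ℕ.∸ 1) * (g * x) * (g ⁻¹ * y) ^ p
          ≈⟨ *-congˡ (^p-homo-* (g ⁻¹) y) ⟩
        g ^ (q ℕ.∸ 1) * (g * x) * (g ⁻¹ * (g ⁻¹) ^ q * y ^ p)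
          ≈⟨ solve 6 (λ a g x i b y → a :* (g :* x) :* (i :* b :* y) := (g :* a) :* b :* (i :* (x :* y))) refl
              (g ^ (q ℕ.∸ 1)) g x (g ⁻¹) ((g ⁻¹) ^ q) (y ^ p) ⟩
        g ^ suc (q ℕ.∸ 1) * (g ⁻¹) ^ q * (g ⁻¹ * (x * y ^ p))
          ≈⟨ *-congʳ (trans (*-congʳ (^-congʳ g (ℕₚ.m+[n∸m]≡n (ℕₚ.≤-pred 1<p)))) (^-inverse q g≉0)) ⟩
        1# * (g ⁻¹ * (x * y ^ p))
          ≈⟨ *-identityˡ _ ⟩
        g ⁻¹ * (x * y ^ p) ∎)
      N≈ : ∀ k i → π ^ toℕ k * e i ≈ ∑ (λ j → N k i j * e j ^ p)
      N≈ k i = begin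
        π ^ toℕ k * (g ⁻¹ * d i)                     ≈⟨ solve 3 (λ a b c → a :* (b :* c) := b :* (a :* c)) refl
            (π ^ toℕ k) (g ⁻¹) (d i) ⟩
        g ⁻¹ * (π ^ toℕ k * d i)                     ≈⟨ trans (*-congˡ (proj₂ (proj₂ (product k i))))
            (*-∑ (g ⁻¹) (λ j → M k i j * d j ^ p)) ⟩
        ∑ (λ j → g ⁻¹ * (M k i j * d j ^ p))         ≈⟨ ∑-cong (λ j → scale (M k i j) (d j)) ⟩
        ∑ (λ j → N k i j * e j ^ p)                  ∎

  module IntegralPolynomials {a : Level} {A : Pred Carrier a} {T : Carrier} (adic : Adic.IsAdic 𝔽 A T) where
    open Adic 𝔽
    open AdicLemmas adic
    private module A = IsSubring (IsAdic.isSubring adic)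

    fp⊆A : Fp ⊆ A
    fp⊆A (n , a≈) = A.resp (sym a≈) (A.times n A.one)

    poly⊆A : ∀ {D} → Poly T D ⊆ A
    poly⊆A (nil a≈0)         = A.resp (sym a≈0) A.zer
    poly⊆A (horner n∈ b∈ eq) = A.resp (sym eq) (A.add (fp⊆A n∈) (A.mul (IsAdic.π∈ adic) (poly⊆A b∈)))

    fp-unique : UniqueDigits A T Fp
    fp-unique {m} {n} {r} m∈ n∈ r∈ eq = x-y≈0⇒x≈y (Dec.decidable-stable ((m - n) ≟ 0#) λ m-n≉0 → contradiction (begin
        1#                           ≈⟨ ⁻¹-inverseʳ m-n≉0 ⟨
        (m - n) * (m - n) ⁻¹         ≈⟨ *-congʳ (trans (+-congʳ eq)
            (solve 3 (λ n p r → (n :+ p :* r) :- n := p :* r) refl n T r)) ⟩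
        T * r * (m - n) ⁻¹           ≈⟨ *-assoc _ _ _ ⟩
        T * (r * (m - n) ⁻¹)         ∎)
      (1∉π (A.mul r∈ (fp⊆A (Fp.inv m-n≉0 (Fp.add m∈ (Fp.neg n∈)))))))

    T-transcendental : ∀ D (n : Fin D → Carrier) → (∀ i → n i ∈ Fp) → ∑ (λ i → n i * T ^ toℕ i) ≈ 0# → ∀ i → n i ≈ 0#
    T-transcendental (suc D) n n∈ rel = λ { zero → n₀≈0 ; (suc i) → T-transcendental D (n ∘ suc) (n∈ ∘ suc) S≈0 i }
      where
      S = ∑ (λ i → n (suc i) * T ^ toℕ i)
      S∈ : S ∈ A
      S∈ = A.∑∈ λ i → A.mul (fp⊆A (n∈ (suc i))) (A.pow (toℕ i) (IsAdic.π∈ adic))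
      unfold : n zero + T * S ≈ 0#
      unfold = trans (sym (trans (∑-suc (λ i → n i * T ^ toℕ i)) (+-cong (*-identityʳ _)
        (trans (∑-cong λ i → solve 3 (λ n t p → n :* (t :* p) := t :* (n :* p)) refl (n (suc i)) T (T ^ toℕ i))
               (sym (*-∑ T (λ i → n (suc i) * T ^ toℕ i))))))) rel
      n₀≈0 : n zero ≈ 0#
      n₀≈0 = fp-unique (n∈ zero) Fp.zer (A.neg S∈)
        (trans (solve 3 (λ n t s → n := (n :+ t :* s) :+ t :* :- s) refl (n zero) T S) (+-congʳ unfold))
      S≈0 : S ≈ 0#
      S≈0 = *-zero-divisor (IsAdic.π≉0 adic) (trans (sym (trans (+-congʳ n₀≈0) (+-identityˡ _))) unfold)

module AutomaticSeries {c ℓ : Level} (𝔽 : Field c ℓ) (em : ExcludedMiddle (c ⊔ ℓ)) (_≟_ : ∀ a b → Dec (Field._≈_ 𝔽 a b))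
                       {q : ℕ} (pr : Prime (suc q))
                       (char : Field._≈_ 𝔽 (FieldTheory._·_ 𝔽 (suc q) (Field.1# 𝔽)) (Field.0# 𝔽)) where
  open Field 𝔽 hiding (zero)
  open FieldTheory 𝔽 using (_^_; _·_; AlgebraicOver)
  open FieldLemmas 𝔽
  open Subrings 𝔽
  open Summation 𝔽
  open Spans 𝔽 _≟_
  open Adic 𝔽
  open PrimeSubfield 𝔽 pr char
  open Automata 𝔽
  open AutomaticSequences 𝔽 em (suc q)
  open IntegerSolver commutativeRing
  open SemiringExp semiring using (^-congˡ; ^-congʳ)
  open SetoidReasoning setoid

  private
    p : ℕ
    p = suc q

  kernel-valued : ∀ {g} {P : Pred Carrier g} → (∀ {a b} → a ≈ b → a ∈ P → b ∈ P) → ∀ {s t} →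
                  (∀ n → s n ∈ P) → t ∈ Kernel p s → ∀ n → t n ∈ P
  kernel-valued resp s∈ (i , j , _ , eq) n = resp (sym (eq n)) (s∈ _)

  δ-injective : ∀ {n m} (E : Fin n → Fin m) → (∀ {i j} → E i ≡ E j → i ≡ j) → ∀ i j → δ (E i) (E j) ≈ δ j i
  δ-injective E inj i j with i Finₚ.≟ j
  ... | yes ≡.refl = trans (δ-diagonal (E i)) (sym (δ-diagonal i))
  ... | no i≢j     = trans (δ-off-diagonal (i≢j ∘ inj)) (sym (δ-off-diagonal (i≢j ∘ ≡.sym)))

  module _ {s : Level} {F : Pred Carrier s} (isF : IsSubfield F) where
    private
      module F = IsSubfield isF
      isR = F.isSubring

    sparse-relation⇒algebraic : ∀ {n m} (E : Fin n → Fin m) → (∀ {i j} → E i ≡ E j → i ≡ j) → ∀ {a} (f : Fin n → Carrier) →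
      (∀ i → f i ∈ F) → (∃ λ i → f i ≉ 0#) → ∑ (λ i → f i * a ^ toℕ (E i)) ≈ 0# → a ∈ AlgebraicOver F
    sparse-relation⇒algebraic {n} {m} E inj {a} f f∈ (i₀ , f≉0) rel =
      m , g , (λ k → F.∑∈ λ i → F.mul (f∈ i) (δ∈ isR (E i) k)) , (E i₀ , λ g≈0 → f≉0 (trans (sym value) g≈0)) ,
      trans (reflexive (≡.sym (∑≡sum (λ k → g k * a ^ toℕ k)))) (begin
        ∑ (λ k → g k * a ^ toℕ k)
          ≈⟨ ∑-cong (λ k → trans (∑-* (a ^ toℕ k) (λ i → f i * δ (E i) k))
              (∑-cong λ i → *-assoc (f i) (δ (E i) k) (a ^ toℕ k))) ⟩
        ∑ (λ k → ∑ (λ i → f i * (δ (E i) k * a ^ toℕ k)))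
          ≈⟨ ∑-comm (λ k i → f i * (δ (E i) k * a ^ toℕ k)) ⟩
        ∑ (λ i → ∑ (λ k → f i * (δ (E i) k * a ^ toℕ k)))
          ≈⟨ ∑-cong (λ i → trans (sym (*-∑ (f i) (λ k → δ (E i) k * a ^ toℕ k))) (*-congˡ (∑-δ (E i) (λ k → a ^ toℕ k)))) ⟩
        ∑ (λ i → f i * a ^ toℕ (E i))
          ≈⟨ rel ⟩
        0# ∎)
      where
      g : Fin m → Carrier
      g k = ∑ (λ i → f i * δ (E i) k)
      value : g (E i₀) ≈ f i₀
      value = trans (∑-cong λ i → trans (*-congˡ (δ-injective E inj i i₀)) (*-comm (f i) (δ i₀ i))) (∑-δ i₀ f)

    span-^p : ∀ {n} {b : Fin n → Carrier} {x} → x ∈ Span F b → x ^ p ∈ Span F (λ i → b i ^ p)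
    span-^p {b = b} (f , f∈ , x≈) = (λ i → f i ^ p) , (λ i → F.pow p (f∈ i)) ,
      trans (^-congˡ p x≈) (trans (^p-homo-∑ (λ i → f i * b i)) (∑-cong λ i → ^p-homo-* (f i) (b i)))

    -- Iterating, the pⁱ-th powers of y k with i ≤ R all lie in the span of the R elements y l ^ (p^R).
    frobenius-span⇒algebraic : ∀ {R} (y : Fin R → Carrier) → (∀ k → y k ∈ Span F (λ l → y l ^ p)) →
                               ∀ k → y k ∈ AlgebraicOver F
    frobenius-span⇒algebraic {R} y y∈ k = finish (span-dependent isR (λ i → frobenius (toℕ i) (y k)) all-in-top)
      where
      chain : ∀ i k → frobenius i (y k) ∈ Span F (λ l → frobenius (suc i) (y l))
      chain zero    k = y∈ k
      chain (suc i) k = span-^p (chain i k)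
      climb : ∀ m i k → frobenius i (y k) ∈ Span F (λ l → frobenius (m ℕ.+ i) (y l))
      climb zero    i k = span-gen isR k
      climb (suc m) i k = span-mono isR (chain (m ℕ.+ i)) (climb m i k)
      all-in-top : ∀ (i : Fin (suc R)) → frobenius (toℕ i) (y k) ∈ Span F (λ l → frobenius R (y l))
      all-in-top i = ≡.subst (λ N → frobenius (toℕ i) (y k) ∈ Span F (λ l → frobenius N (y l)))
        (ℕₚ.m∸n+n≡m (ℕₚ.≤-pred (Finₚ.toℕ<n i))) (climb (R ℕ.∸ toℕ i) (toℕ i) k)
      bound : ∀ (i : Fin (suc R)) → p ℕ.^ toℕ i ℕ.< suc (p ℕ.^ R)
      bound i = s≤s (ℕₚ.^-monoʳ-≤ p (ℕₚ.≤-pred (Finₚ.toℕ<n i)))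
      E : Fin (suc R) → Fin (suc (p ℕ.^ R))
      E i = fromℕ< (bound i)
      toℕ-E : ∀ i → toℕ (E i) ≡ p ℕ.^ toℕ i
      toℕ-E i = Finₚ.toℕ-fromℕ< (bound i)
      power-injective : ∀ m n → p ℕ.^ m ≡ p ℕ.^ n → m ≡ n
      power-injective m n eq with ℕₚ.<-cmp m n
      ... | Tri.tri< m<n _ _ = contradiction eq (ℕₚ.<⇒≢ (ℕₚ.^-monoʳ-< p 1<p m<n))
      ... | Tri.tri≈ _ m≡n _ = m≡n
      ... | Tri.tri> _ _ n<m = contradiction (≡.sym eq) (ℕₚ.<⇒≢ (ℕₚ.^-monoʳ-< p 1<p n<m))
      E-injective : ∀ {i j} → E i ≡ E j → i ≡ j
      E-injective {i} {j} eq = Finₚ.toℕ-injective (power-injective (toℕ i) (toℕ j)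
        (≡.trans (≡.sym (toℕ-E i)) (≡.trans (≡.cong toℕ eq) (toℕ-E j))))
      finish : Dependent F (λ (i : Fin (suc R)) → frobenius (toℕ i) (y k)) → y k ∈ AlgebraicOver F
      finish (f , f∈ , nz , rel) = sparse-relation⇒algebraic E E-injective f f∈ nz (trans
        (∑-cong λ i → *-congˡ (trans (^-congʳ (y k) (toℕ-E i)) (sym (frobenius≈^ (toℕ i) (y k))))) rel)

    automatic-series⇒algebraic : ∀ {a} {A : Pred Carrier a} {π : Carrier} → IsAdic A π → π ∈ F → ∀ {s y} →
      (∀ n → s n ∈ Fp) → Automatic p s → IsSeries A π s y → y ∈ AlgebraicOver F
    automatic-series⇒algebraic {A = A} {π} adic π∈F {s} {y} s∈ auto ser =
      IsSubring.resp (IsSubfield.isSubring (Algebraic.algebraic-isSubfield 𝔽 _≟_ isF))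
        (series-unique (series-cong (λ n → sym (proj₂ first n)) refl (series (proj₁ first))) ser)
        (frobenius-span⇒algebraic value value∈ (proj₁ first))
      where
      open AdicLemmas adic
      open FrobeniusSeries pr char adic
      open Polynomials.IntegralPolynomials 𝔽 _≟_ pr char adic using (fp⊆A)
      open KernelFamily (kernelFamily {s} auto)
      first : ∃ λ k → s ≗ member k
      first = find (kernel-self {s})
      member∈ : ∀ k n → member k n ∈ Fp
      member∈ k = kernel-valued (IsSubfield.resp Fp-isSubfield) s∈ (kernel k)
      series-of : ∀ k → ∃ (IsSeries A π (member k))
      series-of k = IsAdic.complete adic (member k) (fp⊆A ∘ member∈ k)
      value : Fin size → Carrier
      value k = proj₁ (series-of k)
      series : ∀ k → IsSeries A π (member k) (value k)
      series k = proj₂ (series-of k)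
      next : ∀ k (j : Fin p) → ∃ λ l → decimate (toℕ j) (member k) ≗ member l
      next k j = find (kernel-decimate {s} (toℕ j) (Finₚ.toℕ<n j) (kernel k))
      value∈ : ∀ k → value k ∈ Span F (λ l → value l ^ p)
      value∈ k = span-resp isR (sym (series-split (fp⊆A ∘ member∈ k) (λ j → fp⊆A ∘ member∈ (proj₁ (next k j)))
          (λ j n → trans (proj₂ (next k j) n) (sym (Fp-frobenius (member∈ (proj₁ (next k j)) n))))
          (series k) (λ j → series (proj₁ (next k j)))))
        (span-sum isR λ j → span-scale isR (F.pow (toℕ j) π∈F) (span-gen isR (proj₁ (next k j))))

  module _ {r : ℕ} (γ : Fin r → Carrier) {a : Sequence} {u : Fin r → Sequence}
           (a≈ : ∀ n → a n ≈ ∑ (λ j → u j n * γ j)) where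

    automatic⇒automatic-coordinates : Independent Fp γ → (∀ j n → u j n ∈ Fp) → Automatic p a → ∀ j → Automatic p (u j)
    automatic⇒automatic-coordinates ind u∈ auto j = covered-kernel⇒automatic {u j}
      (List.tabulate candidate , λ t (i , k , k< , t≗) →
        let l , eq = find (i , k , k< , λ _ → refl) in
        Anyₚ.tabulate⁺ {f = candidate} l λ n → trans (t≗ n) (coordinates-equal (trans (eq n) (member≗ l n)) j))
      where
      open KernelFamily (kernelFamily {a} auto)
      position : Fin size → ℕ → ℕ
      position l n = let i , k , _ = kernel l in n ℕ.* p ℕ.^ i ℕ.+ k
      member≗ : ∀ l n → member l n ≈ a (position l n)
      member≗ l = proj₂ (proj₂ (proj₂ (kernel l)))
      candidate : Fin size → Sequence
      candidate l n = u j (position l n)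
      coordinates-equal : ∀ {m n} → a m ≈ a n → ∀ j → u j m ≈ u j n
      coordinates-equal {m} {n} eq j = x-y≈0⇒x≈y (ind (λ j → u j m - u j n)
        (λ j → IsSubfield.add Fp-isSubfield (u∈ j m) (IsSubfield.neg Fp-isSubfield (u∈ j n))) (begin
          ∑ (λ j → (u j m - u j n) * γ j)
            ≈⟨ ∑-cong (λ j → solve 3 (λ x y g → (x :- y) :* g := x :* g :+ :- (y :* g)) refl (u j m) (u j n) (γ j)) ⟩
          ∑ (λ j → u j m * γ j + - (u j n * γ j))
            ≈⟨ trans (∑-+ (λ j → u j m * γ j) (λ j → - (u j n * γ j))) (+-congˡ (∑-neg (λ j → u j n * γ j))) ⟩
          ∑ (λ j → u j m * γ j) - ∑ (λ j → u j n * γ j)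
            ≈⟨ +-cong (trans (sym (a≈ m)) eq) (-‿cong (sym (a≈ n))) ⟩
          a n - a n
            ≈⟨ -‿inverseʳ (a n) ⟩
          0# ∎) j)

    automatic-coordinates⇒automatic : (∀ j → Automatic p (u j)) → Automatic p a
    automatic-coordinates⇒automatic auto = covered-kernel⇒automatic {a}
      (proj₁ cover , λ t (i , k , k< , t≗) → proj₂ cover t
        ((λ j n → u j (n ℕ.* p ℕ.^ i ℕ.+ k)) , (λ j → i , k , k< , λ _ → refl) , λ n → trans (t≗ n) (a≈ _)))
      where
      Combinations : ∀ {r} → (Fin r → Carrier) → (Fin r → Pred Sequence ℓ) → Pred Sequence (c ⊔ ℓ)
      Combinations {r} γ P t = ∃ λ (v : Fin r → Sequence) → (∀ j → v j ∈ P j) × t ≗ (λ n → ∑ (λ j → v j n * γ j))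
      combinations : ∀ {r} (γ : Fin r → Carrier) {P : Fin r → Pred Sequence ℓ} → (∀ j → Covered _≗_ (P j)) →
                     Covered _≗_ (Combinations γ P)
      combinations {zero}  γ covers = (λ _ → 0#) ∷ [] , λ { t (v , _ , eq) → here (λ n → trans (eq n) (∑-nil _)) }
      combinations {suc r} γ covers = covered-map₂ (λ v t n → v n * γ zero + t n)
        (λ z≗ x≗ y≗ n → trans (z≗ n) (+-cong (*-congʳ (x≗ n)) (y≗ n)))
        (λ { t (v , v∈ , eq) → v zero , (λ n → ∑ (λ j → v (suc j) n * γ (suc j))) , v∈ zero ,
             (v ∘ suc , v∈ ∘ suc , λ _ → refl) , λ n → trans (eq n) (∑-suc _) })
        (covers zero) (combinations (γ ∘ suc) (covers ∘ suc))
      cover : Covered _≗_ (Combinations γ (λ j → Kernel p (u j)))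
      cover = combinations γ (λ j → automatic⇒covered {u j} (auto j))

module AlgebraicResidues {c ℓ : Level} (𝔽 : Field c ℓ) (em : ExcludedMiddle (c ⊔ ℓ)) (_≟_ : ∀ a b → Dec (Field._≈_ 𝔽 a b))
                         {q : ℕ} (pr : Prime (suc q))
                         (char : Field._≈_ 𝔽 (FieldTheory._·_ 𝔽 (suc q) (Field.1# 𝔽)) (Field.0# 𝔽)) where
  open Field 𝔽 hiding (zero)
  open FieldTheory 𝔽 using (_^_; _·_; AlgebraicOver)
  open FieldLemmas 𝔽
  open PrimeSubfield 𝔽 pr char
  open Automata 𝔽
  open AutomaticSequences 𝔽 em (suc q)
  open Polynomials 𝔽 _≟_ pr char
  open IntegerSolver commutativeRing
  open SemiringExp semiring using (^-congʳ; ^-homo-*; ^-assocʳ)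
  open SetoidReasoning setoid

  module _ {a k : Level} {A : Pred Carrier a} {t : Carrier} {κ : Pred Carrier k}
           (uniformizer : Cartier.IsUniformizer 𝔽 _≟_ pr char A t κ)
           {period : ℕ} (periodic : ∀ {u} → u ∈ κ → frobenius (suc period) u ≈ u)
           (ρ : Carrier → Carrier) (ρ-cong : ∀ {u w} → u ≈ w → ρ u ≈ ρ w) where
    open Cartier 𝔽 _≟_ pr char using (p; module CartierLemmas)
    open CartierLemmas uniformizer
    open CartierPolynomials uniformizer em

    residues : Carrier → ℕ → Carrier → Sequence
    residues π i y n = ρ (frobenius i (residue (y * (π ⁻¹) ^ suc n)))

    residues-cong : ∀ {π} i {y y′} → y ≈ y′ → residues π i y ≗ residues π i y′
    residues-cong {π} i {y} {y′} y≈y′ n = ρ-cong (frobenius-cong i (residue-cong (*-congʳ y≈y′)))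

    residues-decimate : ∀ {π} → π ≉ 0# → ∀ i y n (j : Fin p) → residues π i y (n ℕ.* p ℕ.+ toℕ j)
                        ≈ residues π (suc i) (topCartier (π ^ (q ℕ.∸ toℕ j) * y)) n
    residues-decimate {π} π≉0 i y n j = ρ-cong (begin
      frobenius i (residue (y * (π ⁻¹) ^ suc (n ℕ.* p ℕ.+ toℕ j)))
        ≈⟨ frobenius-cong i (trans (residue-cong split) (residue-adjoint (π ^ o * y) ((π ⁻¹) ^ suc n))) ⟩
      frobenius i (residue (topCartier (π ^ o * y) * (π ⁻¹) ^ suc n) ^ p)
        ≡⟨ frobenius-^p i _ ⟩
      frobenius (suc i) (residue (topCartier (π ^ o * y) * (π ⁻¹) ^ suc n)) ∎)
      where
      o = q ℕ.∸ toℕ j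
      m = suc (n ℕ.* p ℕ.+ toℕ j)
      exponent : o ℕ.+ m ≡ suc n ℕ.* p
      exponent = ≡.trans (ℕₚ.+-suc o (n ℕ.* p ℕ.+ toℕ j)) (≡.cong suc (≡.trans (ℕₚ.+-comm o (n ℕ.* p ℕ.+ toℕ j))
        (≡.trans (ℕₚ.+-assoc (n ℕ.* p) (toℕ j) o) (≡.trans
          (≡.cong (n ℕ.* p ℕ.+_) (ℕₚ.m+[n∸m]≡n (ℕₚ.≤-pred (Finₚ.toℕ<n j)))) (ℕₚ.+-comm (n ℕ.* p) q)))))
      split : y * (π ⁻¹) ^ m ≈ π ^ o * y * ((π ⁻¹) ^ suc n) ^ p
      split = sym (begin
        π ^ o * y * ((π ⁻¹) ^ suc n) ^ p
          ≈⟨ *-congˡ (trans (^-assocʳ (π ⁻¹) (suc n) p) (trans (^-congʳ (π ⁻¹) (≡.sym exponent)) (^-homo-* (π ⁻¹) o m))) ⟩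
        π ^ o * y * ((π ⁻¹) ^ o * (π ⁻¹) ^ m)
          ≈⟨ solve 4 (λ a y b d → a :* y :* (b :* d) := a :* b :* (y :* d)) refl (π ^ o) y ((π ⁻¹) ^ o) ((π ⁻¹) ^ m) ⟩
        π ^ o * (π ⁻¹) ^ o * (y * (π ⁻¹) ^ m)
          ≈⟨ trans (*-congʳ (^-inverse o π≉0)) (*-identityˡ _) ⟩
        y * (π ⁻¹) ^ m ∎)

    algebraic-residues-automatic : ∀ {π h} → π ≉ 0# → π ∈ AlgebraicOver (Frac t) → h ∈ AlgebraicOver (Frac t) →
                                   Automatic p (residues π 0 h)
    algebraic-residues-automatic {π} {h} π≉0 π∈ h∈ = closed-covered⇒automatic {S = Family}
        (λ s≗t (i , y , y∈ , eq) → i , y , y∈ , ≗-trans (≗-sym s≗t) eq)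
        closed covering {residues π 0 h} (zero , h , initial , λ _ → refl)
      where
      open StableSet (stableSet π∈ h∈)
      Family : Pred Sequence (c ⊔ ℓ)
      Family s = ∃ λ (i : Fin (suc period)) → ∃ λ y → y ∈ V × s ≗ residues π (toℕ i) y
      next : ∀ i → ∃ λ (i′ : Fin (suc period)) → ∀ {u} → u ∈ κ → frobenius (suc (toℕ i)) u ≈ frobenius (toℕ i′) u
      next i = step (view i)
        where
        step : ∀ {i} → Top.View i → ∃ λ (i′ : Fin (suc period)) → ∀ {u} → u ∈ κ → frobenius (suc (toℕ i)) u ≈
            frobenius (toℕ i′) u
        step ‵fromℕ       = zero , λ {u} u∈ → trans (reflexive (≡.cong (λ e → frobenius (suc e) u)
            (Finₚ.toℕ-fromℕ period))) (periodic u∈)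
        step (‵inject₁ j) = suc j , λ {u} u∈ → reflexive (≡.cong (λ e → frobenius (suc e) u) (Finₚ.toℕ-inject₁ j))
      closed : ∀ {s} j → j ℕ.< p → s ∈ Family → decimate j s ∈ Family
      closed {s} j j<p (i , y , y∈ , eq) = proj₁ (next i) , topCartier (π ^ (q ℕ.∸ j) * y) ,
          ≡.subst (λ e → topCartier (π ^ e * y) ∈ V) (Finₚ.toℕ-fromℕ< o<p) (stable (fromℕ< o<p) y∈) , λ n → (begin
            s (n ℕ.* p ℕ.+ j)
              ≈⟨ eq (n ℕ.* p ℕ.+ j) ⟩
            residues π (toℕ i) y (n ℕ.* p ℕ.+ j)
              ≈⟨ ≡.subst (λ e → residues π (toℕ i) y (n ℕ.* p ℕ.+ e) ≈ residues π (suc (toℕ i))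
                  (topCartier (π ^ (q ℕ.∸ e) * y)) n)
                   (Finₚ.toℕ-fromℕ< j<p) (residues-decimate π≉0 (toℕ i) y n (fromℕ< j<p)) ⟩
            residues π (suc (toℕ i)) (topCartier (π ^ (q ℕ.∸ j) * y)) n
              ≈⟨ ρ-cong (proj₂ (next i) (residue∈ _)) ⟩
            residues π (toℕ (proj₁ (next i))) (topCartier (π ^ (q ℕ.∸ j) * y)) n ∎)
        where
        o<p : q ℕ.∸ j ℕ.< p
        o<p = s≤s (ℕₚ.m∸n≤m q j)
      covering : Covered _≗_ Family
      covering = covered-map₂ {_∼₁_ = _≡_} {_∼₂_ = _≈_} {P = λ _ → Fin (suc period)} (λ i y → residues π (toℕ i) y)
        (λ { {i} z≗ ≡.refl y≈ n → trans (z≗ n) (residues-cong (toℕ i) y≈ n) })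
        (λ { s (i , y , y∈ , eq) → i , y , i , y∈ , eq })
        (List.tabulate id , λ i _ → Anyₚ.tabulate⁺ {f = id} i ≡.refl)
        covered

-- The functional f(z) = Σₙ θ(z π⁻ⁿ⁻¹) πⁿ attached to an additive map θ : 𝔽 → 𝔽_p vanishing on A is linear over the closure
-- Λ of 𝔽_p[π]; a basis dual to γ with respect to f turns coordinates of digits into values of θ.
module Duality {c ℓ : Level} (𝔽 : Field c ℓ) (_≟_ : ∀ a b → Dec (Field._≈_ 𝔽 a b))
               {q : ℕ} (pr : Prime (suc q))
               (char : Field._≈_ 𝔽 (FieldTheory._·_ 𝔽 (suc q) (Field.1# 𝔽)) (Field.0# 𝔽)) where
  open Field 𝔽 hiding (zero)
  open FieldTheory 𝔽 using (_^_; _·_)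
  open FieldLemmas 𝔽
  open Subrings 𝔽
  open Summation 𝔽
  open Spans 𝔽 _≟_
  open Adic 𝔽
  open PrimeSubfield 𝔽 pr char
  open Polynomials 𝔽 _≟_ pr char
  open IntegerSolver commutativeRing
  open SemiringExp semiring using (^-congʳ; ^-homo-*)
  open SetoidReasoning setoid

  module _ {a g : Level} {A : Pred Carrier a} {π : Carrier} (adic : IsAdic A π)
           {Γ : Pred Carrier g} (digits : IsDigits A π Γ)
           {r : ℕ} {γ : Fin r → Carrier} (γ∈ : ∀ i → γ i ∈ Γ) (independent : Independent Fp γ) (spanning : Γ ⊆ Span Fp γ)
           (θ : Carrier → Carrier) (θ-cong : ∀ {x y} → x ≈ y → θ x ≈ θ y) (θ-+ : ∀ x y → θ (x + y) ≈ θ x + θ y)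
           (θ∈ : ∀ x → θ x ∈ Fp) (θ-integral : ∀ {x} → x ∈ A → θ x ≈ 0#) where
    open IsAdic adic
    open AdicLemmas adic
    open IntegralPolynomials adic
    private
      module A = IsSubring isSubring
      module Γ = IsDigits digits
      module Fp = IsSubfield Fp-isSubfield
      isFp = Fp.isSubring

    coefficients : Carrier → ℕ → Carrier
    coefficients z n = θ (z * (π ⁻¹) ^ suc n)

    abstract
      functional : Carrier → Carrier
      functional z = proj₁ (complete (coefficients z) (λ n → fp⊆A (θ∈ _)))

      functional-series : ∀ z → IsSeries A π (coefficients z) (functional z)
      functional-series z = proj₂ (complete (coefficients z) (λ n → fp⊆A (θ∈ _)))

    functional∈A : ∀ z → functional z ∈ A
    functional∈A z = series∈ (functional-series z)

    functional-cong : ∀ {x y} → x ≈ y → functional x ≈ functional y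
    functional-cong {x} {y} x≈y = series-unique
      (series-cong (λ n → θ-cong (*-congʳ x≈y)) refl (functional-series x)) (functional-series y)

    functional-+ : ∀ x y → functional (x + y) ≈ functional x + functional y
    functional-+ x y = series-unique (functional-series (x + y))
      (series-cong (λ n → trans (sym (θ-+ _ _)) (θ-cong (sym (distribʳ _ _ _)))) refl
        (series-+ (functional-series x) (functional-series y)))

    delay : ℕ → (ℕ → Carrier) → ℕ → Carrier
    delay zero    s n       = s n
    delay (suc N) s zero    = 0#
    delay (suc N) s (suc n) = delay N s n

    delay-+ : ∀ N s n → delay N s (N ℕ.+ n) ≡ s n
    delay-+ zero    s n = ≡.refl
    delay-+ (suc N) s n = delay-+ N s n

    delay∈ : ∀ N {s} → (∀ n → s n ∈ Fp) → ∀ n → delay N s n ∈ Fp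
    delay∈ zero    s∈ n       = s∈ n
    delay∈ (suc N) s∈ zero    = Fp.zer
    delay∈ (suc N) s∈ (suc n) = delay∈ N s∈ n

    delay-series : ∀ N {s y} → IsSeries A π s y → IsSeries A π (delay N s) (π ^ N * y)
    delay-series zero    ser = series-cong (λ _ → refl) (sym (*-identityˡ _)) ser
    delay-series (suc N) {s} ser = series-cong (λ _ → refl) (trans (+-identityˡ _) (sym (*-assoc _ _ _)))
      (series-cons {delay (suc N) s} A.zer (delay-series N ser))

    functional-π : ∀ {z} → z ∈ A → functional (π * z) ≈ π * functional z
    functional-π {z} z∈ = series-unique (functional-series (π * z))
      (series-cong shifted (*-congʳ (*-identityʳ π)) (delay-series 1 (functional-series z)))
      where
      cancel : ∀ n → π * z * (π ⁻¹) ^ suc n ≈ z * (π ⁻¹) ^ n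
      cancel n = trans (solve 4 (λ p z i e → p :* z :* (i :* e) := p :* i :* (z :* e)) refl π z (π ⁻¹) ((π ⁻¹) ^ n))
        (trans (*-congʳ (⁻¹-inverseʳ π≉0)) (*-identityˡ _))
      shifted : ∀ n → delay 1 (coefficients z) n ≈ coefficients (π * z) n
      shifted zero    = sym (θ-integral (A.resp (sym (trans (cancel 0) (*-identityʳ z))) z∈))
      shifted (suc n) = θ-cong (sym (cancel (suc n)))

    functional-π^ : ∀ N {z} → z ∈ A → functional (π ^ N * z) ≈ π ^ N * functional z
    functional-π^ zero    z∈ = trans (functional-cong (*-identityˡ _)) (sym (*-identityˡ _))
    functional-π^ (suc N) z∈ = trans (functional-cong (*-assoc _ _ _)) (trans (functional-π (A.mul (A.pow N π∈) z∈))
      (trans (*-congˡ (functional-π^ N z∈)) (sym (*-assoc _ _ _))))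

    functional-zero : ∀ {z} → z ≈ 0# → functional z ≈ 0#
    functional-zero {z} z≈0 = begin
      functional z                                     ≈⟨ solve 1 (λ x → x := (x :+ x) :- x) refl (functional z) ⟩
      (functional z + functional z) - functional z     ≈⟨ +-congʳ (functional-+ z z) ⟨
      functional (z + z) - functional z                ≈⟨ +-congʳ (functional-cong (trans (+-congʳ z≈0) (+-identityˡ z))) ⟩
      functional z - functional z                      ≈⟨ -‿inverseʳ _ ⟩
      0#                                               ∎

    functional-Fp : ∀ {n} z → n ∈ Fp → functional (n * z) ≈ n * functional z
    functional-Fp {a} z (n , a≈) = trans (functional-cong (trans (*-congʳ a≈) (sym (Fp-times n z)))) (trans (multiples n)
      (trans (Fp-times n _) (*-congʳ (sym a≈))))
      where
      multiples : ∀ n → functional (n · z) ≈ n · functional z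
      multiples zero    = functional-zero refl
      multiples (suc n) = trans (functional-+ z (n · z)) (+-congˡ (multiples n))

    functional-∑ : ∀ {n} (z : Fin n → Carrier) → functional (∑ z) ≈ ∑ (λ i → functional (z i))
    functional-∑ {zero}  z = trans (functional-zero (∑-nil z)) (sym (∑-nil _))
    functional-∑ {suc n} z = trans (functional-cong (∑-suc z)) (trans (functional-+ (z zero) (∑ (λ i → z (suc i))))
      (trans (+-congˡ (functional-∑ (λ i → z (suc i)))) (sym (∑-suc _))))

    functional-poly : ∀ {D z b} → z ∈ A → b ∈ Poly π D → functional (z * b) ≈ functional z * b
    functional-poly z∈ (nil b≈0) = trans (functional-zero (trans (*-congˡ b≈0) (zeroʳ _)))
        (sym (trans (*-congˡ b≈0) (zeroʳ _)))
    functional-poly {z = z} {e} z∈ (horner {n = n} {b} n∈ b∈ eq) = begin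
      functional (z * e)                                  ≈⟨ functional-cong (trans (*-congˡ eq)
                                                              (solve 4 (λ z n p b → z :* (n :+ p :* b) := n :* z :+ p
                                                                  :* (z :* b)) refl z n π b)) ⟩
      functional (n * z + π * (z * b))                    ≈⟨ functional-+ (n * z) (π * (z * b)) ⟩
      functional (n * z) + functional (π * (z * b))       ≈⟨ +-cong (functional-Fp z n∈)
          (trans (functional-π (A.mul z∈ (poly⊆A b∈))) (*-congˡ (functional-poly z∈ b∈))) ⟩
      n * functional z + π * (functional z * b)           ≈⟨ solve 4
          (λ f n p b → n :* f :+ p :* (f :* b) := f :* (n :+ p :* b)) refl (functional z) n π b ⟩
      functional z * (n + π * b)                          ≈⟨ *-congˡ eq ⟨
      functional z * e                                    ∎

    Λ : Pred Carrier (c ⊔ ℓ ⊔ a)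
    Λ x = ∀ N → ∃₂ λ b s → b ∈ Polys π × s ∈ A × x ≈ b + π ^ N * s

    Λ⊆A : Λ ⊆ A
    Λ⊆A x∈ = let b , s , (_ , b∈) , s∈ , eq = x∈ 0 in A.resp (sym eq) (A.add (poly⊆A b∈) (A.mul A.one s∈))

    private module P = IsSubring (polys-isSubring {π})

    Λ-isSubring : IsSubring Λ
    Λ-isSubring = record
      { resp = λ x≈y x∈ N → let b , s , b∈ , s∈ , eq = x∈ N in b , s , b∈ , s∈ , trans (sym x≈y) eq
      ; one  = λ N → 1# , 0# , P.one , A.zer , sym (trans (+-congˡ (zeroʳ _)) (+-identityʳ _))
      ; add  = λ x∈ y∈ N → let b , s , b∈ , s∈ , eq = x∈ N ; d , u , d∈ , u∈ , eq′ = y∈ N in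
          b + d , s + u , P.add b∈ d∈ , A.add s∈ u∈ , trans (+-cong eq eq′)
            (solve 5 (λ b d s u P → (b :+ P :* s) :+ (d :+ P :* u) := (b :+ d) :+ P :* (s :+ u)) refl b d s u (π ^ N))
      ; neg  = λ x∈ N → let b , s , b∈ , s∈ , eq = x∈ N in
          - b , - s , P.neg b∈ , A.neg s∈ , trans (-‿cong eq) (solve 3
              (λ b s P → :- (b :+ P :* s) := :- b :+ P :* :- s) refl b s (π ^ N))
      ; mul  = λ {x} {y} x∈ y∈ N → let b , s , (D , b∈) , s∈ , eq = x∈ N ; d , u , d∈ , u∈ , eq′ = y∈ N in
          b * d , b * u + s * y , P.mul (D , b∈) d∈ , A.add (A.mul (poly⊆A b∈) u∈) (A.mul s∈ (Λ⊆A y∈)) ,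
          trans (*-congʳ eq) (trans (distribʳ y b (π ^ N * s)) (trans (+-congʳ (*-congˡ eq′))
            (solve 6 (λ b s d u y P → b :* (d :+ P :* u) :+ P :* s :* y := b :* d :+ P :* (b :* u :+ s :* y)) refl b s
                d u y (π ^ N))))
      }

    series∈Λ : ∀ {s y} → (∀ n → s n ∈ Fp) → IsSeries A π s y → y ∈ Λ
    series∈Λ {s} s∈ ser N = let r , r∈ , eq = ser N in partial π s N , r , (N , partial∈ s∈ N) , r∈ , eq
      where
      partial∈ : ∀ {s} → (∀ n → s n ∈ Fp) → ∀ N → partial π s N ∈ Poly π N
      partial∈ s∈ zero    = nil refl
      partial∈ s∈ (suc N) = horner (s∈ 0) (partial∈ (s∈ ∘ suc) N) refl

    functional∈Λ : ∀ z → functional z ∈ Λ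
    functional∈Λ z = series∈Λ (λ n → θ∈ _) (functional-series z)

    functional-Λ : ∀ {z x} → z ∈ A → x ∈ Λ → functional (z * x) ≈ functional z * x
    functional-Λ {z} {x} z∈ x∈ = x-y≈0⇒x≈y (separated λ N → let b , s , (D , b∈) , s∈ , eq = x∈ N in
      functional (z * s) - functional z * s , A.add (functional∈A _) (A.neg (A.mul (functional∈A z) s∈)) , (begin
        functional (z * x) - functional z * x
          ≈⟨ +-cong (functional-cong (trans (*-congˡ eq) (solve 4
              (λ z b P s → z :* (b :+ P :* s) := z :* b :+ P :* (z :* s)) refl z b (π ^ N) s)))
                    (-‿cong (*-congˡ eq)) ⟩
        functional (z * b + π ^ N * (z * s)) - functional z * (b + π ^ N * s)
          ≈⟨ +-congʳ (trans (functional-+ (z * b) (π ^ N * (z * s)))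
              (+-cong (functional-poly z∈ b∈) (functional-π^ N (A.mul z∈ s∈)))) ⟩
        (functional z * b + π ^ N * functional (z * s)) - functional z * (b + π ^ N * s)
          ≈⟨ solve 5 (λ f b P e s → (f :* b :+ P :* e) :- f :* (b :+ P :* s) := P :* (e :- f :* s)) refl
              (functional z) b (π ^ N) (functional (z * s)) s ⟩
        π ^ N * (functional (z * s) - functional z * s) ∎))

    Λ-split : ∀ {x} → x ∈ Λ → ∃₂ λ n y → n ∈ Fp × y ∈ Λ × x ≈ n + π * y
    Λ-split {x} x∈ = n , y , n∈ , y∈ , x≈
      where
      first = x∈ 1
      s = proj₁ (proj₂ first)
      s∈ = proj₁ (proj₂ (proj₂ (proj₂ first)))
      head₁ = poly-head (proj₂ (proj₁ (proj₂ (proj₂ first))))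
      n = proj₁ head₁
      b = proj₁ (proj₂ head₁)
      n∈ : n ∈ Fp
      n∈ = proj₁ (proj₂ (proj₂ head₁))
      b∈ : b ∈ A
      b∈ = poly⊆A (proj₁ (proj₂ (proj₂ (proj₂ head₁))))
      y = b + s
      x≈ : x ≈ n + π * y
      x≈ = trans (proj₂ (proj₂ (proj₂ (proj₂ first)))) (trans (+-congʳ (proj₂ (proj₂ (proj₂ (proj₂ head₁)))))
        (solve 4 (λ n p b s → (n :+ p :* b) :+ p :* :1 :* s := n :+ p :* (b :+ s)) refl n π b s))
      y∈ : y ∈ Λ
      y∈ N = let e , u , (_ , e∈) , u∈ , eq = x∈ (suc N)
                 m , d , m∈ , d∈ , eq′ = poly-head e∈
                 x≈′ : x ≈ m + π * (d + π ^ N * u)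
                 x≈′ = trans eq (trans (+-congʳ eq′) (solve 5 (λ m p d P u → (m :+ p :* d) :+ p :* P :* u := m :+ p :*
                     (d :+ P :* u)) refl m π d (π ^ N) u))
                 tail∈ : d + π ^ N * u ∈ A
                 tail∈ = A.add (poly⊆A d∈) (A.mul (A.pow N π∈) u∈)
                 n≈m : n ≈ m
                 n≈m = fp-unique n∈ m∈ (A.add tail∈ (A.neg (A.add b∈ s∈)))
                   (trans (solve 2 (λ n z → n := (n :+ z) :- z) refl n (π * y)) (trans (+-congʳ (trans (sym x≈) x≈′))
                     (solve 4 (λ m p w z → (m :+ p :* w) :- p :* z := m :+ p :* (w :- z)) refl m π (d + π ^ N * u) y)))
             in d , u , (_ , d∈) , u∈ , *-cancelˡ π≉0 (begin
                  π * y                              ≈⟨ solve 2 (λ n z → z := (n :+ z) :- n) refl n (π * y) ⟩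
                  (n + π * y) - n                    ≈⟨ +-cong (trans (sym x≈) x≈′) (-‿cong n≈m) ⟩
                  (m + π * (d + π ^ N * u)) - m      ≈⟨ solve 2 (λ n z → z := (n :+ z) :- n) refl m (π * (d + π ^ N * u)) ⟨
                  π * (d + π ^ N * u)                ∎)

    Γ-combination : ∀ {n : ℕ} (u e : Fin n → Carrier) → (∀ i → u i ∈ Fp) → (∀ i → e i ∈ Γ) → ∑ (λ i → u i * e i) ∈ Γ
    Γ-combination {zero}  u e u∈ e∈ = Γ.resp (sym (∑-nil _)) Γ.zer
    Γ-combination {suc n} u e u∈ e∈ = Γ.resp (sym (∑-suc _)) (Γ.add (scale (u∈ zero) (e∈ zero))
        (Γ-combination (u ∘ suc) (e ∘ suc) (u∈ ∘ suc) (e∈ ∘ suc)))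
      where
      multiples : ∀ n {x} → x ∈ Γ → n · x ∈ Γ
      multiples zero    x∈ = Γ.zer
      multiples (suc n) x∈ = Γ.add x∈ (multiples n x∈)
      scale : ∀ {n x} → n ∈ Fp → x ∈ Γ → n * x ∈ Γ
      scale {x = x} (n , eq) x∈ = Γ.resp (trans (Fp-times n x) (*-congʳ (sym eq))) (multiples n x∈)

    independent-Λ : ∀ (x : Fin r → Carrier) → (∀ i → x i ∈ Λ) → ∑ (λ i → x i * γ i) ≈ 0# → ∀ i → x i ≈ 0#
    independent-Λ x x∈ rel i = separated λ N → deep N x x∈ rel i
      where
      deep : ∀ N (x : Fin r → Carrier) → (∀ i → x i ∈ Λ) → ∑ (λ i → x i * γ i) ≈ 0# → ∀ i → x i ∈ Ideal A π N
      deep zero    x x∈ rel i = ideal-zero (Λ⊆A (x∈ i))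
      deep (suc N) x x∈ rel i = ideal-suc {N} (trans (x≈ i) (trans (+-congʳ (n≈0 i)) (+-identityˡ _))) (deep N y y∈ y-rel i)
        where
        n y : Fin r → Carrier
        n i = proj₁ (Λ-split (x∈ i))
        y i = proj₁ (proj₂ (Λ-split (x∈ i)))
        n∈ : ∀ i → n i ∈ Fp
        n∈ i = proj₁ (proj₂ (proj₂ (Λ-split (x∈ i))))
        y∈ : ∀ i → y i ∈ Λ
        y∈ i = proj₁ (proj₂ (proj₂ (proj₂ (Λ-split (x∈ i)))))
        x≈ : ∀ i → x i ≈ n i + π * y i
        x≈ i = proj₂ (proj₂ (proj₂ (proj₂ (Λ-split (x∈ i)))))
        S T : Carrier
        S = ∑ (λ i → n i * γ i)
        T = ∑ (λ i → y i * γ i)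
        S+πT≈0 : S + π * T ≈ 0#
        S+πT≈0 = trans (trans (+-congˡ (*-∑ π (λ i → y i * γ i))) (sym (∑-+ (λ i → n i * γ i) (λ i → π * (y i * γ i)))))
          (trans (∑-cong λ i → trans (solve 4 (λ n p y g → n :* g :+ p :* (y :* g) := (n :+ p :* y) :* g) refl (n i) π
              (y i) (γ i)) (*-congʳ (sym (x≈ i)))) rel)
        S≈0 : S ≈ 0#
        S≈0 = Γ.unique (Γ-combination n γ n∈ γ∈) Γ.zer (A.neg (A.∑∈ λ i → A.mul (Λ⊆A (y∈ i)) (Γ.integral (γ∈ i))))
          (trans (solve 3 (λ S p T → S := (S :+ p :* T) :+ p :* :- T) refl S π T) (+-congʳ S+πT≈0))
        n≈0 : ∀ i → n i ≈ 0#
        n≈0 = independent n n∈ S≈0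
        y-rel : T ≈ 0#
        y-rel = *-zero-divisor π≉0 (trans (sym (trans (+-congʳ S≈0) (+-identityˡ _))) S+πT≈0)

    nondegenerate : (∃ λ w → θ w ≉ 0#) → ∀ {y} → y ∈ A → (∀ i → functional (y * γ i) ≈ 0#) → y ≈ 0#
    nondegenerate (w , θw≉0) {y} y∈ fyγ≈0 = Dec.decidable-stable (y ≟ 0#) λ y≉0 → θw≉0 (θ≈0 y≉0)
      where
      deep : ∀ N {z} → z ∈ A → functional (y * z) ∈ Ideal A π N
      deep zero    z∈ = ideal-zero (functional∈A _)
      deep (suc N) {z} z∈ = let δ , z′ , δ∈ , z′∈ , z≈ = Γ.exists z∈
                                u , u∈ , δ≈ = spanning δ∈ in
        ideal-suc {N} (begin
          functional (y * z)
            ≈⟨ functional-cong (trans (*-congˡ z≈) (solve 4 (λ y d p z → y :* (d :+ p :* z) := y :* d :+ p :*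
                (y :* z)) refl y δ π z′)) ⟩
          functional (y * δ + π * (y * z′))
            ≈⟨ trans (functional-+ (y * δ) (π * (y * z′))) (+-congˡ (functional-π (A.mul y∈ z′∈))) ⟩
          functional (y * δ) + π * functional (y * z′)
            ≈⟨ +-congʳ (trans (functional-cong (trans (*-congˡ δ≈) (*-∑ y (λ i → u i * γ i))))
                (functional-∑ (λ i → y * (u i * γ i)))) ⟩
          ∑ (λ i → functional (y * (u i * γ i))) + π * functional (y * z′)
            ≈⟨ +-congʳ (∑-zero λ i → trans (functional-cong (solve 3 (λ y u g → y :* (u :* g) := u :* (y :* g)) refl y
                (u i) (γ i)))
                 (trans (functional-Fp (y * γ i) (u∈ i)) (trans (*-congˡ (fyγ≈0 i)) (zeroʳ _)))) ⟩
          0# + π * functional (y * z′)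
            ≈⟨ +-identityˡ _ ⟩
          π * functional (y * z′) ∎) (deep N z′∈)
      fyz≈0 : ∀ {z} → z ∈ A → functional (y * z) ≈ 0#
      fyz≈0 z∈ = separated λ N → deep N z∈
      θ≈0 : y ≉ 0# → θ w ≈ 0#
      θ≈0 y≉0 = let N , x∈ = absorb (y ⁻¹ * w)
                    z = π ^ suc N * (y ⁻¹ * w)
                    z∈ : z ∈ A
                    z∈ = A.resp (sym (*-assoc _ _ _)) (A.mul π∈ x∈)
                in trans (θ-cong (sym (begin
                     y * z * (π ⁻¹) ^ suc N                               ≈⟨ solve 5
                         (λ y P i w J → y :* (P :* (i :* w)) :* J := P :* J :* (y :* (i :* w))) refl y (π ^ suc N)
                         (y ⁻¹) w ((π ⁻¹) ^ suc N) ⟩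
                     π ^ suc N * (π ⁻¹) ^ suc N * (y * (y ⁻¹ * w))        ≈⟨ *-cong (^-inverse (suc N) π≉0)
                         (cancel-⁻¹ w y≉0) ⟩
                     1# * w                                               ≈⟨ *-identityˡ w ⟩
                     w                                                    ∎)))
                   (digits-unique fp⊆A fp-unique (fyz≈0 z∈) ((λ n → θ∈ _) , functional-series (y * z))
                       ((λ _ → Fp.zer) , series-zero) N)

    module _ (θ-nonzero : ∃ λ w → θ w ≉ 0#) {s : Level} {M : Pred Carrier s} (isM : IsSubfield M)
             (π∈M : π ∈ M) (γ∈M : ∀ i → γ i ∈ M) (functional∈M : ∀ {z} → z ∈ M → functional z ∈ M) where
      private
        module M = IsSubfield isM
        M∩Λ-isSubring : IsSubring (λ x → x ∈ M × x ∈ Λ)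
        M∩Λ-isSubring = record
          { resp = λ eq (x , y) → M.resp eq x , IsSubring.resp Λ-isSubring eq y
          ; one  = M.one , IsSubring.one Λ-isSubring
          ; add  = λ (x , y) (x′ , y′) → M.add x x′ , IsSubring.add Λ-isSubring y y′
          ; neg  = λ (x , y) → M.neg x , IsSubring.neg Λ-isSubring y
          ; mul  = λ (x , y) (x′ , y′) → M.mul x x′ , IsSubring.mul Λ-isSubring y y′
          }

      dual : ∀ j → ∃₂ λ y e → y ∈ M × y ∈ A × e ∈ M × e ≉ 0# × e ∈ Λ × ∀ i → functional (y * γ i) ≈ e * δ j i
      dual j = construct (dependence M∩Λ-isSubring r v v∈)
        where
        v : Fin (suc r) → Fin r → Carrier
        v zero    i = δ j i
        v (suc k) i = functional (γ k * γ i)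
        v∈ : ∀ k i → v k i ∈ M × v k i ∈ Λ
        v∈ zero    i = δ∈ M∩Λ-isSubring j i
        v∈ (suc k) i = functional∈M (M.mul (γ∈M k) (γ∈M i)) , functional∈Λ _
        construct : (∃ λ (e : Fin (suc r) → Carrier) → (∀ i → e i ∈ M × e i ∈ Λ) × (∃ λ i → e i ≉ 0#) ×
            (∀ i → ∑ (λ k → e k * v k i) ≈ 0#)) →
          ∃₂ λ y e → y ∈ M × y ∈ A × e ∈ M × e ≉ 0# × e ∈ Λ × ∀ i → functional (y * γ i) ≈ e * δ j i
        construct (e , e∈ , (k₀ , e≉0) , rel) =
          - y , e zero , M.neg (M.∑∈ λ k → M.mul (proj₁ (e∈ (suc k))) (γ∈M k)) , A.neg y∈ , proj₁ (e∈ zero) , e0≉0 ,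
              proj₂ (e∈ zero) , λ i → (begin
            functional (- y * γ i)           ≈⟨ functional-cong (solve 2 (λ y g → :- y :* g := :- :1 :* (y :* g)) refl
                y (γ i)) ⟩
            functional (- 1# * (y * γ i))    ≈⟨ functional-Fp (y * γ i) (Fp.neg Fp.one) ⟩
            - 1# * functional (y * γ i)      ≈⟨ *-congˡ (fyγ i) ⟩
            - 1# * - (e zero * δ j i)        ≈⟨ solve 1 (λ x → :- :1 :* :- x := x) refl (e zero * δ j i) ⟩
            e zero * δ j i                   ∎)
          where
          y = ∑ (λ k → e (suc k) * γ k)
          y∈ : y ∈ A
          y∈ = A.∑∈ λ k → A.mul (Λ⊆A (proj₂ (e∈ (suc k)))) (Γ.integral (γ∈ k))
          fyγ : ∀ i → functional (y * γ i) ≈ - (e zero * δ j i)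
          fyγ i = begin
            functional (y * γ i)
              ≈⟨ trans (functional-cong (∑-* (γ i) (λ k → e (suc k) * γ k))) (functional-∑ (λ k → e (suc k) * γ k * γ i)) ⟩
            ∑ (λ k → functional (e (suc k) * γ k * γ i))
              ≈⟨ ∑-cong (λ k → trans (functional-cong (solve 3 (λ e g h → e :* g :* h := g :* h :* e) refl (e (suc k))
                  (γ k) (γ i)))
                   (trans (functional-Λ (A.mul (Γ.integral (γ∈ k)) (Γ.integral (γ∈ i))) (proj₂ (e∈ (suc k))))
                       (*-comm _ _))) ⟩
            ∑ (λ k → e (suc k) * functional (γ k * γ i))
              ≈⟨ solve 2 (λ x y → y := (x :+ y) :- x) refl (e zero * δ j i) _ ⟩
            (e zero * δ j i + ∑ (λ k → e (suc k) * functional (γ k * γ i))) - e zero * δ j i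
              ≈⟨ +-congʳ (trans (sym (∑-suc (λ k → e k * v k i))) (rel i)) ⟩
            0# - e zero * δ j i
              ≈⟨ +-identityˡ _ ⟩
            - (e zero * δ j i) ∎
          e0≉0 : e zero ≉ 0#
          e0≉0 e0≈0 = e≉0 (all0 k₀)
            where
            y≈0 : y ≈ 0#
            y≈0 = nondegenerate θ-nonzero y∈ λ i → trans (fyγ i)
                (trans (-‿cong (trans (*-congʳ e0≈0) (zeroˡ _))) (solve 0 (:- :0 := :0) refl))
            all0 : ∀ k → e k ≈ 0#
            all0 zero    = e0≈0
            all0 (suc k) = independent-Λ (e ∘ suc) (λ k → proj₂ (e∈ (suc k))) y≈0 k

      coordinate-pairing : ∀ {x} {u : Fin r → ℕ → Carrier} → x ∈ M → (∀ i n → u i n ∈ Fp) →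
        IsSeries A π (λ n → ∑ (λ i → u i n * γ i)) x → ∀ j → ∃ λ h → h ∈ M × ∀ n → u j n ≈ coefficients h n
      coordinate-pairing {x} {u} x∈M u∈ ser j = h , M.mul (M.mul y∈M x∈M) (M.inv e≉0 e∈M) , λ n → (begin
          u j n                                                    ≡⟨ delay-+ N (u j) n ⟨
          delay N (u j) (N ℕ.+ n)                                  ≈⟨ digits-unique fp⊆A fp-unique value
                                                                        ((λ n → θ∈ _) , functional-series (π ^ N * h))
                                                                        (delay∈ N (u∈ j) , delay-series N
                                                                            (X-series j)) (N ℕ.+ n) ⟨
          coefficients (π ^ N * h) (N ℕ.+ n)                       ≈⟨ θ-cong (shift n) ⟩
          coefficients h n                                         ∎)
        where
        y = proj₁ (dual j)
        e = proj₁ (proj₂ (dual j))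
        facts = proj₂ (proj₂ (dual j))
        y∈M = proj₁ facts
        y∈A = proj₁ (proj₂ facts)
        e∈M = proj₁ (proj₂ (proj₂ facts))
        e≉0 = proj₁ (proj₂ (proj₂ (proj₂ facts)))
        e∈Λ = proj₁ (proj₂ (proj₂ (proj₂ (proj₂ facts))))
        fyγ = proj₂ (proj₂ (proj₂ (proj₂ (proj₂ facts))))
        X : Fin r → Carrier
        X i = proj₁ (complete (u i) (fp⊆A ∘ u∈ i))
        X-series : ∀ i → IsSeries A π (u i) (X i)
        X-series i = proj₂ (complete (u i) (fp⊆A ∘ u∈ i))
        x≈ : x ≈ ∑ (λ i → X i * γ i)
        x≈ = series-unique ser (series-cong (λ n → ∑-cong λ i → *-comm _ _) (∑-cong λ i → *-comm _ _)
          (series-∑ λ i → series-* (Γ.integral (γ∈ i)) (X-series i)))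
        h = y * x * e ⁻¹
        N = proj₁ (absorb h)
        fyx : functional (y * x) ≈ e * X j
        fyx = begin
          functional (y * x)
            ≈⟨ trans (functional-cong (trans (*-congˡ x≈) (*-∑ y (λ i → X i * γ i))))
                (functional-∑ (λ i → y * (X i * γ i))) ⟩
          ∑ (λ i → functional (y * (X i * γ i)))
            ≈⟨ ∑-cong (λ i → trans (functional-cong (solve 3 (λ y x g → y :* (x :* g) := y :* g :* x) refl y (X i) (γ i)))
                 (trans (functional-Λ (A.mul y∈A (Γ.integral (γ∈ i))) (series∈Λ (u∈ i) (X-series i))) (*-congʳ (fyγ i)))) ⟩
          ∑ (λ i → e * δ j i * X i)
            ≈⟨ trans (∑-cong λ i → *-assoc e (δ j i) (X i)) (sym (*-∑ e (λ i → δ j i * X i))) ⟩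
          e * ∑ (λ i → δ j i * X i)
            ≈⟨ *-congˡ (∑-δ j X) ⟩
          e * X j ∎
        value : functional (π ^ N * h) ≈ π ^ N * X j
        value = *-cancelˡ e≉0 (begin
          e * functional (π ^ N * h)
            ≈⟨ trans (*-comm _ _) (sym (functional-Λ (proj₂ (absorb h)) e∈Λ)) ⟩
          functional (π ^ N * h * e)
            ≈⟨ functional-cong (trans (solve 4 (λ P z i e → P :* (z :* i) :* e := e :* i :* (P :* z)) refl (π ^ N)
                (y * x) (e ⁻¹) e)
                 (trans (*-congʳ (⁻¹-inverseʳ e≉0)) (*-identityˡ _))) ⟩
          functional (π ^ N * (y * x))
            ≈⟨ trans (functional-π^ N (A.mul y∈A (series∈ ser))) (*-congˡ fyx) ⟩
          π ^ N * (e * X j)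
            ≈⟨ solve 3 (λ P e x → P :* (e :* x) := e :* (P :* x)) refl (π ^ N) e (X j) ⟩
          e * (π ^ N * X j) ∎)
        shift : ∀ n → π ^ N * h * (π ⁻¹) ^ suc (N ℕ.+ n) ≈ h * (π ⁻¹) ^ suc n
        shift n = begin
          π ^ N * h * (π ⁻¹) ^ suc (N ℕ.+ n)                  ≈⟨ *-congˡ
              (trans (^-congʳ (π ⁻¹) (≡.sym (ℕₚ.+-suc N n))) (^-homo-* (π ⁻¹) N (suc n))) ⟩
          π ^ N * h * ((π ⁻¹) ^ N * (π ⁻¹) ^ suc n)           ≈⟨ solve 4
              (λ P h I J → P :* h :* (I :* J) := P :* I :* (h :* J)) refl (π ^ N) h ((π ⁻¹) ^ N) ((π ⁻¹) ^ suc n) ⟩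
          π ^ N * (π ⁻¹) ^ N * (h * (π ⁻¹) ^ suc n)           ≈⟨ trans (*-congʳ (^-inverse N π≉0)) (*-identityˡ _) ⟩
          h * (π ⁻¹) ^ suc n                                  ∎

module Valuations {c ℓ : Level} (𝔽 : Field c ℓ) (_≟_ : ∀ a b → Dec (Field._≈_ 𝔽 a b)) (v : Valuation 𝔽) where
  open Field 𝔽 hiding (zero)
  open FieldTheory 𝔽 using (_^_; _·_; _^ℤ_; sum)
  open FieldLemmas 𝔽
  open Subrings 𝔽
  open Summation 𝔽
  open Adic 𝔽
  open Valuation v
  open ValuedField v
  open Supremum ℤ._≤_ using ([_]; _≤⊤⁺; [≤]-injective; ≤⁺-trans; ≤⁺-reflexive-≡)
  open IntegerSolver commutativeRing
  open RingProps ring using (-1*x≈-x)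
  open SemiringExp semiring using (^-homo-*)
  open SetoidReasoning setoid
  private
    module ℤᴳ = AbelianGroupProps ℤₚ.+-0-abelianGroup
    module ℤᴿ = RingProps ℤₚ.+-*-ring

  infix 4 _⊑_
  _⊑_ : ℤ → Carrier → Set
  n ⊑ a = [ n ] ≤∞ val a

  []-injective : ∀ {m n : ℤ} → _≡_ {A = ℤ∞} [ m ] [ n ] → m ≡ n
  []-injective ≡.refl = ≡.refl

  value : ∀ {a} → a ≉ 0# → ∃ λ k → val a ≡ [ k ]
  value {a} a≉0 with val a in eq
  ... | [ k ] = k , ≡.refl
  ... | ⊤⁺    = contradiction (Equivalence.to (val-∞ a) eq) a≉0

  nonzero : ∀ {a k} → val a ≡ [ k ] → a ≉ 0#
  nonzero {a} val≡ a≈0 with ≡.trans (≡.sym val≡) (Equivalence.from (val-∞ a) a≈0)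
  ... | ()

  ⊑-refl : ∀ {a k} → val a ≡ [ k ] → k ⊑ a
  ⊑-refl eq = ≤⁺-reflexive-≡ ℤₚ.≤-reflexive (≡.sym eq)

  ⊑-value : ∀ {a k n} → val a ≡ [ k ] → n ⊑ a → n ℤ.≤ k
  ⊑-value {n = n} eq n⊑a = [≤]-injective (≡.subst ([ n ] ≤∞_) eq n⊑a)

  ⊑-resp : ∀ {a b n} → a ≈ b → n ⊑ a → n ⊑ b
  ⊑-resp {n = n} a≈b = ≡.subst ([ n ] ≤∞_) (val-cong a≈b)

  ⊑-mono : ∀ {a m n} → m ℤ.≤ n → n ⊑ a → m ⊑ a
  ⊑-mono m≤n = ≤⁺-trans ℤₚ.≤-trans [ m≤n ]

  ⊑-zero : ∀ {a n} → a ≈ 0# → n ⊑ a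
  ⊑-zero {a} {n} a≈0 = ≡.subst ([ n ] ≤∞_) (≡.sym (Equivalence.from (val-∞ a) a≈0)) (_ ≤⊤⁺)

  ⊑-+ : ∀ {a b n} → n ⊑ a → n ⊑ b → n ⊑ a + b
  ⊑-+ {a} {b} n⊑a n⊑b = ≤⁺-trans ℤₚ.≤-trans (bound n⊑a n⊑b) (val-+ a b)
    where
    bound : ∀ {n x y} → [ n ] ≤∞ x → [ n ] ≤∞ y → [ n ] ≤∞ x ⊓∞ y
    bound [ p ]      [ q ]      = [ ℤₚ.⊓-glb p q ]
    bound [ p ]      (_ ≤⊤⁺)    = [ p ]
    bound (_ ≤⊤⁺)    [ q ]      = [ q ]
    bound (_ ≤⊤⁺)    (_ ≤⊤⁺)    = _ ≤⊤⁺

  ⊑-* : ∀ {a b m n} → m ⊑ a → n ⊑ b → m ℤ.+ n ⊑ a * b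
  ⊑-* {a} {b} {m} {n} m⊑a n⊑b = ≡.subst ([ m ℤ.+ n ] ≤∞_) (≡.sym (val-* a b)) (bound m⊑a n⊑b)
    where
    bound : ∀ {m n x y} → [ m ] ≤∞ x → [ n ] ≤∞ y → [ m ℤ.+ n ] ≤∞ x +∞ y
    bound [ p ]      [ q ]      = [ ℤₚ.+-mono-≤ p q ]
    bound [ p ]      (_ ≤⊤⁺)    = _ ≤⊤⁺
    bound (_ ≤⊤⁺)    [ q ]      = _ ≤⊤⁺
    bound (_ ≤⊤⁺)    (_ ≤⊤⁺)    = _ ≤⊤⁺

  val-*-finite : ∀ {a b j k} → val a ≡ [ j ] → val b ≡ [ k ] → val (a * b) ≡ [ j ℤ.+ k ]
  val-*-finite {a} {b} eq eq′ = ≡.trans (val-* a b) (≡.cong₂ _+∞_ eq eq′)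

  val-one : val 1# ≡ [ 0ℤ ]
  val-one = let k , eq = value 1≉0 in ≡.trans eq (≡.cong [_] (ℤᴿ.x+x≈x⇒x≈0 k
    ([]-injective (≡.trans (≡.sym (val-*-finite eq eq)) (≡.trans (val-cong (*-identityˡ 1#)) eq)))))

  val-neg-one : val (- 1#) ≡ [ 0ℤ ]
  val-neg-one = let k , eq = value -1≉0 in ≡.trans eq (≡.cong [_] (half k
    ([]-injective (≡.trans (≡.sym (val-*-finite eq eq)) (≡.trans (val-cong (solve 0 (:- :1 :* :- :1 := :1) refl))
        val-one)))))
    where
    -1≉0 : - 1# ≉ 0#
    -1≉0 eq = 1≉0 (trans (solve 0 (:1 := :- (:- :1)) refl) (trans (-‿cong eq) (solve 0 (:- :0 := :0) refl)))
    half : ∀ k → k ℤ.+ k ≡ 0ℤ → k ≡ 0ℤ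
    half (+ zero) _ = ≡.refl

  ⊑-neg : ∀ {a n} → n ⊑ a → n ⊑ - a
  ⊑-neg {a} {n} n⊑a = ⊑-resp (-1*x≈-x a) (≡.subst (_⊑ - 1# * a) (ℤₚ.+-identityˡ n) (⊑-* (⊑-refl val-neg-one) n⊑a))

  val-^ : ∀ {a k} n → val a ≡ [ k ] → val (a ^ n) ≡ [ + n ℤ.* k ]
  val-^ zero eq = val-one
  val-^ {k = k} (suc n) eq = ≡.trans (val-*-finite eq (val-^ n eq)) (≡.cong [_] (≡.sym (ℤₚ.suc-* (+ n) k)))

  val-⁻¹ : ∀ {a k} → val a ≡ [ k ] → val (a ⁻¹) ≡ [ ℤ.- k ]
  val-⁻¹ {a} {k} eq = let j , eq′ = value (⁻¹-nonzero (nonzero eq)) in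
    ≡.trans eq′ (≡.cong [_] (ℤᴳ.inverseʳ-unique k j ([]-injective
      (≡.trans (≡.sym (val-*-finite eq eq′)) (≡.trans (val-cong (⁻¹-inverseʳ (nonzero eq))) val-one)))))

  valuationRing-isSubring : IsSubring ValuationRing
  valuationRing-isSubring = record
    { resp = ⊑-resp ; one = ⊑-refl val-one ; add = ⊑-+ ; neg = ⊑-neg ; mul = ⊑-* }
  private module A = IsSubring valuationRing-isSubring

  i≤∣i∣ : ∀ i → i ℤ.≤ + ℤ.∣ i ∣
  i≤∣i∣ (+ n)    = ℤₚ.≤-refl
  i≤∣i∣ -[1+ n ] = ℤ.-≤+

  0≤∣i∣+i : ∀ i → 0ℤ ℤ.≤ + ℤ.∣ i ∣ ℤ.+ i
  0≤∣i∣+i (+ n)    = ℤ.+≤+ z≤n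
  0≤∣i∣+i -[1+ n ] = ℤₚ.≤-reflexive (≡.sym (ℤₚ.n⊖n≡0 (suc n)))

  module _ {π : Carrier} {d : ℕ} (val-π : val π ≡ [ + d ]) where

    val-π^ : ∀ N → val (π ^ N) ≡ [ + (N ℕ.* d) ]
    val-π^ N = ≡.trans (val-^ N val-π) (≡.cong [_] (≡.sym (ℤₚ.pos-* N d)))

    ideal⇒⊑ : ∀ {N y} → y ∈ Ideal ValuationRing π N → + (N ℕ.* d) ⊑ y
    ideal⇒⊑ {N} (r , r∈ , y≈) = ⊑-resp (sym y≈) (≡.subst (_⊑ π ^ N * r) (ℤₚ.+-identityʳ _) (⊑-* (⊑-refl (val-π^ N)) r∈))

    ⊑⇒ideal : ∀ {N y} → + (N ℕ.* d) ⊑ y → y ∈ Ideal ValuationRing π N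
    ⊑⇒ideal {N} {y} ⊑y = (π ^ N) ⁻¹ * y ,
      ≡.subst (_⊑ (π ^ N) ⁻¹ * y) (ℤₚ.+-inverseˡ (+ (N ℕ.* d))) (⊑-* (⊑-refl (val-⁻¹ (val-π^ N))) ⊑y) ,
      sym (cancel-⁻¹ y (nonzero (val-π^ N)))

    module _ (d≥1 : 1 ℕ.≤ d) (complete : Complete) where
      private
        N≤N*d : ∀ N → N ℕ.≤ N ℕ.* d
        N≤N*d N = ℕₚ.≤-trans (ℕₚ.≤-reflexive (≡.sym (ℕₚ.*-identityʳ N))) (ℕₚ.*-monoʳ-≤ N d≥1)

        k≤∣k∣*d : ∀ k → k ℤ.≤ + (ℤ.∣ k ∣ ℕ.* d)
        k≤∣k∣*d k = ℤₚ.≤-trans (i≤∣i∣ k) (ℤ.+≤+ (N≤N*d ℤ.∣ k ∣))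

        π∈A : π ∈ ValuationRing
        π∈A = ⊑-mono (ℤ.+≤+ z≤n) (⊑-refl val-π)

      ideal-separated : ∀ {y} → (∀ N → y ∈ Ideal ValuationRing π N) → y ≈ 0#
      ideal-separated {y} y∈ = Dec.decidable-stable (y ≟ 0#) λ y≉0 →
        let k , eq = value y≉0
            N = suc ℤ.∣ k ∣
            Nd≤k = ⊑-value eq (ideal⇒⊑ {N} (y∈ N))
        in ℕₚ.1+n≰n (ℕₚ.≤-trans (N≤N*d N) (ℤₚ.drop‿+≤+ (ℤₚ.≤-trans Nd≤k (i≤∣i∣ k))))

      absorbed : ∀ y → ∃ λ N → π ^ N * y ∈ ValuationRing
      absorbed y with y ≟ 0#
      ... | yes y≈0 = 0 , ⊑-zero (trans (*-congˡ y≈0) (zeroʳ _))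
      ... | no  y≉0 = let k , eq = value y≉0 in ℤ.∣ k ∣ ,
        ⊑-mono (ℤₚ.≤-trans (0≤∣i∣+i k) (ℤₚ.+-monoˡ-≤ k (ℤ.+≤+ (N≤N*d ℤ.∣ k ∣))))
          (⊑-* (⊑-refl (val-π^ ℤ.∣ k ∣)) (⊑-refl eq))

      partial-split : ∀ s N k → partial π s (N ℕ.+ k) ≈ partial π s N + π ^ N * partial π (λ n → s (N ℕ.+ n)) k
      partial-split s zero    k = sym (trans (+-identityˡ _) (*-identityˡ _))
      partial-split s (suc N) k = trans (+-congˡ (*-congˡ (partial-split (s ∘ suc) N k)))
        (solve 5 (λ a p P q r → a :+ p :* (P :+ q :* r) := (a :+ p :* P) :+ p :* q :* r) refl (s 0) π _ (π ^ N) _)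

      partial∈ : ∀ {s} N → (∀ n → s n ∈ ValuationRing) → partial π s N ∈ ValuationRing
      partial∈ zero    s∈ = A.zer
      partial∈ (suc N) s∈ = A.add (s∈ 0) (A.mul π∈A (partial∈ N (s∈ ∘ suc)))

      partial-close : ∀ {s} N i → (∀ n → s n ∈ ValuationRing) → N ℕ.≤ i → partial π s i - partial π s N ∈ Ideal
          ValuationRing π N
      partial-close {s} N i s∈ N≤i with ℕₚ.m≤n⇒∃[o]m+o≡n N≤i
      ... | k , ≡.refl = _ , partial∈ k (λ n → s∈ (N ℕ.+ n)) ,
        trans (+-congʳ (partial-split s N k)) (solve 2 (λ P z → (P :+ z) :- P := z) refl (partial π s N) _)

      series-exists : ∀ s → (∀ n → s n ∈ ValuationRing) → ∃ (IsSeries ValuationRing π s)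
      series-exists s s∈ = y , λ N → let r , r∈ , eq = remainder N in
        r , r∈ , trans (solve 2 (λ P z → z := P :+ (z :- P)) refl (partial π s N) y) (+-congˡ eq)
        where
        close : ∀ N i → N ℕ.≤ i → + (N ℕ.* d) ⊑ partial π s i - partial π s N
        close N i N≤i = ideal⇒⊑ {N} (partial-close N i s∈ N≤i)
        cauchy : Cauchy (partial π s)
        cauchy n = N , λ i j N≤i N≤j → ⊑-mono (k≤∣k∣*d n) (⊑-resp
          (solve 3 (λ a b e → (a :- e) :+ :- (b :- e) := a :- b) refl (partial π s i) (partial π s j) (partial π s N))
          (⊑-+ (close N i N≤i) (⊑-neg (close N j N≤j))))
          where N = ℤ.∣ n ∣
        limit = complete (partial π s) cauchy
        y = proj₁ limit
        remainder : ∀ N → y - partial π s N ∈ Ideal ValuationRing π N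
        remainder N = let M , near = proj₂ limit (+ (N ℕ.* d))
                          i = M ℕ.⊔ N
          in ⊑⇒ideal {N} (⊑-resp (solve 3 (λ a y b → :- (a :- y) :+ (a :- b) := y :- b) refl (partial π s i) y
              (partial π s N))
               (⊑-+ (⊑-neg (near i (ℕₚ.m≤m⊔n M N))) (close N i (ℕₚ.m≤n⊔m M N))))

      adic : IsAdic ValuationRing π
      adic = record
        { isSubring = valuationRing-isSubring
        ; π∈        = π∈A
        ; π≉0       = nonzero val-π
        ; separated = ideal-separated
        ; absorb    = absorbed
        ; complete  = series-exists
        }

      converges-unique : ∀ {s x y} → ConvergesTo s x → ConvergesTo s y → x ≈ y
      converges-unique {s} {x} {y} →x →y = x-y≈0⇒x≈y (ideal-separated λ N →
        let M , near = →x (+ (N ℕ.* d)) ; M′ , near′ = →y (+ (N ℕ.* d)) ; i = M ℕ.⊔ M′ in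
        ⊑⇒ideal {N} (⊑-resp (solve 3 (λ s x y → :- (s :- x) :+ (s :- y) := x :- y) refl (s i) x y)
          (⊑-+ (⊑-neg (near i (ℕₚ.m≤m⊔n M M′))) (near′ i (ℕₚ.m≤n⊔m M M′)))))

      private
        π≉0 : π ≉ 0#
        π≉0 = nonzero val-π

      π^ℤ-⊖ : ∀ i j → π ^ℤ (i ⊖ j) ≈ π ^ i * (π ⁻¹) ^ j
      π^ℤ-⊖ i       zero    = sym (*-identityʳ _)
      π^ℤ-⊖ zero    (suc j) = sym (*-identityˡ _)
      π^ℤ-⊖ (suc i) (suc j) = begin
        π ^ℤ (suc i ⊖ suc j)                   ≡⟨ ≡.cong (π ^ℤ_) (ℤₚ.[1+m]⊖[1+n]≡m⊖n i j) ⟩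
        π ^ℤ (i ⊖ j)                           ≈⟨ π^ℤ-⊖ i j ⟩
        π ^ i * (π ⁻¹) ^ j                     ≈⟨ trans (*-congʳ (⁻¹-inverseʳ π≉0)) (*-identityˡ _) ⟨
        π * π ⁻¹ * (π ^ i * (π ⁻¹) ^ j)        ≈⟨ solve 4 (λ a b x y → a :* b :* (x :* y) := a :* x :* (b :* y)) refl
            π (π ⁻¹) (π ^ i) ((π ⁻¹) ^ j) ⟩
        π ^ suc i * (π ⁻¹) ^ suc j             ∎

      π^ℤ-+ : ∀ m k → π ^ℤ (m ℤ.+ + k) ≈ π ^ℤ m * π ^ k
      π^ℤ-+ (+ i)    k = ^-homo-* π i k
      π^ℤ-+ -[1+ j ] k = trans (π^ℤ-⊖ k (suc j)) (*-comm _ _)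

      π^ℤ-nonzero : ∀ m → π ^ℤ m ≉ 0#
      π^ℤ-nonzero (+ n)    = ^-nonzero n π≉0
      π^ℤ-nonzero -[1+ n ] = ^-nonzero (suc n) (⁻¹-nonzero π≉0)

      shifted-partial : ∀ m a N → sum {N} (λ i → a (toℕ i) * π ^ℤ (m ℤ.+ + toℕ i)) ≈ π ^ℤ m * partial π a N
      shifted-partial m a N = begin
        sum {N} (λ i → a (toℕ i) * π ^ℤ (m ℤ.+ + toℕ i))       ≡⟨ ≡.sym
            (∑≡sum {N} (λ i → a (toℕ i) * π ^ℤ (m ℤ.+ + toℕ i))) ⟩
        ∑ {N} (λ i → a (toℕ i) * π ^ℤ (m ℤ.+ + toℕ i))         ≈⟨ ∑-cong (λ i → trans (*-congˡ (π^ℤ-+ m (toℕ i)))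
                                                                     (solve 3 (λ a u b → a :* (u :* b) := u :*
                                                                         (b :* a)) refl (a (toℕ i)) (π ^ℤ m) (π ^ toℕ i))) ⟩
        ∑ {N} (λ i → π ^ℤ m * (π ^ toℕ i * a (toℕ i)))         ≈⟨ *-∑ (π ^ℤ m) (λ i → π ^ toℕ i * a (toℕ i)) ⟨
        π ^ℤ m * ∑ {N} (λ i → π ^ toℕ i * a (toℕ i))           ≈⟨ *-congˡ (partial≈∑ π a N) ⟨
        π ^ℤ m * partial π a N                                 ∎

      converges-series : ∀ {a y} m → IsSeries ValuationRing π a y →
                         ConvergesTo (λ N → sum {N} (λ i → a (toℕ i) * π ^ℤ (m ℤ.+ + toℕ i))) (π ^ℤ m * y)
      converges-series {a} {y} m ser n = ℤ.∣ n ℤ.- k ∣ , λ i N≤i → let r , r∈ , eq = ser i in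
          ⊑-resp (sym (begin
            sum {i} (λ i → a (toℕ i) * π ^ℤ (m ℤ.+ + toℕ i)) - π ^ℤ m * y
              ≈⟨ +-cong (shifted-partial m a i) (-‿cong (*-congˡ eq)) ⟩
            π ^ℤ m * partial π a i - π ^ℤ m * (partial π a i + π ^ i * r)
              ≈⟨ solve 4 (λ u P q r → u :* P :- u :* (P :+ q :* r) := u :* (q :* :- r)) refl (π ^ℤ m) (partial π a i)
                  (π ^ i) r ⟩
            π ^ℤ m * (π ^ i * - r) ∎))
          (⊑-mono (bound i N≤i) (⊑-* (⊑-refl val-u) (ideal⇒⊑ {i} (- r , A.neg r∈ , refl))))
        where
        k = proj₁ (value (π^ℤ-nonzero m))
        val-u : val (π ^ℤ m) ≡ [ k ]
        val-u = proj₂ (value (π^ℤ-nonzero m))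
        bound : ∀ i → ℤ.∣ n ℤ.- k ∣ ℕ.≤ i → n ℤ.≤ k ℤ.+ + (i ℕ.* d)
        bound i N≤i = ℤₚ.≤-trans (ℤₚ.≤-reflexive (≡.trans (≡.sym (ℤᴳ.xyx⁻¹≈y k n)) (ℤₚ.+-assoc k n (ℤ.- k))))
          (ℤₚ.+-monoʳ-≤ k (ℤₚ.≤-trans (i≤∣i∣ (n ℤ.- k)) (ℤ.+≤+ (ℕₚ.≤-trans N≤i (N≤N*d i)))))

      expansion⇒series : ∀ {g} {Γ : Pred Carrier g} {x m a} → Γ ⊆ ValuationRing → IsExpansion Γ π x m a →
                         ∃ λ y → IsSeries ValuationRing π a y × x ≈ π ^ℤ m * y
      expansion⇒series {m = m} {a} Γ⊆A (a∈ , →x) = let y , ser = series-exists a (Γ⊆A ∘ a∈) in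
        y , ser , converges-unique →x (converges-series m ser)

      completeRepresentatives⇒digits : ∀ {g} {Γ : Pred Carrier g} → IsCompleteRepresentatives Γ π → AdditivelyClosed Γ →
        ∀ {p} → p · 1# ≈ 0# → .{{NonZero p}} → IsDigits ValuationRing π Γ
      completeRepresentatives⇒digits {Γ = Γ} reps closed {suc p} char = record
        { resp     = respects
        ; integral = integral
        ; exists   = λ {y} y∈ → let γ , γ∈ , r , r∈ , eq = exists y y∈ in
            γ , r , γ∈ , r∈ , trans (solve 2 (λ y g → y := g :+ (y :- g)) refl y γ) (+-congˡ eq)
        ; unique   = λ {γ} {δ} {r} γ∈ δ∈ r∈ eq → unique γ∈ δ∈ (r , r∈ ,
            trans (+-congʳ eq) (solve 2 (λ d z → (d :+ z) :- d := z) refl δ (π * r)))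
        ; add      = closed
        ; zer      = let γ , γ∈ , _ = exists 1# A.one in respects
                             (trans (sym (trans (SemiringMult.×-assoc-* semiring (suc p) 1# γ)
            (SemiringMult.×-congʳ semiring (suc p) (*-identityˡ γ)))) (trans (*-congʳ char) (zeroˡ γ))) (multiple p γ∈)
        }
        where
        open IsCompleteRepresentatives reps
        multiple : ∀ n {γ} → γ ∈ Γ → suc n · γ ∈ Γ
        multiple zero    γ∈ = respects (sym (+-identityʳ _)) γ∈
        multiple (suc n) γ∈ = closed γ∈ (multiple n γ∈)

FiniteQuotient : ∀ {c ℓ a} (𝔽 : Field c ℓ) → Pred (Field.Carrier 𝔽) a → Field.Carrier 𝔽 → Set (c ⊔ ℓ ⊔ a)
FiniteQuotient 𝔽 A π = ∃ λ (xs : List Carrier) → ∀ y → y ∈ A → Any (λ x → ∃ λ r → r ∈ A × y ≈ x + π * r) xs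
  where open Field 𝔽

module FiniteDigits {c ℓ : Level} (𝔽 : Field c ℓ) (em : ExcludedMiddle (c ⊔ ℓ)) (_≟_ : ∀ a b → Dec (Field._≈_ 𝔽 a b))
                    {q : ℕ} (pr : Prime (suc q))
                    (char : Field._≈_ 𝔽 (FieldTheory._·_ 𝔽 (suc q) (Field.1# 𝔽)) (Field.0# 𝔽)) where
  open Field 𝔽 hiding (zero)
  open FieldTheory 𝔽 using (_·_)
  open FieldLemmas 𝔽
  open Subrings 𝔽
  open Summation 𝔽
  open Spans 𝔽 _≟_
  open Adic 𝔽
  open PrimeSubfield 𝔽 pr char
  open IntegerSolver commutativeRing
  open SetoidReasoning setoid
  private
    module Fp = IsSubfield Fp-isSubfield
    isFp = Fp.isSubring

  Enumeration : ∀ {g} → Pred Carrier g → Set (c ⊔ ℓ ⊔ g)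
  Enumeration Γ = ∃₂ λ n (e : Fin n → Carrier) → (∀ i → e i ∈ Γ) × (∀ x → x ∈ Γ → ∃ λ i → x ≈ e i)

  enumerate-digits : ∀ {a g} {A : Pred Carrier a} {π : Carrier} {Γ : Pred Carrier g} → IsSubring A → IsDigits A π Γ →
    (∀ x → Dec (∃₂ λ γ r → γ ∈ Γ × r ∈ A × γ ≈ x + π * r)) → FiniteQuotient 𝔽 A π → Enumeration Γ
  enumerate-digits {A = A} {π} {Γ} isA digits hit? (xs , cover) =
    let ys , ys∈ , complete = go xs in length ys , List.lookup ys , ys∈ , λ γ γ∈ →
      let any = complete γ γ∈ (cover γ (IsDigits.integral digits γ∈)) in Any.index any , Anyₚ.lookup-index any
    where
    module A = IsSubring isA
    go : ∀ xs → ∃ λ ys → (∀ i → List.lookup ys i ∈ Γ) ×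
         (∀ γ → γ ∈ Γ → Any (λ x → ∃ λ r → r ∈ A × γ ≈ x + π * r) xs → Any (γ ≈_) ys)
    go []       = [] , (λ ()) , (λ _ _ ())
    go (x ∷ xs) with hit? x | go xs
    ... | no ¬hit | ys , ys∈ , complete = ys , ys∈ , λ
      { γ γ∈ (here (r , r∈ , eq)) → contradiction (γ , r , γ∈ , r∈ , eq) ¬hit ; γ γ∈ (there any) → complete γ γ∈ any }
    ... | yes (δ , s , δ∈ , s∈ , eq′) | ys , ys∈ , complete = δ ∷ ys , (λ { zero → δ∈ ; (suc i) → ys∈ i }) , λ
      { γ γ∈ (here (r , r∈ , eq)) → here (IsDigits.unique digits γ∈ δ∈ (A.add r∈ (A.neg s∈))
          (trans eq (trans (solve 4 (λ x p r s → x :+ p :* r := (x :+ p :* s) :+ p :* (r :- s)) refl x π r s)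
              (+-congʳ (sym eq′)))))
      ; γ γ∈ (there any) → there (complete γ γ∈ any) }

  Fp-basis : ∀ {g} {Γ : Pred Carrier g} → Enumeration Γ →
    ∃₂ λ r (d : Fin r → Carrier) → (∀ i → d i ∈ Γ) × Independent Fp d × Γ ⊆ Span Fp d
  Fp-basis {Γ = Γ} (n , e , e∈ , complete) =
    let r , d , independent , d⊆e , e⊆d = basis Fp-isSubfield (λ _ → em) n e in
    r , d , (λ i → ≡.subst Γ (≡.sym (proj₂ (d⊆e i))) (e∈ (proj₁ (d⊆e i)))) , independent ,
    λ {x} x∈ → let i , x≈ = complete x x∈ in span-resp isFp (sym x≈) (e⊆d (span-gen isFp i))

  module Coordinates {r : ℕ} {d : Fin r → Carrier} (independent : Independent Fp d) (j : Fin r) where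

    private
      from : ∀ {x} → Dec (x ∈ Span Fp d) → Carrier
      from (yes (f , _)) = f j
      from (no _)        = 0#

    abstract
      -- 0 outside the span of d.
      coordinate : Carrier → Carrier
      coordinate x = from {x} em

      coordinate∈ : ∀ x → coordinate x ∈ Fp
      coordinate∈ x = helper em
        where
        helper : ∀ {x} (dec : Dec (x ∈ Span Fp d)) → from dec ∈ Fp
        helper (yes (f , f∈ , _)) = f∈ j
        helper (no _)             = Fp.zer

      coordinate-combination : ∀ {x} (f : Fin r → Carrier) → (∀ i → f i ∈ Fp) → x ≈ ∑ (λ i → f i * d i) → coordinate x ≈ f j
      coordinate-combination {x} f f∈ x≈ = helper em
        where
        helper : (dec : Dec (x ∈ Span Fp d)) → from dec ≈ f j
        helper (no x∉)              = contradiction (f , f∈ , x≈) x∉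
        helper (yes (g , g∈ , x≈′)) = x-y≈0⇒x≈y (independent (λ i → g i - f i) (λ i → Fp.add (g∈ i) (Fp.neg (f∈ i))) (begin
          ∑ (λ i → (g i - f i) * d i)                         ≈⟨ ∑-cong
              (λ i → solve 3 (λ x y e → (x :- y) :* e := x :* e :+ :- (y :* e)) refl (g i) (f i) (d i)) ⟩
          ∑ (λ i → g i * d i + - (f i * d i))                 ≈⟨ trans (∑-+ (λ i → g i * d i) (λ i → - (f i * d i)))
              (+-congˡ (∑-neg (λ i → f i * d i))) ⟩
          ∑ (λ i → g i * d i) - ∑ (λ i → f i * d i)           ≈⟨ +-cong (sym x≈′) (-‿cong (sym x≈)) ⟩
          x - x                                               ≈⟨ -‿inverseʳ x ⟩
          0#                                                  ∎) j)

      coordinate-outside : ∀ {x} → ¬ (x ∈ Span Fp d) → coordinate x ≈ 0#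
      coordinate-outside {x} x∉ = helper em
        where
        helper : (dec : Dec (x ∈ Span Fp d)) → from dec ≈ 0#
        helper (yes x∈) = contradiction x∈ x∉
        helper (no _)   = refl

    coordinate-cong : ∀ {x y} → x ≈ y → coordinate x ≈ coordinate y
    coordinate-cong {x} {y} x≈y = helper em
      where
      helper : Dec (x ∈ Span Fp d) → coordinate x ≈ coordinate y
      helper (yes (f , f∈ , x≈)) = trans (coordinate-combination f f∈ x≈)
          (sym (coordinate-combination f f∈ (trans (sym x≈y) x≈)))
      helper (no x∉)             = trans (coordinate-outside x∉) (sym (coordinate-outside (x∉ ∘ span-resp isFp (sym x≈y))))

    coordinate-+ : ∀ {x y} → x ∈ Span Fp d → y ∈ Span Fp d → coordinate (x + y) ≈ coordinate x + coordinate y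
    coordinate-+ (f , f∈ , x≈) (g , g∈ , y≈) = trans
      (coordinate-combination (λ i → f i + g i) (λ i → Fp.add (f∈ i) (g∈ i))
        (trans (+-cong x≈ y≈) (trans (sym (∑-+ _ _)) (∑-cong λ i → sym (distribʳ (d i) (f i) (g i))))))
      (+-cong (sym (coordinate-combination f f∈ x≈)) (sym (coordinate-combination g g∈ y≈)))

    coordinate-basis : coordinate (d j) ≈ 1#
    coordinate-basis = trans (coordinate-combination (δ j) (δ∈ isFp j) (sym (∑-δ j d))) (δ-diagonal j)

module Teichmueller {c ℓ : Level} (𝔽 : Field c ℓ) (_≟_ : ∀ a b → Dec (Field._≈_ 𝔽 a b)) {q : ℕ} (pr : Prime (suc q))
                    (char : Field._≈_ 𝔽 (FieldTheory._·_ 𝔽 (suc q) (Field.1# 𝔽)) (Field.0# 𝔽))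
                    (v : Valuation 𝔽) (complete : ValuedField.Complete v)
                    {t : Field.Carrier 𝔽} (val-t : Valuation.val v t ≡ [ + 1 ])
                    (finite : FiniteQuotient 𝔽 (ValuedField.ValuationRing v) t) where
  open Field 𝔽 hiding (zero)
  open FieldTheory 𝔽 using (_^_; _·_)
  open FieldLemmas 𝔽
  open Subrings 𝔽
  open Adic 𝔽
  open PrimeSubfield 𝔽 pr char
  open Valuation v
  open ValuedField v
  open Valuations 𝔽 _≟_ v
  open Cartier 𝔽 _≟_ pr char using (IsUniformizer)
  open IntegerSolver commutativeRing
  open SemiringExp semiring using (^-congˡ)
  open SetoidReasoning setoid
  private
    module A = IsSubring valuationRing-isSubring
    p : ℕ
    p = suc q

  t-adic : IsAdic ValuationRing t
  t-adic = adic val-t (s≤s z≤n) complete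

  frobenius-+ : ∀ i x y → frobenius i (x + y) ≈ frobenius i x + frobenius i y
  frobenius-+ zero    x y = refl
  frobenius-+ (suc i) x y = trans (^-congˡ p (frobenius-+ i x y)) (^p-homo-+ _ _)

  frobenius-neg : ∀ i x → frobenius i (- x) ≈ - frobenius i x
  frobenius-neg zero    x = refl
  frobenius-neg (suc i) x = trans (^-congˡ p (frobenius-neg i x)) (^p-homo-- _)

  frobenius-sub : ∀ i x y → frobenius i (x - y) ≈ frobenius i x - frobenius i y
  frobenius-sub i x y = trans (frobenius-+ i x (- y)) (+-congˡ (frobenius-neg i y))

  frobenius-∘ : ∀ i j x → frobenius (i ℕ.+ j) x ≡ frobenius i (frobenius j x)
  frobenius-∘ zero    j x = ≡.refl
  frobenius-∘ (suc i) j x = ≡.cong (_^ p) (frobenius-∘ i j x)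

  frobenius∈ : ∀ i {x} → x ∈ ValuationRing → frobenius i x ∈ ValuationRing
  frobenius∈ zero    x∈ = x∈
  frobenius∈ (suc i) x∈ = A.pow p (frobenius∈ i x∈)

  ⊑-^p : ∀ {n x} → + n ⊑ x → + n ⊑ x ^ p
  ⊑-^p {n} {x} n⊑x = ≡.subst (_⊑ x ^ p) (ℤₚ.+-identityʳ (+ n)) (⊑-* n⊑x (A.pow q (⊑-mono (ℤ.+≤+ z≤n) n⊑x)))

  ⊑-frobenius : ∀ i {n x} → + n ⊑ x → + n ⊑ frobenius i x
  ⊑-frobenius zero    n⊑x = n⊑x
  ⊑-frobenius (suc i) {n} {x} n⊑x = ⊑-^p {n} {frobenius i x} (⊑-frobenius i n⊑x)

  ⊑-frobenius-improves : ∀ i {x} → + 1 ⊑ x → + suc i ⊑ frobenius i x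
  ⊑-frobenius-improves zero    1⊑x = 1⊑x
  ⊑-frobenius-improves (suc i) {x} 1⊑x = ⊑-mono (ℤ.+≤+ (ℕₚ.≤-trans (ℕₚ.≤-reflexive (ℕₚ.+-comm 1 (suc i)))
      (ℕₚ.+-monoʳ-≤ (suc i) (s≤s z≤n))))
    (⊑-* ih (improve (ℕₚ.≤-pred 1<p)))
    where
    ih : + suc i ⊑ frobenius i x
    ih = ⊑-frobenius-improves i 1⊑x
    improve : ∀ {m} → 1 ℕ.≤ m → + suc i ⊑ frobenius i x ^ m
    improve {suc m} _ = ≡.subst (_⊑ frobenius i x ^ suc m) (ℤₚ.+-identityʳ (+ suc i))
        (⊑-* ih (A.pow m (⊑-mono (ℤ.+≤+ z≤n) ih)))

  radical : ∀ {y} → y ^ p ∈ Ideal ValuationRing t 1 → y ∈ Ideal ValuationRing t 1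
  radical {y} yᵖ∈ with y ≟ 0#
  ... | yes y≈0 = 0# , A.zer , trans y≈0 (sym (zeroʳ _))
  ... | no  y≉0 = ⊑⇒ideal val-t {1} (positive (proj₁ (value y≉0)) (proj₂ (value y≉0)))
    where
    positive : ∀ k → val y ≡ [ k ] → + 1 ⊑ y
    positive (+ suc k)  eq = ⊑-mono (ℤ.+≤+ (s≤s z≤n)) (⊑-refl eq)
    positive (+ zero)   eq = contradiction (⊑-value (val-^ p eq) (ideal⇒⊑ val-t {1} yᵖ∈))
      λ 1≤ → contradiction (≡.subst (+ 1 ℤ.≤_) (ℤₚ.*-zeroʳ (+ p)) 1≤) λ { (ℤ.+≤+ ()) }
    positive -[1+ k ]   eq = contradiction (⊑-value (val-^ p eq) (ideal⇒⊑ val-t {1} yᵖ∈)) λ ()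

  radical-frobenius : ∀ i {y} → + 1 ⊑ frobenius i y → + 1 ⊑ y
  radical-frobenius zero    1⊑ = 1⊑
  radical-frobenius (suc i) 1⊑ = radical-frobenius i (ideal⇒⊑ val-t {1} (radical (⊑⇒ideal val-t {1} 1⊑)))

  private
    L : ℕ
    L = length (proj₁ finite)

  -- By the pigeonhole principle some power of Frobenius fixes the class of y; L! is a common multiple of the periods.
  period-of : ∀ {y} → y ∈ ValuationRing → ∃ λ o → 1 ℕ.≤ o × o ℕ.≤ L × + 1 ⊑ frobenius o y - y
  period-of {y} y∈ = o , ℕₚ.m<n⇒0<n∸m i<j , ℕₚ.≤-trans (ℕₚ.m∸n≤m (toℕ j) (toℕ i)) (ℕₚ.≤-pred (Finₚ.toℕ<n j)) ,
      radical-frobenius (toℕ i) (⊑-resp (sym difference)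
        (⊑-+ (ideal⇒⊑ val-t {1} (proj₁ (rest j) , proj₁ (proj₂ (rest j)) , sym (*-congʳ (*-identityʳ t))))
             (⊑-neg (ideal⇒⊑ val-t {1} (proj₁ (rest i) , proj₁ (proj₂ (rest i)) , sym (*-congʳ (*-identityʳ t)))))))
    where
    class : ∀ (k : Fin (suc L)) → Any (λ x → ∃ λ r → r ∈ ValuationRing × frobenius (toℕ k) y ≈ x + t * r) (proj₁ finite)
    class k = proj₂ finite _ (frobenius∈ (toℕ k) y∈)
    collision : ∃₂ λ i j → i Fin.< j × Any.index (class i) ≡ Any.index (class j)
    collision = Finₚ.pigeonhole (ℕₚ.n<1+n L) (λ k → Any.index (class k))
    i = proj₁ collision
    j = proj₁ (proj₂ collision)
    i<j = proj₁ (proj₂ (proj₂ collision))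
    o = toℕ j ℕ.∸ toℕ i
    rest : ∀ k → ∃ λ r → r ∈ ValuationRing × frobenius (toℕ k) y ≈ List.lookup (proj₁ finite) (Any.index (class k)) + t * r
    rest k = Anyₚ.lookup-index (class k)
    x = List.lookup (proj₁ finite) (Any.index (class j))
    difference : frobenius (toℕ i) (frobenius o y - y) ≈ t * proj₁ (rest j) + - (t * proj₁ (rest i))
    difference = begin
      frobenius (toℕ i) (frobenius o y - y)
        ≈⟨ frobenius-sub (toℕ i) (frobenius o y) y ⟩
      frobenius (toℕ i) (frobenius o y) - frobenius (toℕ i) y
        ≡⟨ ≡.cong (_- frobenius (toℕ i) y) (≡.trans (≡.sym (frobenius-∘ (toℕ i) o y))
            (≡.cong (λ k → frobenius k y) (ℕₚ.m+[n∸m]≡n (ℕₚ.<⇒≤ i<j)))) ⟩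
      frobenius (toℕ j) y - frobenius (toℕ i) y
        ≈⟨ +-cong (proj₂ (proj₂ (rest j))) (-‿cong (trans (proj₂ (proj₂ (rest i)))
            (+-congʳ (reflexive (≡.cong (List.lookup (proj₁ finite)) (proj₂ (proj₂ (proj₂ collision)))))))) ⟩
      (x + t * proj₁ (rest j)) - (x + t * proj₁ (rest i))
        ≈⟨ solve 3 (λ x a b → (x :+ a) :- (x :+ b) := a :+ :- b) refl x (t * proj₁ (rest j)) (t * proj₁ (rest i)) ⟩
      t * proj₁ (rest j) + - (t * proj₁ (rest i)) ∎

  periodic-multiple : ∀ {o y} → + 1 ⊑ frobenius o y - y → ∀ k → + 1 ⊑ frobenius (k ℕ.* o) y - y
  periodic-multiple {o} {y} 1⊑ zero    = ⊑-zero (-‿inverseʳ y)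
  periodic-multiple {o} {y} 1⊑ (suc k) = ⊑-resp (begin
      frobenius o (frobenius (k ℕ.* o) y - y) + (frobenius o y - y)
        ≈⟨ +-congʳ (frobenius-sub o (frobenius (k ℕ.* o) y) y) ⟩
      (frobenius o (frobenius (k ℕ.* o) y) - frobenius o y) + (frobenius o y - y)
        ≈⟨ solve 3 (λ a b y → (a :- b) :+ (b :- y) := a :- y) refl (frobenius o (frobenius (k ℕ.* o) y)) (frobenius o y) y ⟩
      frobenius o (frobenius (k ℕ.* o) y) - y
        ≡⟨ ≡.cong (_- y) (≡.sym (frobenius-∘ o (k ℕ.* o) y)) ⟩
      frobenius (suc k ℕ.* o) y - y ∎)
    (⊑-+ (⊑-frobenius o {1} (periodic-multiple {o} 1⊑ k)) 1⊑)

  abstract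
    period : ℕ
    period = L ! ℕ.∸ 1

    suc-period : suc period ≡ L !
    suc-period = ℕₚ.m+[n∸m]≡n (ℕₚ.1≤n! L)

  n∣m! : ∀ {m n} → 1 ℕ.≤ n → n ℕ.≤ m → n ∣ m !
  n∣m! {n = suc n} _ n≤m = ∣-trans (m∣m*n (n !)) (m≤n⇒m!∣n! n≤m)

  periodic-mod : ∀ {y} → y ∈ ValuationRing → + 1 ⊑ frobenius (suc period) y - y
  periodic-mod {y} y∈ = multiple (period-of y∈)
    where
    multiple : (∃ λ o → 1 ℕ.≤ o × o ℕ.≤ L × + 1 ⊑ frobenius o y - y) → + 1 ⊑ frobenius (suc period) y - y
    multiple (o , 1≤o , o≤L , 1⊑) = let k = _∣_.quotient (n∣m! 1≤o o≤L) in
      ≡.subst (λ n → + 1 ⊑ frobenius n y - y)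
        (≡.sym (≡.trans suc-period (_∣_.equality (n∣m! 1≤o o≤L)))) (periodic-multiple {o} 1⊑ k)

  κ : Pred Carrier ℓ
  κ u = frobenius (suc period) u ≈ u

  κ-value : ∀ {u k} → u ∈ κ → val u ≡ [ k ] → k ≡ 0ℤ
  κ-value {u} {k} u∈ eq with k ℤₚ.≟ 0ℤ
  ... | yes k≡0 = k≡0
  ... | no  k≢0 = contradiction (ℤₚ.+-injective 1≡n) (ℕₚ.<⇒≢ 1<n)
    where
    n = p ℕ.^ suc period
    1<n : 1 ℕ.< n
    1<n = ℕₚ.^-monoʳ-< p 1<p {0} {suc period} (s≤s z≤n)
    scaled : + n ℤ.* k ≡ k
    scaled = []-injective (≡.trans (≡.sym (val-^ n eq))
      (≡.trans (val-cong (trans (sym (frobenius≈^ (suc period) u)) u∈)) eq))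
    instance
      k-nonZero : ℤ.NonZero k
      k-nonZero = ℤ.≢-nonZero k≢0
    1≡n : + 1 ≡ + n
    1≡n = ℤₚ.*-cancelˡ-≡ k (+ 1) (+ n) (≡.trans (ℤₚ.*-identityʳ k) (≡.trans (≡.sym scaled) (ℤₚ.*-comm (+ n) k)))

  κ-integral : κ ⊆ ValuationRing
  κ-integral {u} u∈ with u ≟ 0#
  ... | yes u≈0 = ⊑-zero u≈0
  ... | no  u≉0 = let k , eq = value u≉0 in ⊑-mono (ℤₚ.≤-reflexive (≡.sym (κ-value u∈ eq))) (⊑-refl eq)

  κ-resp : ∀ {u w} → u ≈ w → u ∈ κ → w ∈ κ
  κ-resp u≈w u∈ = trans (frobenius-cong (suc period) (sym u≈w)) (trans u∈ u≈w)

  κ-add : ∀ {u w} → u ∈ κ → w ∈ κ → u + w ∈ κ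
  κ-add u∈ w∈ = trans (frobenius-+ (suc period) _ _) (+-cong u∈ w∈)

  κ-neg : ∀ {u} → u ∈ κ → - u ∈ κ
  κ-neg u∈ = trans (frobenius-neg (suc period) _) (-‿cong u∈)

  κ-frobenius : ∀ i {u} → u ∈ κ → frobenius i u ∈ κ
  κ-frobenius i {u} u∈ = begin
    frobenius (suc period) (frobenius i u)       ≡⟨ ≡.sym (frobenius-∘ (suc period) i u) ⟩
    frobenius (suc period ℕ.+ i) u               ≡⟨ ≡.cong (λ k → frobenius k u) (ℕₚ.+-comm (suc period) i) ⟩
    frobenius (i ℕ.+ suc period) u               ≡⟨ frobenius-∘ i (suc period) u ⟩
    frobenius i (frobenius (suc period) u)       ≈⟨ frobenius-cong i u∈ ⟩
    frobenius i u                                ∎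

  κ-unique : UniqueDigits ValuationRing t κ
  κ-unique {u} {w} {r} u∈ w∈ r∈ eq = x-y≈0⇒x≈y (Dec.decidable-stable ((u - w) ≟ 0#) λ u-w≉0 →
    let val≡ = proj₂ (value u-w≉0) in
    contradiction (⊑-value val≡ (ideal⇒⊑ val-t {1} (r , r∈ , trans (+-congʳ eq)
          (solve 3 (λ w t r → (w :+ t :* r) :- w := t :* :1 :* r) refl w t r)))) λ 1≤k →
        contradiction (≡.subst (+ 1 ℤ.≤_) (κ-value (κ-add u∈ (κ-neg w∈)) val≡) 1≤k) λ { (ℤ.+≤+ ()) })

  -- The Teichmüller representative is the limit of the iterates of y under the power of Frobenius fixing residue classes.
  representative : ∀ {y} → y ∈ ValuationRing → ∃ λ u → u ∈ κ × + 1 ⊑ y - u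
  representative {y} y∈ = u , u∈ , near 0
    where
    P = suc period
    s : ℕ → Carrier
    s n = frobenius (n ℕ.* P) y
    close : ∀ N i → N ℕ.≤ i → + suc N ⊑ s i - s N
    close N i N≤i = ≡.subst (λ i → + suc N ⊑ s i - s N) (proj₂ (ℕₚ.m≤n⇒∃[o]m+o≡n N≤i)) (far (proj₁ (ℕₚ.m≤n⇒∃[o]m+o≡n N≤i)))
      where
      far : ∀ k → + suc N ⊑ s (N ℕ.+ k) - s N
      far k = ⊑-mono (ℤ.+≤+ (s≤s (ℕₚ.m≤m*n N P))) (⊑-resp (begin
          frobenius (N ℕ.* P) (frobenius (k ℕ.* P) y - y)
            ≈⟨ frobenius-sub (N ℕ.* P) (frobenius (k ℕ.* P) y) y ⟩
          frobenius (N ℕ.* P) (frobenius (k ℕ.* P) y) - s N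
            ≡⟨ ≡.cong (_- s N) (≡.trans (≡.sym (frobenius-∘ (N ℕ.* P) (k ℕ.* P) y))
                (≡.cong (λ n → frobenius n y) (≡.sym (ℕₚ.*-distribʳ-+ P N k)))) ⟩
          s (N ℕ.+ k) - s N ∎)
        (⊑-frobenius-improves (N ℕ.* P) (periodic-multiple {P} (periodic-mod y∈) k)))
    cauchy : Cauchy s
    cauchy n = N , λ i j N≤i N≤j → ⊑-mono (ℤₚ.≤-trans (i≤∣i∣ n) (ℤ.+≤+ (ℕₚ.n≤1+n N))) (⊑-resp
        (solve 3 (λ a b e → (a :- e) :+ :- (b :- e) := a :- b) refl (s i) (s j) (s N))
        (⊑-+ (close N i N≤i) (⊑-neg (close N j N≤j))))
      where N = ℤ.∣ n ∣
    limit = complete s cauchy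
    u = proj₁ limit
    near : ∀ N → + suc N ⊑ s N - u
    near N = let M , conv = proj₂ limit (+ suc N) ; i = M ℕ.⊔ N in
      ⊑-resp (solve 3 (λ a b u → :- (a :- b) :+ (a :- u) := b :- u) refl (s i) (s N) u)
        (⊑-+ (⊑-neg (close N i (ℕₚ.m≤n⊔m M N))) (conv i (ℕₚ.m≤m⊔n M N)))
    u∈ : u ∈ κ
    u∈ = x-y≈0⇒x≈y (IsAdic.separated t-adic λ N → ⊑⇒ideal val-t {N}
        (⊑-mono (ℤ.+≤+ (ℕₚ.≤-trans (ℕₚ.≤-reflexive (ℕₚ.*-identityʳ N)) (ℕₚ.n≤1+n N)))
      (⊑-resp (begin
          - frobenius P (s N - u) + (s (suc N) - u)
            ≈⟨ +-congʳ (-‿cong (frobenius-sub P (s N) u)) ⟩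
          - (frobenius P (s N) - frobenius P u) + (s (suc N) - u)
            ≡⟨ ≡.cong (λ z → - (z - frobenius P u) + (s (suc N) - u)) (≡.sym (frobenius-∘ P (N ℕ.* P) y)) ⟩
          - (s (suc N) - frobenius P u) + (s (suc N) - u)
            ≈⟨ solve 3 (λ a b u → :- (a :- b) :+ (a :- u) := b :- u) refl (s (suc N)) (frobenius P u) u ⟩
          frobenius P u - u ∎)
        (⊑-+ (⊑-neg (⊑-frobenius P (near N))) (⊑-mono (ℤ.+≤+ (ℕₚ.n≤1+n (suc N))) (near (suc N)))))))

  κ-digits : IsDigits ValuationRing t κ
  κ-digits = record
    { resp     = κ-resp
    ; integral = κ-integral
    ; exists   = λ {y} y∈ → let u , u∈ , 1⊑ = representative y∈
                                r , r∈ , eq = ⊑⇒ideal val-t {1} 1⊑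
                 in u , r , u∈ , r∈ , trans (solve 2 (λ y u → y := u :+ (y :- u)) refl y u)
                      (+-congˡ (trans eq (*-congʳ (*-identityʳ t))))
    ; unique   = κ-unique
    ; add      = κ-add
    ; zer      = frobenius-zero
    }
    where
    frobenius-zero : frobenius (suc period) 0# ≈ 0#
    frobenius-zero = trans (frobenius-cong (suc period) (sym (-‿inverseʳ 0#)))
      (trans (frobenius-sub (suc period) 0# 0#) (-‿inverseʳ _))

  uniformizer : IsUniformizer ValuationRing t κ
  uniformizer = record
    { adic    = t-adic
    ; radical = λ _ → radical
    ; digits  = κ-digits
    ; power   = κ-frobenius 1
    ; root    = λ {u} u∈ → frobenius period u , κ-frobenius period u∈ , sym u∈
    }

module FunctionFields {c₀ ℓ₀ c ℓ : Level} (em : ExcludedMiddle (c₀ ⊔ ℓ₀ ⊔ c ⊔ ℓ)) {q : ℕ} {K : Field c₀ ℓ₀}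
                      (global : IsGlobalFunctionField (suc q) K) {v : Valuation K} (C : Completion v c ℓ)
                      (_≟_ : ∀ a b → Dec (Field._≈_ (Completion.K̂ C) a b)) where
  open IsGlobalFunctionField global using (prime; characteristic; x; finite)
  open Completion C
  private
    module K where
      open Field K public
      open FieldTheory K public
    module ι = RingMorphisms.IsRingHomomorphism ι-homo
  open Field K̂ hiding (zero)
  open FieldTheory K̂ using (_^_; _·_; AlgebraicOver; sum)
  open FieldLemmas K̂
  open Subrings K̂
  open Summation K̂
  open Spans K̂ _≟_
  open Algebraic K̂ _≟_
  open Adic K̂
  open Valuation v̂
  open ValuedField v̂
  open Valuations K̂ _≟_ v̂
  open IntegerSolver commutativeRing
  open SetoidReasoning setoid

  ι-· : ∀ n → ι (n K.· K.1#) ≈ n · 1#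
  ι-· zero    = ι.0#-homo
  ι-· (suc n) = trans (ι.+-homo K.1# (n K.· K.1#)) (+-cong ι.1#-homo (ι-· n))

  ι-^ : ∀ n a → ι (a K.^ n) ≈ ι a ^ n
  ι-^ zero    a = ι.1#-homo
  ι-^ (suc n) a = trans (ι.*-homo a (a K.^ n)) (*-congˡ (ι-^ n a))

  ι-sum : ∀ {n} (f : Fin n → K.Carrier) → ι (K.sum f) ≈ ∑ (λ i → ι (f i))
  ι-sum {zero}  f = trans ι.0#-homo (sym (∑-nil _))
  ι-sum {suc n} f = trans (ι.+-homo (f zero) (K.sum (λ i → f (suc i))))
    (trans (+-congˡ (ι-sum (λ i → f (suc i)))) (sym (∑-suc _)))

  ι-inverse : ∀ {a} → a K.≉ K.0# → ι a * ι (a K.⁻¹) ≈ 1#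
  ι-inverse {a} a≉0 = trans (sym (ι.*-homo a (a K.⁻¹))) (trans (ι.⟦⟧-cong (K.⁻¹-inverseʳ a≉0)) ι.1#-homo)

  ι-nonzero : ∀ {a} → a K.≉ K.0# → ι a ≉ 0#
  ι-nonzero a≉0 ιa≈0 = 1≉0 (trans (sym (ι-inverse a≉0)) (trans (*-congʳ ιa≈0) (zeroˡ _)))

  ι-⁻¹ : ∀ {a} → a K.≉ K.0# → ι (a K.⁻¹) ≈ (ι a) ⁻¹
  ι-⁻¹ a≉0 = *-cancelˡ (ι-nonzero a≉0) (trans (ι-inverse a≉0) (sym (⁻¹-inverseʳ (ι-nonzero a≉0))))

  char : suc q · 1# ≈ 0#
  char = trans (sym (ι-· (suc q))) (trans (ι.⟦⟧-cong characteristic) ι.0#-homo)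

  open PrimeSubfield K̂ prime char
  open Polynomials K̂ _≟_ prime char
  private module Fp = IsSubfield Fp-isSubfield

  K₀ : Pred Carrier (c₀ ⊔ ℓ)
  K₀ y = ∃ λ a → y ≈ ι a

  K₀-isSubfield : IsSubfield K₀
  K₀-isSubfield = record
    { isSubring = record
      { resp = λ y≈z (a , y≈) → a , trans (sym y≈z) y≈
      ; one  = K.1# , sym ι.1#-homo
      ; add  = λ (a , y≈) (b , z≈) → a K.+ b , trans (+-cong y≈ z≈) (sym (ι.+-homo a b))
      ; neg  = λ (a , y≈) → K.- a , trans (-‿cong y≈) (sym (ι.-‿homo a))
      ; mul  = λ (a , y≈) (b , z≈) → a K.* b , trans (*-cong y≈ z≈) (sym (ι.*-homo a b))
      }
    ; inv = λ y≉0 (a , y≈) → a K.⁻¹ ,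
        trans (⁻¹-cong y≈) (sym (ι-⁻¹ λ a≈0 → y≉0 (trans y≈ (trans (ι.⟦⟧-cong a≈0) ι.0#-homo))))
    }

  X : Carrier
  X = ι x

  generated⇒frac : ∀ {a} → a ∈ K.Generated (x K.≈_) → ι a ∈ Frac X
  generated⇒frac (K.gen x≈a)       = IsSubfield.resp frac-isSubfield (ι.⟦⟧-cong x≈a) (poly⇒frac T∈Polys)
  generated⇒frac K.one             = IsSubfield.resp frac-isSubfield (sym ι.1#-homo) (IsSubfield.one frac-isSubfield)
  generated⇒frac (K.add {a} {b} a∈ b∈) = IsSubfield.resp frac-isSubfield (sym (ι.+-homo a b))
    (IsSubfield.add frac-isSubfield (generated⇒frac a∈) (generated⇒frac b∈))
  generated⇒frac (K.neg {a} a∈)    = IsSubfield.resp frac-isSubfield (sym (ι.-‿homo a))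
      (IsSubfield.neg frac-isSubfield (generated⇒frac a∈))
  generated⇒frac (K.mul {a} {b} a∈ b∈) = IsSubfield.resp frac-isSubfield (sym (ι.*-homo a b))
    (IsSubfield.mul frac-isSubfield (generated⇒frac a∈) (generated⇒frac b∈))
  generated⇒frac (K.inv a≉0 a∈)    = IsSubfield.resp frac-isSubfield (sym (ι-⁻¹ a≉0))
    (IsSubfield.inv frac-isSubfield (ι-nonzero a≉0) (generated⇒frac a∈))
  generated⇒frac (K.resp a≈b a∈)   = IsSubfield.resp frac-isSubfield (ι.⟦⟧-cong a≈b) (generated⇒frac a∈)

  degree : ℕ
  degree = proj₁ finite

  generators : Fin degree → Carrier
  generators i = ι (proj₁ (proj₂ finite) i)

  K₀-span-X : ∀ {y} → y ∈ K₀ → y ∈ Span (Frac X) generators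
  K₀-span-X (a , y≈) = let f , f∈ , a≈ = proj₂ (proj₂ finite) a in
    (λ i → ι (f i)) , (λ i → generated⇒frac (f∈ i)) ,
    trans y≈ (trans (ι.⟦⟧-cong a≈) (trans (ι-sum (λ i → f i K.* proj₁ (proj₂ finite) i))
        (∑-cong λ i → ι.*-homo (f i) (proj₁ (proj₂ finite) i))))

  spanned⇒algebraic : ∀ {s n} {F : Pred Carrier s} {b : Fin n → Carrier} → IsSubfield F →
                      (∀ {y} → y ∈ K₀ → y ∈ Span F b) → K₀ ⊆ AlgebraicOver F
  spanned⇒algebraic {n = n} isF spanned {y} y∈
    with span-dependent (IsSubfield.isSubring isF) {n = n} (powers y)
        (λ i → spanned (IsSubfield.pow K₀-isSubfield (toℕ i) y∈))
  ... | f , f∈ , nz , rel = suc n , f , f∈ , nz , trans (reflexive (≡.sym (∑≡sum _))) rel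

  -- A polynomial relation between T and Y with coefficients in 𝔽_p, read as a polynomial in Y.
  exchange : ∀ {T Y} → (∀ D (n : Fin D → Carrier) → (∀ i → n i ∈ Fp) → ∑ (λ i → n i * T ^ toℕ i) ≈ 0# → ∀ i → n i ≈ 0#) →
             T ∈ AlgebraicOver (Frac Y) → Y ∈ AlgebraicOver (Frac T)
  exchange {T} {Y} transcendental (m , f , f∈ , (i₀ , f≉0) , rel) =
      D , g , (λ j → poly⇒frac (m , poly-combination (λ i → n i j) (λ i → n∈ i j))) , nontrivial ,
      trans (reflexive (≡.sym (∑≡sum (λ j → g j * Y ^ toℕ j)))) (begin
        ∑ (λ j → g j * Y ^ toℕ j)
          ≈⟨ ∑-cong (λ j → ∑-* (Y ^ toℕ j) (λ i → n i j * T ^ toℕ i)) ⟩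
        ∑ (λ j → ∑ (λ i → n i j * T ^ toℕ i * Y ^ toℕ j))
          ≈⟨ ∑-comm (λ j i → n i j * T ^ toℕ i * Y ^ toℕ j) ⟩
        ∑ (λ i → ∑ (λ j → n i j * T ^ toℕ i * Y ^ toℕ j))
          ≈⟨ ∑-cong (λ i → trans (∑-cong λ j → solve 3 (λ n t y → n :* t :* y := (n :* y) :* t) refl (n i j)
              (T ^ toℕ i) (Y ^ toℕ j))
               (trans (sym (∑-* (T ^ toℕ i) (λ j → n i j * Y ^ toℕ j))) (*-congʳ (sym (ef≈ i))))) ⟩
        ∑ (λ i → e * f i * T ^ toℕ i)
          ≈⟨ trans (∑-cong λ i → *-assoc e (f i) (T ^ toℕ i)) (sym (*-∑ e (λ i → f i * T ^ toℕ i))) ⟩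
        e * ∑ (λ i → f i * T ^ toℕ i)
          ≈⟨ trans (*-congˡ (trans (reflexive (∑≡sum (λ i → f i * T ^ toℕ i))) rel)) (zeroʳ e) ⟩
        0# ∎)
    where
    cleared : ∃ λ e → IsDenominator {Y} e × e ∈ Clears f
    cleared = clear-denominators f f∈
    e = proj₁ cleared
    bounded : ∃ λ D → ∀ i → e * f i ∈ Poly Y D
    bounded = common-degree {Y} (λ i D → e * f i ∈ Poly Y D) (λ i → poly-mono) (proj₂ (proj₂ cleared))
    D = proj₁ bounded
    n : Fin m → Fin D → Carrier
    n i = proj₁ (poly-coefficients (proj₂ bounded i))
    n∈ : ∀ i j → n i j ∈ Fp
    n∈ i = proj₁ (proj₂ (poly-coefficients (proj₂ bounded i)))
    ef≈ : ∀ i → e * f i ≈ ∑ (λ j → n i j * Y ^ toℕ j)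
    ef≈ i = proj₂ (proj₂ (poly-coefficients (proj₂ bounded i)))
    g : Fin D → Carrier
    g j = ∑ (λ i → n i j * T ^ toℕ i)
    nontrivial : ∃ λ j → g j ≉ 0#
    nontrivial = helper (Finₚ.any? (λ j → Dec.¬? (n i₀ j ≟ 0#)))
      where
      helper : Dec (∃ λ j → n i₀ j ≉ 0#) → ∃ λ j → g j ≉ 0#
      helper (yes (j , n≉0)) = j , λ g≈0 → n≉0 (transcendental m (λ i → n i j) (λ i → n∈ i j) g≈0 i₀)
      helper (no all0)       = contradiction (*-zero-divisor (proj₂ (proj₁ (proj₂ cleared))) (trans (ef≈ i₀)
        (∑-zero λ j → trans (*-congʳ (Dec.decidable-stable (n i₀ j ≟ 0#) λ n≉0 → all0 (j , n≉0))) (zeroˡ _)))) f≉0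

  module Positive {T : Carrier} (T∈ : T ∈ K₀) {d : ℕ} (val-T : val T ≡ [ + d ]) (d≥1 : 1 ℕ.≤ d) where

    T-adic : IsAdic ValuationRing T
    T-adic = adic val-T d≥1 complete

    open IntegralPolynomials T-adic
    open AdicLemmas T-adic
    private
      module A = IsSubring valuationRing-isSubring
      isFrac : IsSubfield (Frac T)
      isFrac = frac-isSubfield
      isFr : IsSubring (Frac T)
      isFr = IsSubfield.isSubring isFrac

    X-algebraic : X ∈ AlgebraicOver (Frac T)
    X-algebraic = exchange T-transcendental (spanned⇒algebraic frac-isSubfield K₀-span-X T∈)

    abstract
      X-algebra : InFiniteAlgebra isFrac {1} (λ _ → X)
      X-algebra = algebraic⇒finite isFrac (λ _ → X) (λ _ → X-algebraic)

    private
      b : Fin (proj₁ X-algebra) → Carrier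
      b = proj₁ (proj₂ X-algebra)
      b-algebra : IsFiniteAlgebra (Frac T) b
      b-algebra = proj₁ (proj₂ (proj₂ X-algebra))
      X∈ : X ∈ Span (Frac T) b
      X∈ = proj₂ (proj₂ (proj₂ X-algebra)) zero

      fp∈ : ∀ {n} → n ∈ Fp → n ∈ Span (Frac T) b
      fp∈ n∈ = span-resp isFr (*-identityʳ _) (span-scale isFr (poly⇒frac (1 , poly-const n∈))
          (IsFiniteAlgebra.one b-algebra))

      poly∈ : ∀ {D y} → y ∈ Poly X D → y ∈ Span (Frac T) b
      poly∈ (nil y≈0)          = span-resp isFr (sym y≈0) (span-zero isFr)
      poly∈ (horner n∈ y∈ eq)  = span-resp isFr (sym eq) (span-add isFr (fp∈ n∈)
          (algebra-mul isFrac b-algebra X∈ (poly∈ y∈)))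

      frac∈ : ∀ {y} → y ∈ Frac X → y ∈ Span (Frac T) b
      frac∈ {y} (e , (_ , e∈) , e≉0 , (_ , ey∈)) = span-resp isFr
        (trans (sym (*-assoc (e ⁻¹) e y)) (trans (*-congʳ (⁻¹-inverseˡ e≉0)) (*-identityˡ y)))
        (algebra-mul isFrac b-algebra (span-inv isFrac b-algebra e≉0 (poly∈ e∈)) (poly∈ ey∈))

    spanningSet : Fin (proj₁ X-algebra ℕ.* degree) → Carrier
    spanningSet = b ⊗ generators

    K₀-span : ∀ {y} → y ∈ K₀ → y ∈ Span (Frac T) spanningSet
    K₀-span y∈ = let f , f∈ , y≈ = K₀-span-X y∈ in span-resp isFr (sym y≈)
      (span-sum isFr λ i → span-⊗ isFrac (frac∈ (f∈ i)) (span-gen isFr i))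

    K₀-algebraic : K₀ ⊆ AlgebraicOver (Frac T)
    K₀-algebraic = spanned⇒algebraic isFrac K₀-span

    primitive-relation : ∀ D {k} (u f : Fin k → Carrier) → (∀ i → u i ∈ ValuationRing) → (∀ i → f i ∈ Poly T D) →
      (∃ λ i → f i ≉ 0#) → ∑ (λ i → f i * u i) ≈ 0# →
      ∃ λ (n : Fin k → Carrier) → (∀ i → n i ∈ Fp) × (∃ λ i → n i ≉ 0#) × ∑ (λ i → n i * u i) ∈ Ideal ValuationRing T 1
    primitive-relation zero    u f u∈ f∈ (i , f≉0) rel = contradiction (vanishes (f∈ i)) f≉0
      where
      vanishes : ∀ {y} → y ∈ Poly T 0 → y ≈ 0#
      vanishes (nil y≈0) = y≈0
    primitive-relation (suc D) {k} u f u∈ f∈ (i₀ , f≉0) rel = helper (Finₚ.any? (λ i → Dec.¬? (n i ≟ 0#)))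
      where
      n e : Fin k → Carrier
      n i = proj₁ (poly-head (f∈ i))
      e i = proj₁ (proj₂ (poly-head (f∈ i)))
      n∈ : ∀ i → n i ∈ Fp
      n∈ i = proj₁ (proj₂ (proj₂ (poly-head (f∈ i))))
      e∈ : ∀ i → e i ∈ Poly T D
      e∈ i = proj₁ (proj₂ (proj₂ (proj₂ (poly-head (f∈ i)))))
      f≈ : ∀ i → f i ≈ n i + T * e i
      f≈ i = proj₂ (proj₂ (proj₂ (proj₂ (poly-head (f∈ i)))))
      S R : Carrier
      S = ∑ (λ i → n i * u i)
      R = ∑ (λ i → e i * u i)
      S+TR≈0 : S + T * R ≈ 0#
      S+TR≈0 = trans (trans (+-congˡ (*-∑ T (λ i → e i * u i))) (sym (∑-+ (λ i → n i * u i) (λ i → T * (e i * u i)))))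
        (trans (∑-cong λ i → trans (solve 4 (λ n t e u → n :* u :+ t :* (e :* u) := (n :+ t :* e) :* u) refl (n i) T
            (e i) (u i)) (*-congʳ (sym (f≈ i)))) rel)
      helper : Dec (∃ λ i → n i ≉ 0#) →
        ∃ λ (n : Fin k → Carrier) → (∀ i → n i ∈ Fp) × (∃ λ i → n i ≉ 0#) × ∑ (λ i → n i * u i) ∈ Ideal ValuationRing T 1
      helper (yes nz)  = n , n∈ , nz , - R , A.neg (A.∑∈ λ i → A.mul (poly⊆A (e∈ i)) (u∈ i)) ,
        trans (solve 3 (λ S T R → S := (S :+ T :* R) :+ T :* :1 :* :- R) refl S T R)
            (trans (+-congʳ S+TR≈0) (+-identityˡ _))
      helper (no all0) = primitive-relation D u e u∈ e∈ (i₀ , λ e≈0 → f≉0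
          (trans (f≈ i₀) (trans (+-cong (n≈0 i₀) (trans (*-congˡ e≈0) (zeroʳ T))) (+-identityˡ 0#))))
        (*-zero-divisor (IsAdic.π≉0 T-adic) (trans (sym (trans (+-congʳ
            (∑-zero λ i → trans (*-congʳ (n≈0 i)) (zeroˡ _))) (+-identityˡ _))) S+TR≈0))
        where
        n≈0 : ∀ i → n i ≈ 0#
        n≈0 i = Dec.decidable-stable (n i ≟ 0#) λ n≉0 → all0 (i , n≉0)

    private
      RelationMod : ∀ {k} → (Fin k → Carrier) → Set (c ⊔ ℓ)
      RelationMod {k} u = ∃ λ (n : Fin k → Carrier) → (∀ i → n i ∈ Fp) × (∃ λ i → n i ≉ 0#) × ∑ (λ i → n i * u i) ∈
          Ideal ValuationRing T 1

      IndependentMod : ℕ → Set (c₀ ⊔ c ⊔ ℓ)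
      IndependentMod k = ∃ λ (u : Fin k → Carrier) → (∀ i → u i ∈ K₀) × (∀ i → u i ∈ ValuationRing) × ¬ RelationMod u

      bound : ℕ
      bound = proj₁ X-algebra ℕ.* degree

      independent-bounded : ¬ IndependentMod (suc bound)
      independent-bounded (u , u∈K , u∈A , free) = free
        (primitive-relation (proj₁ bounded) u (λ i → e * f i) u∈A (proj₂ bounded)
          (i₀ , *-nonzero (proj₂ (proj₁ (proj₂ cleared))) (proj₂ (proj₁ (proj₂ (proj₂ relation)))))
          (trans (∑-cong λ i → *-assoc e (f i) (u i)) (trans (sym (*-∑ e (λ i → f i * u i)))
              (trans (*-congˡ (proj₂ (proj₂ (proj₂ relation)))) (zeroʳ e)))))
        where
        relation : Dependent (Frac T) u
        relation = span-dependent isFr u (λ i → K₀-span (u∈K i))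
        f = proj₁ relation
        i₀ = proj₁ (proj₁ (proj₂ (proj₂ relation)))
        cleared : ∃ λ e → IsDenominator {T} e × e ∈ Clears f
        cleared = clear-denominators f (proj₁ (proj₂ relation))
        e = proj₁ cleared
        bounded : ∃ λ D → ∀ i → e * f i ∈ Poly T D
        bounded = common-degree {T} (λ i D → e * f i ∈ Poly T D) (λ i → poly-mono) (proj₂ (proj₂ cleared))

    abstract
      maximal : ∃ λ k → IndependentMod k × ¬ IndependentMod (suc k)
      maximal = search (suc bound) 0 ((λ ()) , (λ ()) , (λ ()) , λ { (_ , _ , (() , _) , _) })
                  (≡.subst (¬_ ∘ IndependentMod) (≡.sym (ℕₚ.+-identityʳ (suc bound))) independent-bounded)
        where
        search : ∀ fuel k → IndependentMod k → ¬ IndependentMod (fuel ℕ.+ k) → ∃ λ k → IndependentMod k × ¬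
            IndependentMod (suc k)
        search zero       k good bad = contradiction good bad
        search (suc fuel) k good bad = step (lowerEM (ℓ₀) em)
          where
          step : Dec (IndependentMod (suc k)) → ∃ λ k → IndependentMod k × ¬ IndependentMod (suc k)
          step (yes better) = search fuel (suc k) better (≡.subst (¬_ ∘ IndependentMod) (≡.sym (ℕₚ.+-suc fuel k)) bad)
          step (no stop)    = k , good , stop

    module Reduction {k : ℕ} (u : Fin k → Carrier) (u∈K : ∀ i → u i ∈ K₀) (u∈A : ∀ i → u i ∈ ValuationRing)
                     (free : ¬ RelationMod u) (full : ¬ IndependentMod (suc k)) where
      Combination : Pred Carrier (c ⊔ ℓ)
      Combination z = ∃ λ (a : Fin k → Carrier) → (∀ i → a i ∈ Fp) × z ≈ ∑ (λ i → a i * u i)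
      combos : Covered _≈_ Combination
      combos = combinations-covered u (fp-covered {T})
      extend : Carrier → Fin (suc k) → Carrier
      extend z zero    = z
      extend z (suc i) = u i
      relation : ∀ {z} → z ∈ K₀ → z ∈ ValuationRing → RelationMod (extend z)
      relation {z} z∈K z∈A = helper (lowerEM (c₀ ⊔ ℓ₀) em)
        where
        helper : Dec (RelationMod (extend z)) → RelationMod (extend z)
        helper (yes rel) = rel
        helper (no ¬rel) = ⊥-elim (full (extend z , (λ { zero → z∈K ; (suc i) → u∈K i }) ,
            (λ { zero → z∈A ; (suc i) → u∈A i }) , ¬rel))

      reduce-K : ∀ {z} → z ∈ K₀ → z ∈ ValuationRing → ∃₂ λ w r → w ∈ Combination × r ∈ ValuationRing × z ≈ w + T * r
      reduce-K {z} z∈K z∈A = - ∑ (λ i → n₀ ⁻¹ * n (suc i) * u i) , n₀ ⁻¹ * r ,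
          ((λ i → - (n₀ ⁻¹ * n (suc i))) , (λ i → Fp.neg (Fp.mul (Fp.inv n₀≉0 (n∈ zero)) (n∈ (suc i)))) ,
            trans (sym (∑-neg (λ i → n₀ ⁻¹ * n (suc i) * u i))) (∑-cong λ i → solve 2
                (λ a u → :- (a :* u) := :- a :* u) refl (n₀ ⁻¹ * n (suc i)) (u i))) ,
          A.mul (fp⊆A (Fp.inv n₀≉0 (n∈ zero))) r∈ , (begin
            z                                               ≈⟨ trans (*-congʳ (⁻¹-inverseˡ n₀≉0)) (*-identityˡ z) ⟨
            n₀ ⁻¹ * n₀ * z                                  ≈⟨ solve 4
                (λ i n z S → i :* n :* z := :- (i :* S) :+ i :* (n :* z :+ S)) refl (n₀ ⁻¹) n₀ z S ⟩
            - (n₀ ⁻¹ * S) + n₀ ⁻¹ * (n₀ * z + S)            ≈⟨ +-cong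
                (-‿cong (trans (*-∑ (n₀ ⁻¹) (λ i → n (suc i) * u i)) (∑-cong λ i → sym (*-assoc _ _ _))))
                                                                 (*-congˡ (trans (sym (∑-suc (λ i → n i * extend z
                                                                     i))) (trans rel (*-congʳ (*-identityʳ T))))) ⟩
            - ∑ (λ i → n₀ ⁻¹ * n (suc i) * u i) + n₀ ⁻¹ * (T * r)   ≈⟨ +-congˡ
                (solve 3 (λ i t r → i :* (t :* r) := t :* (i :* r)) refl (n₀ ⁻¹) T r) ⟩
            - ∑ (λ i → n₀ ⁻¹ * n (suc i) * u i) + T * (n₀ ⁻¹ * r)   ∎)
        where
        found : RelationMod (extend z)
        found = relation z∈K z∈A
        n = proj₁ found
        n∈ = proj₁ (proj₂ found)
        n₀ = n zero
        S = ∑ (λ i → n (suc i) * u i)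
        r = proj₁ (proj₂ (proj₂ (proj₂ found)))
        r∈ = proj₁ (proj₂ (proj₂ (proj₂ (proj₂ found))))
        rel : ∑ (λ i → n i * extend z i) ≈ T ^ 1 * r
        rel = proj₂ (proj₂ (proj₂ (proj₂ (proj₂ found))))
        n₀≉0 : n₀ ≉ 0#
        n₀≉0 n₀≈0 = free (n ∘ suc , n∈ ∘ suc , nonzero-tail (proj₁ (proj₁ (proj₂ (proj₂ found))))
            (proj₂ (proj₁ (proj₂ (proj₂ found)))) , r , r∈ ,
            trans (sym (trans (∑-suc (λ i → n i * extend z i)) (trans (+-congʳ (trans (*-congʳ n₀≈0) (zeroˡ z)))
                (+-identityˡ S)))) rel)
          where
          nonzero-tail : ∀ i → n i ≉ 0# → ∃ λ i → n (suc i) ≉ 0#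
          nonzero-tail zero    n≉0 = contradiction n₀≈0 n≉0
          nonzero-tail (suc i) n≉0 = i , n≉0

      reduce : ∀ {y} → y ∈ ValuationRing → ∃₂ λ w r → w ∈ Combination × r ∈ ValuationRing × y ≈ w + T * r
      reduce {y} y∈ = approximate (dense y (+ d))
        where
        approximate : (∃ λ a → + d ⊑ y - ι a) → ∃₂ λ w r → w ∈ Combination × r ∈ ValuationRing × y ≈ w + T * r
        approximate (a , close) = sum-up (reduce-K (a , refl) ιa∈)
            (⊑⇒ideal val-T {1} (≡.subst (_⊑ y - ι a) (≡.cong +_ (≡.sym (ℕₚ.+-identityʳ d))) close))
          where
          ιa∈ : ι a ∈ ValuationRing
          ιa∈ = ⊑-resp (solve 2 (λ y a → y :- (y :- a) := a) refl y (ι a)) (A.add y∈ (A.neg (⊑-mono (ℤ.+≤+ z≤n) close)))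
          sum-up : (∃₂ λ w r → w ∈ Combination × r ∈ ValuationRing × ι a ≈ w + T * r) → y - ι a ∈ Ideal ValuationRing T 1 →
                   ∃₂ λ w r → w ∈ Combination × r ∈ ValuationRing × y ≈ w + T * r
          sum-up (w , r , w∈ , r∈ , ιa≈) (s , s∈ , rest≈) = w , r + s , w∈ , A.add r∈ s∈ , (begin
            y                          ≈⟨ solve 2 (λ y a → y := a :+ (y :- a)) refl y (ι a) ⟩
            ι a + (y - ι a)            ≈⟨ +-cong ιa≈ (trans rest≈ (*-congʳ (*-identityʳ T))) ⟩
            (w + T * r) + T * s        ≈⟨ solve 4 (λ w t r s → (w :+ t :* r) :+ t :* s := w :+ t :* (r :+ s)) refl w T r s ⟩
            w + T * (r + s)            ∎)

      finite-quotient : FiniteQuotient K̂ ValuationRing T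
      finite-quotient = proj₁ combos , λ y y∈ → hit (reduce y∈)
        where
        hit : ∀ {y} → (∃₂ λ w r → w ∈ Combination × r ∈ ValuationRing × y ≈ w + T * r) →
              Any (λ z → ∃ λ r → r ∈ ValuationRing × y ≈ z + T * r) (proj₁ combos)
        hit (w , r , w∈ , r∈ , y≈) = Any.map (λ w≈ → r , r∈ , trans y≈ (+-congʳ w≈)) (proj₂ combos w w∈)

    residues-finite : FiniteQuotient K̂ ValuationRing T
    residues-finite = conclude maximal
      where
      conclude : (∃ λ k → IndependentMod k × ¬ IndependentMod (suc k)) → FiniteQuotient K̂ ValuationRing T
      conclude (_ , (u , u∈K , u∈A , free) , full) = Reduction.finite-quotient u u∈K u∈A free full

module Criterion {c ℓ : Level} (𝔽 : Field c ℓ) (em : ExcludedMiddle (c ⊔ ℓ)) (_≟_ : ∀ a b → Dec (Field._≈_ 𝔽 a b))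
                 {q : ℕ} (pr : Prime (suc q))
                 (char : Field._≈_ 𝔽 (FieldTheory._·_ 𝔽 (suc q) (Field.1# 𝔽)) (Field.0# 𝔽)) where
  open Field 𝔽 hiding (zero)
  open FieldTheory 𝔽 using (_^_; _·_; AlgebraicOver)
  open Subrings 𝔽
  open Summation 𝔽
  open Spans 𝔽 _≟_
  open Adic 𝔽
  open PrimeSubfield 𝔽 pr char
  open Polynomials 𝔽 _≟_ pr char using (Frac; module IntegralPolynomials)
  open Cartier 𝔽 _≟_ pr char using (IsUniformizer; module CartierLemmas)
  open Automata 𝔽
  open AutomaticSequences 𝔽 em (suc q)
  open AutomaticSeries 𝔽 em _≟_ pr char
  open AlgebraicResidues 𝔽 em _≟_ pr char

  module _ {a k : Level} {A : Pred Carrier a} {t : Carrier} {κ : Pred Carrier k} (uniformizer : IsUniformizer A t κ)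
           {period : ℕ} (periodic : ∀ {u} → u ∈ κ → frobenius (suc period) u ≈ u)
           (ρ : Carrier → Carrier) (ρ-cong : ∀ {u w} → u ≈ w → ρ u ≈ ρ w) (ρ∈ : ∀ u → ρ u ∈ Fp)
           (ρ-+ : ∀ {u w} → u ∈ κ → w ∈ κ → ρ (u + w) ≈ ρ u + ρ w) (ρ-zero : ρ 0# ≈ 0#)
           (ρ-nonzero : ∃ λ u → u ∈ κ × ρ u ≉ 0#)
           {π : Carrier} (adic : IsAdic A π) {g : Level} {Γ : Pred Carrier g} (digits : IsDigits A π Γ)
           {r : ℕ} (γ : Fin r → Carrier) (γ∈ : ∀ i → γ i ∈ Γ) (independent : Independent Fp γ) (spanning : Γ ⊆ Span Fp γ)
           {s : Level} {M : Pred Carrier s} (isM : IsSubfield M) (M-closed : AlgebraicOver M ⊆ M)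
           (M⊆ : M ⊆ AlgebraicOver (Frac t)) (π∈M : π ∈ M) (γ∈M : ∀ i → γ i ∈ M) where
    open IsAdic adic using (π≉0; complete)
    open AdicLemmas adic
    open IntegralPolynomials adic using (fp⊆A)
    open CartierLemmas uniformizer
    private module M = IsSubfield isM

    θ : Carrier → Carrier
    θ z = ρ (residue z)

    θ-nonzero : ∃ λ w → θ w ≉ 0#
    θ-nonzero = let u , u∈ , ρu≉0 = ρ-nonzero in
      u * (t ⁻¹) ^ 1 , λ θ≈0 → ρu≉0 (trans (ρ-cong (sym (residue-monomial 0 u∈))) θ≈0)

    open Duality 𝔽 _≟_ pr char
    private
      θ-cong : ∀ {x y} → x ≈ y → θ x ≈ θ y
      θ-cong x≈y = ρ-cong (residue-cong x≈y)
      θ-+ : ∀ x y → θ (x + y) ≈ θ x + θ y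
      θ-+ x y = trans (ρ-cong (residue-+ x y)) (ρ-+ (residue∈ x) (residue∈ y))
      θ∈ : ∀ x → θ x ∈ Fp
      θ∈ x = ρ∈ (residue x)
      θ-integral : ∀ {x} → x ∈ A → θ x ≈ 0#
      θ-integral x∈ = trans (ρ-cong (residue-integral x∈)) ρ-zero

    pairing-automatic : ∀ {h} → h ∈ M → Automatic (suc q) (λ n → θ (h * (π ⁻¹) ^ suc n))
    pairing-automatic h∈ = algebraic-residues-automatic uniformizer {period} periodic ρ ρ-cong π≉0 (M⊆ π∈M) (M⊆ h∈)

    module _ {d : ℕ → Carrier} {x : Carrier} (d∈ : ∀ n → d n ∈ Γ) (series : IsSeries A π d x) where

      private
        u : Fin r → ℕ → Carrier
        u j n = proj₁ (spanning (d∈ n)) j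
        u∈ : ∀ j n → u j n ∈ Fp
        u∈ j n = proj₁ (proj₂ (spanning (d∈ n))) j
        d≈ : ∀ n → d n ≈ ∑ (λ j → u j n * γ j)
        d≈ n = proj₂ (proj₂ (spanning (d∈ n)))

      algebraic⇒automatic : x ∈ M → Automatic (suc q) d
      algebraic⇒automatic x∈ = automatic-coordinates⇒automatic γ {d} {u} d≈ λ j → transfer j
        (coordinate-pairing adic digits γ∈ independent spanning θ θ-cong θ-+ θ∈ θ-integral θ-nonzero isM π∈M γ∈M
          (λ {z} z∈ → M-closed (automatic-series⇒algebraic isM adic π∈M (λ n → θ∈ _) (pairing-automatic z∈)
            (functional-series adic digits γ∈ independent spanning θ θ-cong θ-+ θ∈ θ-integral z)))
          x∈ u∈ (series-cong d≈ refl series) j)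
        where
        transfer : ∀ j → (∃ λ h → h ∈ M × ∀ n → u j n ≈ θ (h * (π ⁻¹) ^ suc n)) → Automatic (suc q) (u j)
        transfer j (h , h∈ , eq) = automatic-resp (λ n → sym (eq n)) (pairing-automatic h∈)

      automatic⇒algebraic : Automatic (suc q) d → x ∈ M
      automatic⇒algebraic auto = M.resp (sym x≈) (M.∑∈ λ j → M.mul (γ∈M j)
          (M-closed (automatic-series⇒algebraic isM adic π∈M (u∈ j)
            (automatic⇒automatic-coordinates γ {d} {u} d≈ independent u∈ auto j) (X-series j))))
        where
        X : Fin r → Carrier
        X j = proj₁ (complete (u j) (fp⊆A ∘ u∈ j))
        X-series : ∀ j → IsSeries A π (u j) (X j)
        X-series j = proj₂ (complete (u j) (fp⊆A ∘ u∈ j))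
        x≈ : x ≈ ∑ (λ j → γ j * X j)
        x≈ = series-unique (series-cong d≈ refl series)
          (series-cong (λ n → ∑-cong λ j → *-comm _ _) refl
            (series-∑ λ j → series-* (IsDigits.integral digits (γ∈ j)) (X-series j)))

module PropertyBTheorem {c ℓ c′ ℓ′ g : Level} (em : ExcludedMiddle (c ⊔ ℓ ⊔ c′ ⊔ ℓ′ ⊔ g)) {q : ℕ} {K : Field c ℓ}
                        (global : IsGlobalFunctionField (suc q) K) {v : Valuation K} (normalized : ValuedField.Normalized v)
                        (C : Completion v c′ ℓ′) where
  open IsGlobalFunctionField global using () renaming (prime to pr)
  open Completion C
  open Field K̂ hiding (zero)
  open FieldTheory K̂ using (_^_; _^ℤ_; AlgebraicOver)
  open FieldLemmas K̂
  open Subrings K̂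
  open Adic K̂
  open Valuation v̂
  open ValuedField v̂
  open Automata K̂
  open SetoidReasoning setoid

  private
    p : ℕ
    p = suc q

    em′ : ExcludedMiddle (c′ ⊔ ℓ′)
    em′ = lowerEM (c ⊔ ℓ ⊔ g) em

    _≟_ : ∀ a b → Dec (a ≈ b)
    a ≟ b = lowerEM (c ⊔ ℓ ⊔ c′ ⊔ g) em

  open Summation K̂
  open Spans K̂ _≟_
  open Algebraic K̂ _≟_
  open Valuations K̂ _≟_ v̂
  open FunctionFields {c} {ℓ} {c′} {ℓ′} (lowerEM g em) global C _≟_
  open PrimeSubfield K̂ pr char
  open Polynomials K̂ _≟_ pr char using (Frac; frac-isSubfield)
  open FiniteDigits K̂ em′ _≟_ pr char
  open AutomaticSequences K̂ em′ p

  M-isSubfield : IsSubfield AlgebraicOverK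
  M-isSubfield = algebraic-isSubfield K₀-isSubfield

  private module M = IsSubfield M-isSubfield

  M-closed : AlgebraicOver AlgebraicOverK ⊆ AlgebraicOverK
  M-closed = algebraic-trans K₀-isSubfield

  element : ∀ d → ∃ λ T → T ∈ K₀ × val T ≡ [ + d ]
  element d = let a , val-a = normalized (+ d) in ι a , (a , refl) , ≡.trans (extends a) val-a

  module _ {t : Carrier} (t∈ : t ∈ K₀) (val-t : val t ≡ [ + 1 ]) where

    private
      module P = Positive t∈ val-t (s≤s z≤n)
      open Teichmueller K̂ _≟_ pr char v̂ complete val-t P.residues-finite

    M⊆algebraic : AlgebraicOverK ⊆ AlgebraicOver (Frac t)
    M⊆algebraic y∈ = algebraic-trans frac-isSubfield (algebraic-mono {F = K₀} (λ {y} → P.K₀-algebraic {y}) y∈)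

    κ-basis : ∃₂ λ r (d : Fin r → Carrier) → (∀ i → d i ∈ κ) × Independent Fp d × κ ⊆ Span Fp d
    κ-basis = Fp-basis (enumerate-digits valuationRing-isSubring κ-digits (λ _ → em′) P.residues-finite)

    module _ {π : Carrier} {d : ℕ} (val-π : val π ≡ [ + d ]) (d≥1 : 1 ℕ.≤ d) {Γ : Pred Carrier g}
             (digits : IsDigits ValuationRing π Γ) (π∈M : π ∈ AlgebraicOverK) (Γ⊆M : Γ ⊆ AlgebraicOverK)
             {r : ℕ} (γ : Fin r → Carrier) (γ∈ : ∀ i → γ i ∈ Γ) (independent : Independent Fp γ) (spanning : Γ ⊆ Span Fp γ)
             {a : ℕ → Carrier} {x : Carrier} (a∈ : ∀ n → a n ∈ Γ) (series : IsSeries ValuationRing π a x) where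

      private
        with-basis : (∃₂ λ r (e : Fin r → Carrier) → (∀ i → e i ∈ κ) × Independent Fp e × κ ⊆ Span Fp e) →
                     (x ∈ AlgebraicOverK → Automatic p a) × (Automatic p a → x ∈ AlgebraicOverK)
        with-basis (zero , e , e∈ , ind , span) = ⊥-elim (1≉0 (trans (proj₂ (proj₂ (span one∈κ))) (∑-nil _)))
          where
          one∈κ : 1# ∈ κ
          one∈κ = trans (frobenius≈^ (suc period) 1#) (1^n≈1 (p ℕ.^ suc period))
        with-basis (suc r , e , e∈ , ind , span) =
            algebraic⇒automatic uniformizer {period} (λ u∈ → u∈) coordinate coordinate-cong coordinate∈ ρ-+ ρ-zero ρ-nonzero
              (adic val-π d≥1 complete) digits γ γ∈ independent spanning M-isSubfield M-closed M⊆algebraic π∈M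
                  (λ i → Γ⊆M (γ∈ i)) a∈ series
          , automatic⇒algebraic uniformizer {period} (λ u∈ → u∈) coordinate coordinate-cong coordinate∈ ρ-+ ρ-zero ρ-nonzero
              (adic val-π d≥1 complete) digits γ γ∈ independent spanning M-isSubfield M-closed M⊆algebraic π∈M
                  (λ i → Γ⊆M (γ∈ i)) a∈ series
          where
          open Coordinates ind zero
          open Criterion K̂ em′ _≟_ pr char
          ρ-+ : ∀ {u w} → u ∈ κ → w ∈ κ → coordinate (u + w) ≈ coordinate u + coordinate w
          ρ-+ u∈ w∈ = coordinate-+ (span u∈) (span w∈)
          ρ-zero : coordinate 0# ≈ 0#
          ρ-zero = coordinate-combination (λ _ → 0#) (λ _ → IsSubfield.zer Fp-isSubfield) (sym (∑-zero λ i → zeroˡ _))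
          ρ-nonzero : ∃ λ u → u ∈ κ × coordinate u ≉ 0#
          ρ-nonzero = e zero , e∈ zero , λ eq → 1≉0 (trans (sym coordinate-basis) eq)

      criterion : (x ∈ AlgebraicOverK → Automatic p a) × (Automatic p a → x ∈ AlgebraicOverK)
      criterion = with-basis κ-basis

  module _ {π : Carrier} {d : ℕ} (val-π : val π ≡ [ + d ]) (d≥1 : 1 ℕ.≤ d) {Γ : Pred Carrier g}
           (reps : IsCompleteRepresentatives Γ π) (closed : AdditivelyClosed Γ) where

    private
      digits : IsDigits ValuationRing π Γ
      digits = completeRepresentatives⇒digits val-π d≥1 complete reps closed {p} char
      module Γ = IsDigits digits
      π-adic : IsAdic ValuationRing π
      π-adic = adic val-π d≥1 complete
      open AdicLemmas π-adic

    quotient-finite : FiniteQuotient K̂ ValuationRing π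
    quotient-finite = transfer (element d)
      where
      transfer : (∃ λ T → T ∈ K₀ × val T ≡ [ + d ]) → FiniteQuotient K̂ ValuationRing π
      transfer (T , T∈ , val-T) = change (Positive.residues-finite T∈ val-T d≥1)
        (⊑⇒ideal val-π {1} (⊑-mono (ℤₚ.≤-reflexive (≡.cong +_ (ℕₚ.*-identityˡ d))) (⊑-refl val-T)))
        where
        change : FiniteQuotient K̂ ValuationRing T → T ∈ Ideal ValuationRing π 1 → FiniteQuotient K̂ ValuationRing π
        change (zs , cover) (w , w∈ , T≈) = zs , λ y y∈ → Any.map (λ (r , r∈ , y≈) →
          w * r , IsSubring.mul valuationRing-isSubring w∈ r∈ ,
          trans y≈ (+-congˡ (trans (*-congʳ (trans T≈ (*-congʳ (*-identityʳ π)))) (*-assoc π w r)))) (cover y y∈)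

    Γ-basis : ∃₂ λ r (γ : Fin r → Carrier) → (∀ i → γ i ∈ Γ) × Independent Fp γ × Γ ⊆ Span Fp γ
    Γ-basis = Fp-basis (enumerate-digits valuationRing-isSubring digits (λ _ → lowerEM (c ⊔ ℓ) em) quotient-finite)

    algebraic⇒propertyB : π ∈ AlgebraicOverK → (∀ γ → γ ∈ Γ → γ ∈ AlgebraicOverK) → PropertyB p Γ π
    algebraic⇒propertyB π∈M Γ⊆M x m a expansion = combine′ (element 1) Γ-basis
        (expansion⇒series val-π d≥1 complete {m = m} Γ.integral expansion)
      where
      u = π ^ℤ m
      u≉0 : u ≉ 0#
      u≉0 = π^ℤ-nonzero val-π d≥1 complete m
      u∈ : ∀ m → π ^ℤ m ∈ AlgebraicOverK
      u∈ (+ n)    = M.pow n π∈M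
      u∈ -[1+ n ] = M.pow (suc n) (M.inv (nonzero val-π) π∈M)
      combine′ : (∃ λ t → t ∈ K₀ × val t ≡ [ + 1 ]) →
        (∃₂ λ r (γ : Fin r → Carrier) → (∀ i → γ i ∈ Γ) × Independent Fp γ × Γ ⊆ Span Fp γ) →
        (∃ λ y → IsSeries ValuationRing π a y × x ≈ u * y) → x ∈ AlgebraicOverK ⇔ Automatic p a
      combine′ (t , t∈ , val-t) (r , γ , γ∈ , ind , span) (y , series , x≈) = mk⇔
        (λ x∈ → proj₁ equivalence (M.resp (trans (*-congˡ x≈) (trans (sym (*-assoc _ _ _))
            (trans (*-congʳ (⁻¹-inverseˡ u≉0)) (*-identityˡ y))))
          (M.mul (M.inv u≉0 (u∈ m)) x∈)))
        (λ auto → M.resp (sym x≈) (M.mul (u∈ m) (proj₂ equivalence auto)))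
        where
        equivalence : (y ∈ AlgebraicOverK → Automatic p a) × (Automatic p a → y ∈ AlgebraicOverK)
        equivalence = criterion t∈ val-t val-π d≥1 digits π∈M (λ {γ} → Γ⊆M γ) γ γ∈ ind span (proj₁ expansion) series

    private
      impulse : Carrier → ℕ → Carrier
      impulse γ zero    = γ
      impulse γ (suc _) = 0#

      impulse-automatic : ∀ γ → Automatic p (impulse γ)
      impulse-automatic γ = closed-covered⇒automatic {S = S}
        (λ { s≗t (inj₁ eq) → inj₁ (≗-trans (≗-sym s≗t) eq) ; s≗t (inj₂ eq) → inj₂ (≗-trans (≗-sym s≗t) eq) })
        decimated
        (impulse γ ∷ (λ _ → 0#) ∷ [] , λ { s (inj₁ eq) → here eq ; s (inj₂ eq) → there (here eq) })
        {impulse γ} (inj₁ λ _ → refl)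
        where
        S : Pred Sequence ℓ′
        S s = (s ≗ impulse γ) ⊎ (s ≗ λ _ → 0#)
        decimated : ∀ {s} j → j ℕ.< p → s ∈ S → decimate j s ∈ S
        decimated zero    _ (inj₁ eq) = inj₁ λ { zero → eq 0 ; (suc n) → eq _ }
        decimated (suc j) _ (inj₁ eq) = inj₂ λ n → trans (eq _) (reflexive (≡.cong (impulse γ) (ℕₚ.+-suc (n ℕ.* p) j)))
        decimated j       _ (inj₂ eq) = inj₂ λ n → eq _

      impulse-algebraic : PropertyB p Γ π → ∀ {γ} → γ ∈ Γ → ∀ m → π ^ℤ m * γ ∈ AlgebraicOverK
      impulse-algebraic B {γ} γ∈ m = Equivalence.from
        (B (π ^ℤ m * γ) m (impulse γ) ((λ { zero → γ∈ ; (suc n) → Γ.zer }) , converges-series val-π d≥1 complete m series))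
        (impulse-automatic γ)
        where
        series : IsSeries ValuationRing π (impulse γ) γ
        series = series-cong (λ _ → refl) (trans (+-congˡ (zeroʳ π)) (+-identityʳ γ))
          (series-cons {impulse γ} (Γ.integral γ∈) series-zero)

    propertyB⇒algebraic : PropertyB p Γ π → π ∈ AlgebraicOverK × (∀ γ → γ ∈ Γ → γ ∈ AlgebraicOverK)
    propertyB⇒algebraic B = π∈ (Γ.exists (IsSubring.one valuationRing-isSubring)) , λ γ γ∈ → digit∈ γ∈
      where
      digit∈ : ∀ {γ} → γ ∈ Γ → γ ∈ AlgebraicOverK
      digit∈ γ∈ = M.resp (*-identityˡ _) (impulse-algebraic B γ∈ (+ 0))
      π∈ : (∃₂ λ γ r → γ ∈ Γ × r ∈ ValuationRing × 1# ≈ γ + π * r) → π ∈ AlgebraicOverK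
      π∈ (γ , r , γ∈ , r∈ , 1≈) = M.resp
          (trans (*-congʳ (*-congʳ (*-identityʳ π))) (trans (*-assoc _ _ _)
              (trans (*-congˡ (⁻¹-inverseʳ γ≉0)) (*-identityʳ π))))
          (M.mul (impulse-algebraic B γ∈ (+ 1)) (M.inv γ≉0 (digit∈ γ∈)))
        where
        γ≉0 : γ ≉ 0#
        γ≉0 γ≈0 = 1∉π r∈ (trans 1≈ (trans (+-congʳ γ≈0) (+-identityˡ _)))

theorem3p5 : ∀ {c ℓ c′ ℓ′ g : Level} →
    ExcludedMiddle (c ⊔ ℓ ⊔ c′ ⊔ ℓ′ ⊔ g) →
    (p : ℕ) (K : Field c ℓ) → IsGlobalFunctionField p K →
    (v : Valuation K) → ValuedField.Nontrivial v → ValuedField.Normalized v →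
    (C : Completion v c′ ℓ′) →
    let open Completion C
        open ValuedField v̂
    in (π : Field.Carrier K̂) → PositiveValuation π →
       (Γ : Pred (Field.Carrier K̂) g) → IsCompleteRepresentatives Γ π →
       AdditivelyClosed Γ →
       PropertyB p Γ π ⇔ (π ∈ AlgebraicOverK × (∀ γ → γ ∈ Γ → γ ∈ AlgebraicOverK))
theorem3p5 em zero    K global = ⊥-elim (Primality.¬prime[0] (IsGlobalFunctionField.prime global))
theorem3p5 {c} {ℓ} {c′} {ℓ′} {g} em (suc q) K global v _ normalized C π (+ d , ℤ.+<+ d≥1 , val-π) Γ reps closed =
  mk⇔ (propertyB⇒algebraic val-π d≥1 reps closed) (λ (π∈ , Γ⊆) → algebraic⇒propertyB val-π d≥1 reps closed π∈ Γ⊆)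
  where open PropertyBTheorem {c} {ℓ} {c′} {ℓ′} {g} em global normalized C
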